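{- There is a constant $C>0$ such that for all integers $r\geq 2$, in every $r$-connected graph $G$, any two longest cycles $C_1,C_2$ of $G$ satisfy $|V(C_1)\cap V(C_2)|\geq C r^{5/8}$.
   Context: A longest cycle in a graph is a cycle of maximum possible length among all cycles in the graph. Graphs are finite. -}

module Defs where

open import Data.Nat using (ℕ; _≤_; _<_; _+_)
open import Data.Fin using (Fin; _≟_)
open import Data.Fin.Subset using (Subset; _∈_; _∉_; ∣_∣)
open import Data.List using (List; []; _∷_; _++_; [_]; length; filter)
open import Data.List.Relation.Unary.Unique.Propositional using (Unique)
open import Data.Product using (_×_; Σ; ∃)
open import Data.Unit using (⊤)
open import Data.Empty using (⊥)
open import Relation.Nullary using (¬_)
open import Relation.Binary.PropositionalEquality using (_≡_)

record Graph : Set₁ where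
  field
    n      : ℕ
    Adj    : Fin n → Fin n → Set
    sym    : ∀ {u v} → Adj u v → Adj v u
    irrefl : ∀ {u} → ¬ Adj u u

open Graph public

module _ (G : Graph) where

  ConsecAdj : List (Fin (n G)) → Set
  ConsecAdj []             = ⊤
  ConsecAdj (x ∷ [])       = ⊤
  ConsecAdj (x ∷ y ∷ xs)   = Adj G x y × ConsecAdj (y ∷ xs)

  data WalkAvoiding (S : Subset (n G)) : Fin (n G) → Fin (n G) → Set where
    here : ∀ {u} → u ∉ S → WalkAvoiding S u u
    step : ∀ {u w v} → u ∉ S → Adj G u w → WalkAvoiding S w v → WalkAvoiding S u v

  ConnectedAvoiding : Subset (n G) → Set
  ConnectedAvoiding S = ∀ u v → u ∉ S → v ∉ S → WalkAvoiding S u v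

  Connectedness : ℕ → Set
  Connectedness r = r < n G × (∀ (S : Subset (n G)) → ∣ S ∣ < r → ConnectedAvoiding S)

  IsCycle : List (Fin (n G)) → Set
  IsCycle []         = ⊥
  IsCycle (x ∷ rest) = 3 ≤ length (x ∷ rest) × Unique (x ∷ rest) × ConsecAdj ((x ∷ rest) ++ [ x ])

  IsLongestCycle : List (Fin (n G)) → Set
  IsLongestCycle c = IsCycle c × (∀ d → IsCycle d → length d ≤ length c)

-- |V(C₁) ∩ V(C₂)| for vertex sequences of cycles (entries of C₁ are distinct)
commonVertices : ∀ {m} → List (Fin m) → List (Fin m) → ℕ
commonVertices {m} c₁ c₂ = length (filter (λ x → x ∈? c₂) c₁)
  where open import Data.List.Membership.DecPropositional (_≟_ {n = m}) using (_∈?_)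

{-# OPTIONS --safe #-}
-- If the two cycles C and D share m vertices, Menger's theorem gives r ∸ m disjoint paths between C ∖ D
-- and D ∖ C.  Cut C and D at the common vertices into segments and regard every path as an edge joining
-- a segment of C to a segment of D.  Exchanging arcs between C and D shows that
--   (1) no two edges join the same pair of segments, and
--   (2) no 4-cycle e, f, g, h (e, f on one segment of C, h, g on another; e, h on one segment of D, f, g
--       on another) has e before f and h before g on C, and e before h and f before g on D:
-- otherwise the two cycles could be rerouted, each losing the arcs that the other gains, with larger
-- total length.
--
-- To bound the number k of edges, count 4-cycles by the signs of the two orders.  For every pair of
-- segments, the number of concordant pairs of common neighbours minus that of discordant ones is a
-- square up to lower order terms, so by (2) nearly every 4-cycle is concordant on exactly one side and
-- nearly all these squares vanish.  If each segment of C is cut into two halves, the same holds after the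
-- cut, which is possible only if few 4-cycles are separated by the cut.  After log k halvings no 4-cycle
-- is left; hence there are few of them and, by Cauchy–Schwarz, k² = O(m³ log² k), more than enough.

module Submission where

open import Defs hiding (sym)
open import Data.Nat
open import Data.Nat.Properties
open import Data.Nat.Solver using (module +-*-Solver)
open +-*-Solver using (solve; _:=_; _:+_; _:*_; con)
open import Data.Fin using (Fin)
import Data.Fin as Fin
import Data.Fin.Properties as Fin
open import Data.Fin.Subset using (Subset; inside; outside; ∣_∣)
import Data.Fin.Subset as Subset
import Data.Fin.Subset.Properties as Subset
open import Data.Vec using ([]; _∷_)
import Data.Vec as Vec
open import Data.List using (List; []; _∷_; [_]; _++_; length; lookup; map; filter; reverse; deduplicate; downFrom; allFin; cartesianProduct)
open import Data.List.Properties using (++-assoc; ++-identityʳ; length-++; length-map; length-reverse; length-tabulate; unfold-reverse; reverse-++; filter-++)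
open import Data.List.Membership.Propositional using (_∈_; _∉_; find)
open import Data.List.Membership.Propositional.Properties
open import Data.List.Relation.Unary.All using (All; []; _∷_)
import Data.List.Relation.Unary.All as All
import Data.List.Relation.Unary.All.Properties as All
open import Data.List.Relation.Unary.AllPairs using ([]; _∷_)
open import Data.List.Relation.Unary.Any using (here; there; index)
open import Data.List.Relation.Unary.Any.Properties using (lookup-index; reverse⁻)
open import Data.List.Relation.Unary.Unique.Propositional using (Unique)
open import Data.List.Relation.Unary.Unique.Propositional.Properties using (++⁺; filter⁺; allFin⁺)
import Data.List.Relation.Unary.Unique.DecPropositional.Properties as DecUnique
open import Data.Product using (_×_; _,_; ∃; proj₁; proj₂; swap)
open import Data.Sum using (_⊎_; inj₁; inj₂)
open import Data.Unit using (tt)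
open import Data.Empty using (⊥; ⊥-elim)
open import Function.Definitions using (Injective)
open import Relation.Nullary using (¬_; yes; no; Dec; ¬?; _×-dec_)
open import Relation.Nullary.Decidable using (decidable-stable; ¬¬-excluded-middle)

open import Relation.Binary.Definitions using (DecidableEquality; Tri; tri<; tri≈; tri>)
open import Relation.Binary.PropositionalEquality hiding ([_])
open import Relation.Binary.Construct.Closure.ReflexiveTransitive using (Star; ε; _◅_; _◅◅_)

-- Finite sums and binary labels

-- A cut is at odds with balance for the following reason. Fix two segments of C and call the order
-- on D of a pair of edges from them to a common segment of D its sign. If both halves of the first
-- segment see the two signs equally often, then pairs of unlike sign, one from each half, form
-- 4-cycles that are discordant on D. Of the two ways to assign the signs to the halves, at least
-- one has all its cycles discordant on C too. Such doubly discordant cycles, here `twisted`, are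
-- rare, because they and the squares stand on the same side of one inequality (`balance`). So a
-- fixed proportion of the separated 4-cycles is under control.
--
-- Each of L halvings may lose 1/(2L) of the count, which turns into the factor L². There is room
-- for it: K² = O(m³ L²) beats K⁵ = O(m⁸) by a power of K, and L¹⁶ is at most a constant times K.
--
-- Adjacency is not assumed decidable, so Menger's theorem and the bridges are obtained under double
-- negation, which the decidable final inequality absorbs. That inequality,
-- `r ^ 5 ≤ (suc q * m) ^ 8`, is the claim with C = 1/(q+1).

∑ : {A : Set} → List A → (A → ℕ) → ℕ
∑ []       f = 0
∑ (x ∷ xs) f = f x + ∑ xs f

syntax ∑ xs (λ x → t) = ∑[ x ← xs ] t

module _ {A : Set} where

  ∑-cong : (xs : List A) {f g : A → ℕ} → (∀ x → f x ≡ g x) → ∑ xs f ≡ ∑ xs g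
  ∑-cong []       eq = refl
  ∑-cong (x ∷ xs) eq = cong₂ _+_ (eq x) (∑-cong xs eq)

  ∑-mono : (xs : List A) {f g : A → ℕ} → (∀ x → f x ≤ g x) → ∑ xs f ≤ ∑ xs g
  ∑-mono []       le = z≤n
  ∑-mono (x ∷ xs) le = +-mono-≤ (le x) (∑-mono xs le)

  ∑-zero : (xs : List A) → ∑[ x ← xs ] 0 ≡ 0
  ∑-zero []       = refl
  ∑-zero (x ∷ xs) = ∑-zero xs

  ∑-+ : (xs : List A) (f g : A → ℕ) → ∑[ x ← xs ] (f x + g x) ≡ ∑ xs f + ∑ xs g
  ∑-+ []       f g = refl
  ∑-+ (x ∷ xs) f g rewrite ∑-+ xs f g =
    solve 4 (λ a b c d → (a :+ b) :+ (c :+ d) := (a :+ c) :+ (b :+ d)) refl (f x) (g x) (∑ xs f) (∑ xs g)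

  ∑-*ˡ : (xs : List A) (c : ℕ) (f : A → ℕ) → ∑[ x ← xs ] (c * f x) ≡ c * ∑ xs f
  ∑-*ˡ []       c f = sym (*-zeroʳ c)
  ∑-*ˡ (x ∷ xs) c f rewrite ∑-*ˡ xs c f = sym (*-distribˡ-+ c (f x) (∑ xs f))

  ∑-*ʳ : (xs : List A) (c : ℕ) (f : A → ℕ) → ∑[ x ← xs ] (f x * c) ≡ ∑ xs f * c
  ∑-*ʳ []       c f = refl
  ∑-*ʳ (x ∷ xs) c f rewrite ∑-*ʳ xs c f = sym (*-distribʳ-+ c (f x) (∑ xs f))

  ∑-witness : (xs : List A) {f g : A → ℕ} → ¬ (∑ xs f ≤ ∑ xs g) → ∃ λ x → ¬ (f x ≤ g x)
  ∑-witness []       nle = ⊥-elim (nle z≤n)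
  ∑-witness (x ∷ xs) {f} {g} nle with f x ≤? g x
  ... | no  fx≰gx = x , fx≰gx
  ... | yes fx≤gx = ∑-witness xs (λ le → nle (+-mono-≤ fx≤gx le))

module _ {A B : Set} where

  ∑-swap : (xs : List A) (ys : List B) (f : A → B → ℕ) →
           ∑[ x ← xs ] ∑[ y ← ys ] f x y ≡ ∑[ y ← ys ] ∑[ x ← xs ] f x y
  ∑-swap []       ys f = sym (∑-zero ys)
  ∑-swap (x ∷ xs) ys f rewrite ∑-swap xs ys f = sym (∑-+ ys (f x) (λ y → ∑[ x ← xs ] f x y))

  ∑-cong₂ : (xs : List A) (ys : List B) {f g : A → B → ℕ} → (∀ x y → f x y ≡ g x y) →
            ∑[ x ← xs ] ∑[ y ← ys ] f x y ≡ ∑[ x ← xs ] ∑[ y ← ys ] g x y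
  ∑-cong₂ xs ys eq = ∑-cong xs (λ x → ∑-cong ys (eq x))

  ∑-mono₂ : (xs : List A) (ys : List B) {f g : A → B → ℕ} → (∀ x y → f x y ≤ g x y) →
            ∑[ x ← xs ] ∑[ y ← ys ] f x y ≤ ∑[ x ← xs ] ∑[ y ← ys ] g x y
  ∑-mono₂ xs ys le = ∑-mono xs (λ x → ∑-mono ys (le x))

  ∑₂-+ : (xs : List A) (ys : List B) (f g : A → B → ℕ) →
         ∑[ x ← xs ] ∑[ y ← ys ] (f x y + g x y) ≡
         ∑[ x ← xs ] ∑[ y ← ys ] f x y + ∑[ x ← xs ] ∑[ y ← ys ] g x y
  ∑₂-+ xs ys f g = trans (∑-cong xs (λ x → ∑-+ ys (f x) (g x)))
                         (∑-+ xs (λ x → ∑ ys (f x)) (λ x → ∑ ys (g x)))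

  ∑₂-*ˡ : (xs : List A) (ys : List B) (c : ℕ) (f : A → B → ℕ) →
          ∑[ x ← xs ] ∑[ y ← ys ] (c * f x y) ≡ c * (∑[ x ← xs ] ∑[ y ← ys ] f x y)
  ∑₂-*ˡ xs ys c f = trans (∑-cong xs (λ x → ∑-*ˡ ys c (f x))) (∑-*ˡ xs c (λ x → ∑ ys (f x)))

  ∑-*-∑ : (xs : List A) (ys : List B) (f : A → ℕ) (g : B → ℕ) →
          ∑ xs f * ∑ ys g ≡ ∑[ x ← xs ] ∑[ y ← ys ] (f x * g y)
  ∑-*-∑ xs ys f g = trans (sym (∑-*ʳ xs (∑ ys g) f)) (∑-cong xs (λ x → sym (∑-*ˡ ys (f x) g)))

-- Indicators valued in `ℕ` rather than decisions, so that they multiply inside sums and the ring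
-- solver applies to counts.
δ : ℕ → ℕ → ℕ
δ zero    zero    = 1
δ zero    (suc b) = 0
δ (suc a) zero    = 0
δ (suc a) (suc b) = δ a b

lt : ℕ → ℕ → ℕ
lt _       zero    = 0
lt zero    (suc b) = 1
lt (suc a) (suc b) = lt a b

δ-refl : ∀ a → δ a a ≡ 1
δ-refl zero    = refl
δ-refl (suc a) = δ-refl a

δ-sym : ∀ a b → δ a b ≡ δ b a
δ-sym zero    zero    = refl
δ-sym zero    (suc b) = refl
δ-sym (suc a) zero    = refl
δ-sym (suc a) (suc b) = δ-sym a b

δ-cases : ∀ a b → (δ a b ≡ 0) ⊎ (a ≡ b × δ a b ≡ 1)
δ-cases zero    zero    = inj₂ (refl , refl)
δ-cases zero    (suc b) = inj₁ refl
δ-cases (suc a) zero    = inj₁ refl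
δ-cases (suc a) (suc b) with δ-cases a b
... | inj₁ z       = inj₁ z
... | inj₂ (p , q) = inj₂ (cong suc p , q)

lt-cases : ∀ a b → (lt a b ≡ 0) ⊎ (a < b × lt a b ≡ 1)
lt-cases zero    zero    = inj₁ refl
lt-cases zero    (suc b) = inj₂ (s≤s z≤n , refl)
lt-cases (suc a) zero    = inj₁ refl
lt-cases (suc a) (suc b) with lt-cases a b
... | inj₁ z       = inj₁ z
... | inj₂ (p , q) = inj₂ (s≤s p , q)

lt-yes : ∀ {a b} → a < b → lt a b ≡ 1
lt-yes {zero}  {suc b} _       = refl
lt-yes {suc a} {suc b} (s≤s p) = lt-yes p

lt-no : ∀ {a b} → b ≤ a → lt a b ≡ 0
lt-no {a}     {zero}  _       = refl
lt-no {suc a} {suc b} (s≤s p) = lt-no p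

data Comparison (a b : ℕ) : Set where
  less    : a < b → lt a b ≡ 1 → lt b a ≡ 0 → Comparison a b
  equal   : a ≡ b → lt a b ≡ 0 → lt b a ≡ 0 → Comparison a b
  greater : b < a → lt a b ≡ 0 → lt b a ≡ 1 → Comparison a b

comparison : ∀ a b → Comparison a b
comparison a b with <-cmp a b
... | tri< a<b _ _ = less a<b (lt-yes a<b) (lt-no (<⇒≤ a<b))
... | tri≈ _ a≡b _ = equal a≡b (lt-no (≤-reflexive (sym a≡b))) (lt-no (≤-reflexive a≡b))
... | tri> _ _ b<a = greater b<a (lt-no (<⇒≤ b<a)) (lt-yes b<a)

∑-δ-absent : ∀ {M a} (f : ℕ → ℕ) → M ≤ a → ∑[ i ← downFrom M ] (δ a i * f i) ≡ 0
∑-δ-absent {zero}  f M≤a = refl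
∑-δ-absent {suc M} {a} f M<a with δ-cases a M
... | inj₁ z rewrite z       = ∑-δ-absent f (<⇒≤ M<a)
... | inj₂ (refl , _)        = ⊥-elim (<-irrefl refl M<a)

∑-δ : ∀ {M a} (f : ℕ → ℕ) → a < M → ∑[ i ← downFrom M ] (δ a i * f i) ≡ f a
∑-δ {suc M} {a} f a<M with δ-cases a M
... | inj₂ (refl , eq) rewrite eq | ∑-δ-absent {M} f ≤-refl =
      solve 1 (λ x → x :+ con 0 :+ con 0 := x) refl (f M)
... | inj₁ z rewrite z = ∑-δ f (≤∧≢⇒< (≤-pred a<M) a≢M)
  where
  a≢M : a ≢ M
  a≢M refl with () ← trans (sym z) (δ-refl M)

dbl : ℕ → ℕ
dbl zero    = zero
dbl (suc n) = suc (suc (dbl n))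

dbl≡2* : ∀ n → dbl n ≡ 2 * n
dbl≡2* zero    = refl
dbl≡2* (suc n) rewrite dbl≡2* n = solve 1 (λ n → con 2 :+ con 2 :* n := con 2 :* (con 1 :+ n)) refl n

-- Piece `i` of the halved labelling is the disjoint union of the pieces `dbl i` and `suc (dbl i)`
-- of the finer one. Every halving step starts here.
δ-half : ∀ a i → δ ⌊ a /2⌋ i ≡ δ a (dbl i) + δ a (suc (dbl i))
δ-half zero          zero    = refl
δ-half zero          (suc i) = refl
δ-half (suc zero)    zero    = refl
δ-half (suc zero)    (suc i) = refl
δ-half (suc (suc a)) zero    = refl
δ-half (suc (suc a)) (suc i) = δ-half a i

∑-dbl : ∀ M (f : ℕ → ℕ) → ∑ (downFrom (dbl M)) f ≡ ∑[ i ← downFrom M ] (f (dbl i) + f (suc (dbl i)))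
∑-dbl zero    f = refl
∑-dbl (suc M) f rewrite ∑-dbl M f =
  solve 3 (λ a b c → b :+ (a :+ c) := a :+ b :+ c) refl (f (dbl M)) (f (suc (dbl M)))
    (∑[ i ← downFrom M ] (f (dbl i) + f (suc (dbl i))))


<dbl : ∀ {a M} → ⌊ a /2⌋ < M → a < dbl M
<dbl {zero}        {suc M} _       = s≤s z≤n
<dbl {suc zero}    {suc M} _       = s≤s (s≤s z≤n)
<dbl {suc (suc a)} {suc M} (s≤s p) = s≤s (s≤s (<dbl p))

half-dbl : ∀ i → ⌊ dbl i /2⌋ ≡ i
half-dbl zero    = refl
half-dbl (suc i) = cong suc (half-dbl i)

half-suc-dbl : ∀ i → ⌊ suc (dbl i) /2⌋ ≡ i
half-suc-dbl zero    = refl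
half-suc-dbl (suc i) = cong suc (half-suc-dbl i)

∑-dbl₂ : ∀ M (f : ℕ → ℕ → ℕ) → ∑[ i ← downFrom (dbl M) ] ∑[ j ← downFrom (dbl M) ] f i j ≡
  ∑[ i ← downFrom M ] ∑[ j ← downFrom M ]
    (f (dbl i) (dbl j) + f (dbl i) (suc (dbl j)) + (f (suc (dbl i)) (dbl j) + f (suc (dbl i)) (suc (dbl j))))
∑-dbl₂ M f = trans (∑-dbl M _) (∑-cong (downFrom M) λ i →
  trans (cong₂ _+_ (∑-dbl M (f (dbl i))) (∑-dbl M (f (suc (dbl i))))) (sym (∑-+ (downFrom M) _ _)))

half-< : ∀ {a M} → a < dbl M → ⌊ a /2⌋ < M
half-< {zero}        {suc M} _ = s≤s z≤n
half-< {suc zero}    {suc M} _ = s≤s z≤n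
half-< {suc (suc a)} {suc M} (s≤s (s≤s p)) = s≤s (half-< p)

module _ {A : Set} where

  ∑-strict : ∀ {xs : List A} {f g : A → ℕ} {x} → x ∈ xs → (∀ z → f z ≤ g z) → f x < g x → ∑ xs f < ∑ xs g
  ∑-strict {xs = _ ∷ xs} (here refl) le lt = +-mono-<-≤ lt (∑-mono xs le)
  ∑-strict (there x∈) le lt = +-mono-≤-< (le _) (∑-strict x∈ le lt)

  ∑-ones : (xs : List A) → ∑[ x ← xs ] 1 ≡ length xs
  ∑-ones []       = refl
  ∑-ones (x ∷ xs) = cong suc (∑-ones xs)

  -- Used to sum out degenerate quadruples: once its value is prescribed, an edge has at most one
  -- choice.
  ∑-δ-injective : ∀ {xs : List A} (X : A → ℕ) → (∀ {e f} → X e ≡ X f → e ≡ f) → Unique xs →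
                  ∀ m → ∑[ e ← xs ] δ m (X e) ≤ 1
  ∑-δ-injective {[]} X inj u m = z≤n
  ∑-δ-injective {x ∷ xs} X inj (x∉ ∷ u) m with δ-cases m (X x)
  ... | inj₁ z rewrite z = ∑-δ-injective X inj u m
  ... | inj₂ (refl , o) rewrite o = s≤s (≤-reflexive (absent xs x∉))
    where
    absent : ∀ ys → All (x ≢_) ys → ∑[ e ← ys ] δ (X x) (X e) ≡ 0
    absent []       []           = refl
    absent (y ∷ ys) (x≢y ∷ x∉ys) with δ-cases (X x) (X y)
    ... | inj₁ z rewrite z = absent ys x∉ys
    ... | inj₂ (eq , _)    = ⊥-elim (x≢y (inj eq))

halve : ℕ → ℕ → ℕ
halve zero    a = a
halve (suc s) a = ⌊ halve s a /2⌋

halve-shift : ∀ s a → halve s ⌊ a /2⌋ ≡ halve (suc s) a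
halve-shift zero    a = refl
halve-shift (suc s) a = cong ⌊_/2⌋ (halve-shift s a)

-- Halving `s` times discards the `s` lowest binary digits, which are those of `b`.
halve-digits : ∀ s p b → b < 2 ^ s → halve s (p * 2 ^ s + b) ≡ p
halve-digits zero    p zero    _ = trans (+-identityʳ _) (*-identityʳ p)
halve-digits zero    p (suc b) (s≤s ())
halve-digits (suc s) p b b< = begin
  halve (suc s) (p * 2 ^ suc s + b)     ≡⟨ sym (halve-shift s _) ⟩
  halve s ⌊ p * 2 ^ suc s + b /2⌋       ≡⟨ cong (halve s) eq ⟩
  halve s (p * 2 ^ s + ⌊ b /2⌋)         ≡⟨ halve-digits s p ⌊ b /2⌋ (half-< (subst (b <_) (sym (dbl≡2* (2 ^ s))) b<)) ⟩
  p ∎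
  where
  open ≡-Reasoning
  half-even-+ : ∀ a b → ⌊ dbl a + b /2⌋ ≡ a + ⌊ b /2⌋
  half-even-+ zero    b = refl
  half-even-+ (suc a) b = cong suc (half-even-+ a b)
  eq : ⌊ p * 2 ^ suc s + b /2⌋ ≡ p * 2 ^ s + ⌊ b /2⌋
  eq = trans (cong (λ z → ⌊ z + b /2⌋) (trans (solve 2 (λ p q → p :* (con 2 :* q) := con 2 :* (p :* q)) refl p (2 ^ s)) (sym (dbl≡2* (p * 2 ^ s)))))
         (half-even-+ (p * 2 ^ s) b)

-- Sums over pairs and quadruples of edges

-- The square of `a - b` without subtraction: it is the excess of a concordant count `a * a + b * b`
-- over a discordant one.
sq-dist : ∀ a b → a * a + b * b ≡ (a * b + b * a) + ∣ a - b ∣ * ∣ a - b ∣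
sq-dist zero    b rewrite *-zeroʳ b = refl
sq-dist (suc a) zero    = solve 1 (λ a → (con 1 :+ a) :* (con 1 :+ a) :+ con 0 := ((con 1 :+ a) :* con 0 :+ con 0) :+ (con 1 :+ a) :* (con 1 :+ a)) refl a
sq-dist (suc a) (suc b) = begin
  suc a * suc a + suc b * suc b
    ≡⟨ solve 2 (λ a b → (con 1 :+ a) :* (con 1 :+ a) :+ (con 1 :+ b) :* (con 1 :+ b)
         := (a :* a :+ b :* b) :+ con 2 :* (con 1 :+ a :+ b)) refl a b ⟩
  (a * a + b * b) + 2 * (1 + a + b)
    ≡⟨ cong (_+ 2 * (1 + a + b)) (sq-dist a b) ⟩
  (a * b + b * a) + ∣ a - b ∣ * ∣ a - b ∣ + 2 * (1 + a + b)
    ≡⟨ solve 3 (λ a b d → (a :* b :+ b :* a) :+ d :+ con 2 :* (con 1 :+ a :+ b)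
         := ((con 1 :+ a) :* (con 1 :+ b) :+ (con 1 :+ b) :* (con 1 :+ a)) :+ d) refl a b (∣ a - b ∣ * ∣ a - b ∣) ⟩
  (suc a * suc b + suc b * suc a) + ∣ a - b ∣ * ∣ a - b ∣ ∎
  where open ≡-Reasoning

module _ {A : Set} (xs : List A) where

  pairs : (A → ℕ) → (A → ℕ) → (A → A → ℕ) → ℕ
  pairs p q φ = ∑[ e ← xs ] ∑[ h ← xs ] (p e * q h * φ e h)

  ∑⁴ : (A → A → A → A → ℕ) → ℕ
  ∑⁴ F = ∑[ e ← xs ] ∑[ h ← xs ] ∑[ f ← xs ] ∑[ g ← xs ] F e h f g

  quads : (A → ℕ) → (A → ℕ) → (A → ℕ) → (A → ℕ) → (A → A → A → A → ℕ) → ℕ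
  quads p q p' q' F = ∑⁴ λ e h f g → (p e * q h) * (p' f * q' g) * F e h f g

  -- A sum over closed walks of length four: the labels tie `e` to `f` and `h` to `g`, and `F` has
  -- to tie `e` to `h` and `f` to `g`.
  linked : (A → ℕ) → (A → A → A → A → ℕ) → ℕ
  linked ℓ F = ∑⁴ λ e h f g → δ (ℓ e) (ℓ f) * δ (ℓ h) (ℓ g) * F e h f g

  piece : (A → ℕ) → ℕ → A → ℕ
  piece ℓ i e = δ (ℓ e) i

  ∑⁴-cong : ∀ {F G} → (∀ e h f g → F e h f g ≡ G e h f g) → ∑⁴ F ≡ ∑⁴ G
  ∑⁴-cong eq = ∑-cong₂ xs xs λ e h → ∑-cong₂ xs xs (eq e h)

  ∑⁴-mono : ∀ {F G} → (∀ e h f g → F e h f g ≤ G e h f g) → ∑⁴ F ≤ ∑⁴ G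
  ∑⁴-mono le = ∑-mono₂ xs xs λ e h → ∑-mono₂ xs xs (le e h)

  ∑⁴-+ : ∀ F G → ∑⁴ (λ e h f g → F e h f g + G e h f g) ≡ ∑⁴ F + ∑⁴ G
  ∑⁴-+ F G = trans (∑-cong₂ xs xs λ e h → ∑₂-+ xs xs (F e h) (G e h)) (∑₂-+ xs xs _ _)

  ∑⁴-swap : ∀ F → ∑⁴ F ≡ ∑⁴ (λ e f h g → F e h f g)
  ∑⁴-swap F = ∑-cong xs λ e → ∑-swap xs xs _

  ∑⁴-range : ∀ M (F : ℕ → A → A → A → A → ℕ) →
             ∑⁴ (λ e h f g → ∑[ i ← downFrom M ] F i e h f g) ≡ ∑[ i ← downFrom M ] ∑⁴ (F i)
  ∑⁴-range M F = begin
    ∑⁴ (λ e h f g → ∑[ i ← r ] F i e h f g)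
      ≡⟨ ∑-cong₂ xs xs (λ e h → ∑-cong xs (λ f → ∑-swap xs r _)) ⟩
    ∑[ e ← xs ] ∑[ h ← xs ] ∑[ f ← xs ] ∑[ i ← r ] ∑[ g ← xs ] F i e h f g
      ≡⟨ ∑-cong₂ xs xs (λ e h → ∑-swap xs r _) ⟩
    ∑[ e ← xs ] ∑[ h ← xs ] ∑[ i ← r ] ∑[ f ← xs ] ∑[ g ← xs ] F i e h f g
      ≡⟨ ∑-cong xs (λ e → ∑-swap xs r _) ⟩
    ∑[ e ← xs ] ∑[ i ← r ] ∑[ h ← xs ] ∑[ f ← xs ] ∑[ g ← xs ] F i e h f g
      ≡⟨ ∑-swap xs r _ ⟩
    ∑[ i ← r ] ∑⁴ (F i) ∎
    where
    open ≡-Reasoning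
    r = downFrom M

  quads-* : ∀ p q p' q' φ ψ →
            quads p q p' q' (λ e h f g → φ e h * ψ f g) ≡ pairs p q φ * pairs p' q' ψ
  quads-* p q p' q' φ ψ = sym (begin
    pairs p q φ * pairs p' q' ψ
      ≡⟨ ∑-*-∑ xs xs _ _ ⟩
    ∑[ e ← xs ] ∑[ f ← xs ] (∑[ h ← xs ] (p e * q h * φ e h) * ∑[ g ← xs ] (p' f * q' g * ψ f g))
      ≡⟨ ∑-cong₂ xs xs (λ e f → ∑-*-∑ xs xs _ _) ⟩
    ∑[ e ← xs ] ∑[ f ← xs ] ∑[ h ← xs ] ∑[ g ← xs ] ((p e * q h * φ e h) * (p' f * q' g * ψ f g))
      ≡⟨ ∑-cong xs (λ e → ∑-swap xs xs _) ⟩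
    ∑[ e ← xs ] ∑[ h ← xs ] ∑[ f ← xs ] ∑[ g ← xs ] ((p e * q h * φ e h) * (p' f * q' g * ψ f g))
      ≡⟨ ∑⁴-cong (λ e h f g → solve 4 (λ a x b y → (a :* x) :* (b :* y) := (a :* b) :* (x :* y)) refl
           (p e * q h) (φ e h) (p' f * q' g) (ψ f g)) ⟩
    quads p q p' q' (λ e h f g → φ e h * ψ f g) ∎)
    where open ≡-Reasoning

  linked-pieces : ∀ {M} {ℓ : A → ℕ} → (∀ e → ℓ e < M) → ∀ F →
    linked ℓ F ≡ ∑[ i ← downFrom M ] ∑[ j ← downFrom M ]
                   quads (piece ℓ i) (piece ℓ j) (piece ℓ i) (piece ℓ j) F
  linked-pieces {M} {ℓ} ℓ<M F = begin
    linked ℓ F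
      ≡⟨ ∑⁴-cong (λ e h f g → expand e h f g) ⟩
    ∑⁴ (λ e h f g → ∑[ i ← r ] ∑[ j ← r ] G i j e h f g)
      ≡⟨ ∑⁴-range M _ ⟩
    ∑[ i ← r ] ∑⁴ (λ e h f g → ∑[ j ← r ] G i j e h f g)
      ≡⟨ ∑-cong r (λ i → ∑⁴-range M _) ⟩
    ∑[ i ← r ] ∑[ j ← r ] ∑⁴ (G i j) ∎
    where
    open ≡-Reasoning
    r = downFrom M
    G : ℕ → ℕ → A → A → A → A → ℕ
    G i j e h f g = (δ (ℓ e) i * δ (ℓ h) j) * (δ (ℓ f) i * δ (ℓ g) j) * F e h f g
    expand : ∀ e h f g → δ (ℓ e) (ℓ f) * δ (ℓ h) (ℓ g) * F e h f g ≡ ∑[ i ← r ] ∑[ j ← r ] G i j e h f g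
    expand e h f g = begin
      δ (ℓ e) (ℓ f) * δ (ℓ h) (ℓ g) * F e h f g
        ≡⟨ cong (_* F e h f g) (cong₂ _*_
             (trans (δ-sym (ℓ e) (ℓ f)) (sym (∑-δ {M} (λ i → δ (ℓ f) i) (ℓ<M e))))
             (trans (δ-sym (ℓ h) (ℓ g)) (sym (∑-δ {M} (λ j → δ (ℓ g) j) (ℓ<M h))))) ⟩
      ∑[ i ← r ] (δ (ℓ e) i * δ (ℓ f) i) * ∑[ j ← r ] (δ (ℓ h) j * δ (ℓ g) j) * F e h f g
        ≡⟨ cong (_* F e h f g) (∑-*-∑ r r _ _) ⟩
      ∑[ i ← r ] ∑[ j ← r ] (δ (ℓ e) i * δ (ℓ f) i * (δ (ℓ h) j * δ (ℓ g) j)) * F e h f g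
        ≡⟨ sym (∑-*ʳ r _ _) ⟩
      ∑[ i ← r ] (∑[ j ← r ] (δ (ℓ e) i * δ (ℓ f) i * (δ (ℓ h) j * δ (ℓ g) j)) * F e h f g)
        ≡⟨ ∑-cong r (λ i → sym (∑-*ʳ r _ _)) ⟩
      ∑[ i ← r ] ∑[ j ← r ] (δ (ℓ e) i * δ (ℓ f) i * (δ (ℓ h) j * δ (ℓ g) j) * F e h f g)
        ≡⟨ ∑-cong₂ r r (λ i j → solve 5 (λ a b c d F → a :* b :* (c :* d) :* F := a :* c :* (b :* d) :* F) refl
             (δ (ℓ e) i) (δ (ℓ f) i) (δ (ℓ h) j) (δ (ℓ g) j) (F e h f g)) ⟩
      ∑[ i ← r ] ∑[ j ← r ] G i j e h f g ∎

  linked-* : ∀ {M} {ℓ : A → ℕ} → (∀ e → ℓ e < M) → ∀ φ ψ →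
    linked ℓ (λ e h f g → φ e h * ψ f g) ≡
    ∑[ i ← downFrom M ] ∑[ j ← downFrom M ] (pairs (piece ℓ i) (piece ℓ j) φ * pairs (piece ℓ i) (piece ℓ j) ψ)
  linked-* {M} {ℓ} ℓ<M φ ψ = trans (linked-pieces ℓ<M _)
    (∑-cong₂ (downFrom M) (downFrom M) λ i j → quads-* (piece ℓ i) (piece ℓ j) (piece ℓ i) (piece ℓ j) φ ψ)

  linked-+ : ∀ ℓ F G → linked ℓ (λ e h f g → F e h f g + G e h f g) ≡ linked ℓ F + linked ℓ G
  linked-+ ℓ F G = trans (∑⁴-cong λ e h f g → *-distribˡ-+ (δ (ℓ e) (ℓ f) * δ (ℓ h) (ℓ g)) (F e h f g) (G e h f g)) (∑⁴-+ _ _)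

  concordant discordant : (A → A → ℕ) → A → A → A → A → ℕ
  concordant φ e h f g = φ e h * φ f g + φ h e * φ g f
  discordant φ e h f g = φ e h * φ g f + φ h e * φ f g

  imbalance : (A → ℕ) → (A → ℕ) → (A → A → ℕ) → ℕ
  imbalance p q φ = ∣ pairs p q φ - pairs p q (λ e h → φ h e) ∣

  -- If two pieces have `a` pairs in one order and `b` in the other, they contribute a² + b²
  -- concordant and 2ab discordant quadruples. The difference is the squared imbalance.
  linked-concordant : ∀ {M} {ℓ : A → ℕ} → (∀ e → ℓ e < M) → ∀ φ →
    linked ℓ (concordant φ) ≡ linked ℓ (discordant φ) +
      ∑[ i ← downFrom M ] ∑[ j ← downFrom M ]
        (imbalance (piece ℓ i) (piece ℓ j) φ * imbalance (piece ℓ i) (piece ℓ j) φ)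
  linked-concordant {M} {ℓ} ℓ<M φ = begin
    linked ℓ (concordant φ)
      ≡⟨ linked-+ ℓ _ _ ⟩
    linked ℓ (λ e h f g → φ e h * φ f g) + linked ℓ (λ e h f g → φ h e * φ g f)
      ≡⟨ cong₂ _+_ (linked-* ℓ<M φ φ) (linked-* ℓ<M φᵀ φᵀ) ⟩
    ∑[ i ← r ] ∑[ j ← r ] (a i j * a i j) + ∑[ i ← r ] ∑[ j ← r ] (b i j * b i j)
      ≡⟨ sym (∑₂-+ r r _ _) ⟩
    ∑[ i ← r ] ∑[ j ← r ] (a i j * a i j + b i j * b i j)
      ≡⟨ ∑-cong₂ r r (λ i j → sq-dist (a i j) (b i j)) ⟩
    ∑[ i ← r ] ∑[ j ← r ] ((a i j * b i j + b i j * a i j) + D i j)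
      ≡⟨ ∑₂-+ r r _ _ ⟩
    ∑[ i ← r ] ∑[ j ← r ] (a i j * b i j + b i j * a i j) + ∑[ i ← r ] ∑[ j ← r ] D i j
      ≡⟨ cong (_+ ∑[ i ← r ] ∑[ j ← r ] D i j) (begin
           ∑[ i ← r ] ∑[ j ← r ] (a i j * b i j + b i j * a i j)
             ≡⟨ ∑₂-+ r r _ _ ⟩
           ∑[ i ← r ] ∑[ j ← r ] (a i j * b i j) + ∑[ i ← r ] ∑[ j ← r ] (b i j * a i j)
             ≡⟨ sym (cong₂ _+_ (linked-* ℓ<M φ φᵀ) (linked-* ℓ<M φᵀ φ)) ⟩
           linked ℓ (λ e h f g → φ e h * φ g f) + linked ℓ (λ e h f g → φ h e * φ f g)
             ≡⟨ sym (linked-+ ℓ _ _) ⟩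
           linked ℓ (discordant φ) ∎) ⟩
    linked ℓ (discordant φ) + ∑[ i ← r ] ∑[ j ← r ] D i j ∎
    where
    open ≡-Reasoning
    r = downFrom M
    φᵀ : A → A → ℕ
    φᵀ e h = φ h e
    a b D : ℕ → ℕ → ℕ
    a i j = pairs (piece ℓ i) (piece ℓ j) φ
    b i j = pairs (piece ℓ i) (piece ℓ j) φᵀ
    D i j = ∣ a i j - b i j ∣ * ∣ a i j - b i j ∣

-- Inequalities for the halving step and the final estimate

∣-∣-+ : ∀ a b c d → ∣ (a + c) - (b + d) ∣ ≤ ∣ a - b ∣ + ∣ c - d ∣
∣-∣-+ zero    zero    c d = ≤-refl
∣-∣-+ zero    (suc b) c d = begin
  ∣ c - (suc b + d) ∣           ≤⟨ ∣-∣-triangle c d (suc b + d) ⟩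
  ∣ c - d ∣ + ∣ d - (suc b + d) ∣ ≡⟨ cong (λ z → ∣ c - d ∣ + ∣ d - z ∣) (+-comm (suc b) d) ⟩
  ∣ c - d ∣ + ∣ d - (d + suc b) ∣ ≡⟨ cong (∣ c - d ∣ +_) (∣m-m+n∣≡n d (suc b)) ⟩
  ∣ c - d ∣ + suc b             ≡⟨ +-comm _ (suc b) ⟩
  suc b + ∣ c - d ∣ ∎
  where open ≤-Reasoning
∣-∣-+ (suc a) zero    c d = begin
  ∣ suc a + c - d ∣             ≤⟨ ∣-∣-triangle (suc a + c) c d ⟩
  ∣ suc a + c - c ∣ + ∣ c - d ∣   ≡⟨ cong (λ z → ∣ z - c ∣ + ∣ c - d ∣) (+-comm (suc a) c) ⟩
  ∣ c + suc a - c ∣ + ∣ c - d ∣   ≡⟨ cong (_+ ∣ c - d ∣) (trans (∣-∣-comm (c + suc a) c) (∣m-m+n∣≡n c (suc a))) ⟩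
  suc a + ∣ c - d ∣ ∎
  where open ≤-Reasoning
∣-∣-+ (suc a) (suc b) c d = ∣-∣-+ a b c d

2ab≤a²+b² : ∀ a b → 2 * (a * b) ≤ a * a + b * b
2ab≤a²+b² a b = begin
  2 * (a * b)   ≡⟨ solve 2 (λ a b → con 2 :* (a :* b) := a :* b :+ b :* a) refl a b ⟩
  a * b + b * a ≤⟨ m≤m+n _ _ ⟩
  a * b + b * a + ∣ a - b ∣ * ∣ a - b ∣ ≡⟨ sym (sq-dist a b) ⟩
  a * a + b * b ∎
  where open ≤-Reasoning

-- If `a₀` = `b₀` and `a₁` = `b₁`, the product is four times either mixed product. In general `a₀`
-- is replaced by `b₀ + D₀` and `b₁` by `a₁ + D₁`, at the cost of `t` times the imbalances.
separated-bound : ∀ a₀ b₀ a₁ b₁ t m → b₀ * a₁ ≤ m ⊎ a₀ * b₁ ≤ m → (a₀ + b₀) + (a₁ + b₁) ≤ t →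
  (a₀ + b₀) * (a₁ + b₁) ≤ 4 * m + 2 * (t * (∣ a₀ - b₀ ∣ + ∣ a₁ - b₁ ∣))
separated-bound a₀ b₀ a₁ b₁ t m (inj₁ small) le = begin
  (a₀ + b₀) * (a₁ + b₁)
    ≤⟨ *-monoʳ-≤ (a₀ + b₀) (begin
         a₁ + b₁          ≤⟨ +-monoʳ-≤ a₁ (≤-trans (m≤n+∣m-n∣ b₁ a₁) (≤-reflexive (cong (a₁ +_) (∣-∣-comm b₁ a₁)))) ⟩
         a₁ + (a₁ + D₁)   ∎) ⟩
  (a₀ + b₀) * (a₁ + (a₁ + D₁))
    ≡⟨ solve 4 (λ a b c d → (a :+ b) :* (c :+ (c :+ d)) := (a :+ b) :* (con 2 :* c) :+ (a :+ b) :* d) refl a₀ b₀ a₁ D₁ ⟩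
  (a₀ + b₀) * (2 * a₁) + (a₀ + b₀) * D₁
    ≤⟨ +-mono-≤ (*-monoˡ-≤ (2 * a₁) (+-monoˡ-≤ b₀ (m≤n+∣m-n∣ a₀ b₀)))
         (*-monoˡ-≤ D₁ (≤-trans (m≤m+n (a₀ + b₀) (a₁ + b₁)) le)) ⟩
  (b₀ + D₀ + b₀) * (2 * a₁) + t * D₁
    ≡⟨ solve 4 (λ b d a z → (b :+ d :+ b) :* (con 2 :* a) :+ z := con 4 :* (b :* a) :+ con 2 :* (a :* d) :+ z) refl b₀ D₀ a₁ (t * D₁) ⟩
  4 * (b₀ * a₁) + 2 * (a₁ * D₀) + t * D₁
    ≤⟨ +-mono-≤ (+-mono-≤ (*-monoʳ-≤ 4 small) (*-monoʳ-≤ 2 (*-monoˡ-≤ D₀ (≤-trans (≤-trans (m≤m+n a₁ b₁) (m≤n+m (a₁ + b₁) (a₀ + b₀))) le))))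
         (m≤m+n (t * D₁) (t * D₁)) ⟩
  4 * m + 2 * (t * D₀) + (t * D₁ + t * D₁)
    ≡⟨ solve 4 (λ m t d e → con 4 :* m :+ con 2 :* (t :* d) :+ (t :* e :+ t :* e) := con 4 :* m :+ con 2 :* (t :* (d :+ e))) refl m t D₀ D₁ ⟩
  4 * m + 2 * (t * (D₀ + D₁)) ∎
  where
  open ≤-Reasoning
  D₀ = ∣ a₀ - b₀ ∣
  D₁ = ∣ a₁ - b₁ ∣
separated-bound a₀ b₀ a₁ b₁ t m (inj₂ small) le = begin
  (a₀ + b₀) * (a₁ + b₁) ≡⟨ cong₂ _*_ (+-comm a₀ b₀) (+-comm a₁ b₁) ⟩
  (b₀ + a₀) * (b₁ + a₁) ≤⟨ separated-bound b₀ a₀ b₁ a₁ t m (inj₁ small)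
                             (≤-trans (≤-reflexive (cong₂ _+_ (+-comm b₀ a₀) (+-comm b₁ a₁))) le) ⟩
  4 * m + 2 * (t * (∣ b₀ - a₀ ∣ + ∣ b₁ - a₁ ∣)) ≡⟨ cong (λ z → 4 * m + 2 * (t * z)) (cong₂ _+_ (∣-∣-comm b₀ a₀) (∣-∣-comm b₁ a₁)) ⟩
  4 * m + 2 * (t * (∣ a₀ - b₀ ∣ + ∣ a₁ - b₁ ∣)) ∎
  where open ≤-Reasoning

double-square : ∀ a b → (a + b) * (a + b) ≤ 2 * (a * a) + 2 * (b * b)
double-square a b = begin
  (a + b) * (a + b)               ≡⟨ solve 2 (λ a b → (a :+ b) :* (a :+ b) := a :* a :+ b :* b :+ con 2 :* (a :* b)) refl a b ⟩
  a * a + b * b + 2 * (a * b)     ≤⟨ +-monoʳ-≤ (a * a + b * b) (2ab≤a²+b² a b) ⟩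
  a * a + b * b + (a * a + b * b) ≡⟨ solve 2 (λ x y → x :+ y :+ (x :+ y) := con 2 :* x :+ con 2 :* y) refl (a * a) (b * b) ⟩
  2 * (a * a) + 2 * (b * b) ∎
  where open ≤-Reasoning

-- From t² ≤ Σ t_c² + 8m + 8tD, since 16KtD ≤ t² + 64K²D².
quartering : ∀ K t₀₀ t₀₁ t₁₀ t₁₁ d₀₀ d₀₁ d₁₀ d₁₁ D₀ D₁ m₁ m₂ m₃ m → let t = (t₀₀ + t₀₁) + (t₁₀ + t₁₁) in
  (t₀₀ + t₀₁) * (t₁₀ + t₁₁) ≤ 4 * m₁ + 2 * (t * (D₀ + D₁)) →
  t₀₀ * t₀₁ ≤ 4 * m₂ + 2 * (t * (d₀₀ + d₀₁)) →
  t₁₀ * t₁₁ ≤ 4 * m₃ + 2 * (t * (d₁₀ + d₁₁)) →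
  D₀ ≤ d₀₀ + d₀₁ → D₁ ≤ d₁₀ + d₁₁ → m₁ + m₂ + m₃ ≤ m →
  K * (t * t) ≤ K * (t₀₀ * t₀₀ + t₀₁ * t₀₁ + (t₁₀ * t₁₀ + t₁₁ * t₁₁)) + t * t + 8 * K * m
              + 64 * (K * K) * (d₀₀ * d₀₀ + d₀₁ * d₀₁ + (d₁₀ * d₁₀ + d₁₁ * d₁₁))
quartering K t₀₀ t₀₁ t₁₀ t₁₁ d₀₀ d₀₁ d₁₀ d₁₁ D₀ D₁ m₁ m₂ m₃ m h₁ h₂ h₃ e₀ e₁ em = begin
  K * (t * t)
    ≡⟨ solve 5 (λ K a b c d → K :* (((a :+ b) :+ (c :+ d)) :* ((a :+ b) :+ (c :+ d))) :=
         K :* (a :* a :+ b :* b :+ (c :* c :+ d :* d)) :+ K :* (con 2 :* ((a :+ b) :* (c :+ d) :+ a :* b :+ c :* d)))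
         refl K t₀₀ t₀₁ t₁₀ t₁₁ ⟩
  K * s + K * (2 * ((t₀₀ + t₀₁) * (t₁₀ + t₁₁) + t₀₀ * t₀₁ + t₁₀ * t₁₁))
    ≤⟨ +-monoʳ-≤ (K * s) (*-monoʳ-≤ K (*-monoʳ-≤ 2 (+-mono-≤ (+-mono-≤
         (≤-trans h₁ (+-monoʳ-≤ (4 * m₁) (*-monoʳ-≤ 2 (*-monoʳ-≤ t (+-mono-≤ e₀ e₁))))) h₂) h₃))) ⟩
  K * s + K * (2 * (4 * m₁ + 2 * (t * (d₀₀ + d₀₁ + (d₁₀ + d₁₁))) + (4 * m₂ + 2 * (t * (d₀₀ + d₀₁))) + (4 * m₃ + 2 * (t * (d₁₀ + d₁₁)))))
    ≡⟨ solve 8 (λ K s t x y m₁ m₂ m₃ →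
         K :* s :+ K :* (con 2 :* (con 4 :* m₁ :+ con 2 :* (t :* (x :+ y)) :+ (con 4 :* m₂ :+ con 2 :* (t :* x)) :+ (con 4 :* m₃ :+ con 2 :* (t :* y))))
         := K :* s :+ con 2 :* (t :* (con 4 :* K :* (x :+ y))) :+ con 8 :* K :* (m₁ :+ m₂ :+ m₃))
         refl K s t (d₀₀ + d₀₁) (d₁₀ + d₁₁) m₁ m₂ m₃ ⟩
  K * s + 2 * (t * (4 * K * D)) + 8 * K * (m₁ + m₂ + m₃)
    ≤⟨ +-mono-≤ (+-monoʳ-≤ (K * s) (2ab≤a²+b² t (4 * K * D))) (*-monoʳ-≤ (8 * K) em) ⟩
  K * s + (t * t + 4 * K * D * (4 * K * D)) + 8 * K * m
    ≡⟨ solve 5 (λ x y K D z → x :+ (y :+ con 4 :* K :* D :* (con 4 :* K :* D)) :+ z := (x :+ y :+ z) :+ con 16 :* (K :* K) :* (D :* D)) refl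
         (K * s) (t * t) K D (8 * K * m) ⟩
  K * s + t * t + 8 * K * m + 16 * (K * K) * (D * D)
    ≤⟨ +-monoʳ-≤ (K * s + t * t + 8 * K * m) (begin
         16 * (K * K) * (D * D) ≤⟨ *-monoʳ-≤ (16 * (K * K)) D² ⟩
         16 * (K * K) * (4 * q) ≡⟨ solve 2 (λ k q → con 16 :* k :* (con 4 :* q) := con 64 :* k :* q) refl (K * K) q ⟩
         64 * (K * K) * q ∎) ⟩
  K * s + t * t + 8 * K * m + 64 * (K * K) * q ∎
  where
  open ≤-Reasoning
  t = (t₀₀ + t₀₁) + (t₁₀ + t₁₁)
  s = t₀₀ * t₀₀ + t₀₁ * t₀₁ + (t₁₀ * t₁₀ + t₁₁ * t₁₁)
  D = d₀₀ + d₀₁ + (d₁₀ + d₁₁)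
  q = d₀₀ * d₀₀ + d₀₁ * d₀₁ + (d₁₀ * d₁₀ + d₁₁ * d₁₁)
  D² : D * D ≤ 4 * q
  D² = begin
    D * D ≤⟨ double-square (d₀₀ + d₀₁) (d₁₀ + d₁₁) ⟩
    2 * ((d₀₀ + d₀₁) * (d₀₀ + d₀₁)) + 2 * ((d₁₀ + d₁₁) * (d₁₀ + d₁₁))
      ≤⟨ +-mono-≤ (*-monoʳ-≤ 2 (double-square d₀₀ d₀₁)) (*-monoʳ-≤ 2 (double-square d₁₀ d₁₁)) ⟩
    2 * (2 * (d₀₀ * d₀₀) + 2 * (d₀₁ * d₀₁)) + 2 * (2 * (d₁₀ * d₁₀) + 2 * (d₁₁ * d₁₁))
      ≡⟨ solve 4 (λ x y z w → con 2 :* (con 2 :* x :+ con 2 :* y) :+ con 2 :* (con 2 :* z :+ con 2 :* w) := con 4 :* (x :+ y :+ (z :+ w))) refl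
           (d₀₀ * d₀₀) (d₀₁ * d₀₁) (d₁₀ * d₁₀) (d₁₁ * d₁₁) ⟩
    4 * q ∎

cauchy-schwarz : ∀ M (f : ℕ → ℕ) → ∑ (downFrom M) f * ∑ (downFrom M) f ≤ M * ∑[ i ← downFrom M ] (f i * f i)
cauchy-schwarz zero    f = z≤n
cauchy-schwarz (suc M) f = begin
  (a + s) * (a + s)
    ≡⟨ solve 2 (λ a s → (a :+ s) :* (a :+ s) := a :* a :+ con 2 :* (a :* s) :+ s :* s) refl a s ⟩
  a * a + 2 * (a * s) + s * s
    ≤⟨ +-mono-≤ (+-monoʳ-≤ (a * a) cross) (cauchy-schwarz M f) ⟩
  a * a + (M * (a * a) + q) + M * q
    ≡⟨ solve 3 (λ a M q → a :* a :+ (M :* (a :* a) :+ q) :+ M :* q := (con 1 :+ M) :* (a :* a :+ q)) refl a M q ⟩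
  suc M * (a * a + q) ∎
  where
  open ≤-Reasoning
  r = downFrom M
  a = f M
  s = ∑ r f
  q = ∑[ i ← r ] (f i * f i)
  const-sum : ∀ N c → ∑[ i ← downFrom N ] c ≡ N * c
  const-sum zero    c = refl
  const-sum (suc N) c = cong (c +_) (const-sum N c)
  cross : 2 * (a * s) ≤ M * (a * a) + q
  cross = begin
    2 * (a * s) ≡⟨ cong (2 *_) (sym (∑-*ˡ r a f)) ⟩
    2 * (∑[ i ← r ] (a * f i)) ≡⟨ sym (∑-*ˡ r 2 _) ⟩
    ∑[ i ← r ] (2 * (a * f i)) ≤⟨ ∑-mono r (λ i → 2ab≤a²+b² a (f i)) ⟩
    ∑[ i ← r ] (a * a + f i * f i) ≡⟨ ∑-+ r _ _ ⟩
    ∑[ i ← r ] (a * a) + q ≡⟨ cong (_+ q) (const-sum M (a * a)) ⟩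
    M * (a * a) + q ∎

module _ {A : Set} (xs : List A) {M} {ℓ : A → ℕ} (ℓ<M : ∀ e → ℓ e < M) where

  private r = downFrom M

  ∑-by-piece : ∀ (φ : A → ℕ) → ∑ xs φ ≡ ∑[ i ← r ] ∑[ e ← xs ] (δ (ℓ e) i * φ e)
  ∑-by-piece φ = trans (∑-cong xs λ e → sym (∑-δ (λ _ → φ e) (ℓ<M e))) (∑-swap xs r _)

  ∑-by-pieces : ∀ (φ : A → A → ℕ) → ∑[ e ← xs ] ∑[ h ← xs ] φ e h ≡
                ∑[ i ← r ] ∑[ j ← r ] pairs xs (piece xs ℓ i) (piece xs ℓ j) φ
  ∑-by-pieces φ = begin
    ∑[ e ← xs ] ∑[ h ← xs ] φ e h
      ≡⟨ ∑-by-piece _ ⟩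
    ∑[ i ← r ] ∑[ e ← xs ] (δ (ℓ e) i * ∑[ h ← xs ] φ e h)
      ≡⟨ ∑-cong₂ r xs (λ i e → sym (∑-*ˡ xs (δ (ℓ e) i) _)) ⟩
    ∑[ i ← r ] ∑[ e ← xs ] ∑[ h ← xs ] (δ (ℓ e) i * φ e h)
      ≡⟨ ∑-cong₂ r xs (λ i e → ∑-by-piece _) ⟩
    ∑[ i ← r ] ∑[ e ← xs ] ∑[ j ← r ] ∑[ h ← xs ] (δ (ℓ h) j * (δ (ℓ e) i * φ e h))
      ≡⟨ ∑-cong r (λ i → ∑-swap xs r _) ⟩
    ∑[ i ← r ] ∑[ j ← r ] ∑[ e ← xs ] ∑[ h ← xs ] (δ (ℓ h) j * (δ (ℓ e) i * φ e h))
      ≡⟨ ∑-cong₂ r r (λ i j → ∑-cong₂ xs xs λ e h →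
           solve 3 (λ a b c → a :* (b :* c) := b :* a :* c) refl (δ (ℓ h) j) (δ (ℓ e) i) (φ e h)) ⟩
    ∑[ i ← r ] ∑[ j ← r ] pairs xs (piece xs ℓ i) (piece xs ℓ j) φ ∎
    where open ≡-Reasoning

  -- The pairs `e`, `h` fall into `M * M` groups according to their two pieces, and `linked` is the
  -- sum of the squares of the group totals.
  cauchy-schwarz-linked : ∀ (φ : A → A → ℕ) → let s = ∑[ e ← xs ] ∑[ h ← xs ] φ e h in
    s * s ≤ M * M * linked xs ℓ (λ e h f g → φ e h * φ f g)
  cauchy-schwarz-linked φ = begin
    s * s ≡⟨ cong₂ _*_ (∑-by-pieces φ) (∑-by-pieces φ) ⟩
    ∑[ i ← r ] ∑ r (T i) * ∑[ i ← r ] ∑ r (T i) ≤⟨ cauchy-schwarz M _ ⟩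
    M * (∑[ i ← r ] (∑ r (T i) * ∑ r (T i))) ≤⟨ *-monoʳ-≤ M (∑-mono r λ i → cauchy-schwarz M (T i)) ⟩
    M * (∑[ i ← r ] (M * ∑[ j ← r ] (T i j * T i j))) ≡⟨ cong (M *_) (∑-*ˡ r M _) ⟩
    M * (M * (∑[ i ← r ] ∑[ j ← r ] (T i j * T i j))) ≡⟨ sym (*-assoc M M _) ⟩
    M * M * (∑[ i ← r ] ∑[ j ← r ] (T i j * T i j)) ≡⟨ cong (M * M *_) (sym (linked-* xs ℓ<M φ φ)) ⟩
    M * M * linked xs ℓ (λ e h f g → φ e h * φ f g) ∎
    where
    open ≤-Reasoning
    s = ∑[ e ← xs ] ∑[ h ← xs ] φ e h
    T : ℕ → ℕ → ℕ
    T i j = pairs xs (piece xs ℓ i) (piece xs ℓ j) φ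

  -- The double sum is the sum of the squared degrees, that is, of the squared sizes of the pieces.
  length²-≤ : length xs * length xs ≤ M * (∑[ e ← xs ] ∑[ f ← xs ] δ (ℓ e) (ℓ f))
  length²-≤ = begin
    length xs * length xs ≡⟨ cong₂ _*_ len len ⟩
    ∑ r size * ∑ r size ≤⟨ cauchy-schwarz M size ⟩
    M * ∑[ i ← r ] (size i * size i) ≡⟨ cong (M *_) (trans (∑-cong r (λ i → ∑-*-∑ xs xs _ _)) (trans (∑-swap r xs _) (∑-cong xs λ e → ∑-swap r xs _))) ⟩
    M * (∑[ e ← xs ] ∑[ f ← xs ] ∑[ i ← r ] (δ (ℓ e) i * 1 * (δ (ℓ f) i * 1)))
      ≡⟨ cong (M *_) (∑-cong₂ xs xs λ e f → trans (∑-cong r λ i → *-assoc (δ (ℓ e) i) 1 (δ (ℓ f) i * 1)) (trans (∑-δ _ (ℓ<M e)) (simplify e f))) ⟩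
    M * (∑[ e ← xs ] ∑[ f ← xs ] δ (ℓ e) (ℓ f)) ∎
    where
    open ≤-Reasoning
    size : ℕ → ℕ
    size i = ∑[ e ← xs ] (δ (ℓ e) i * 1)
    len : length xs ≡ ∑ r size
    len = trans (sym (∑-ones xs)) (∑-by-piece (λ _ → 1))
    simplify : ∀ e f → 1 * (δ (ℓ f) (ℓ e) * 1) ≡ δ (ℓ e) (ℓ f)
    simplify e f = trans (+-identityʳ _) (trans (*-identityʳ _) (δ-sym (ℓ f) (ℓ e)))

-- `N` reappears on the right because every halving loses a fraction of it; that occurrence is half
-- of the left one and is subtracted.
absorb-half : ∀ L .{{_ : NonZero L}} N d κ → 2 * L * N ≤ 2 * L * d + L * (N + κ * d) → N ≤ (2 + κ) * d
absorb-half L N d κ le = *-cancelˡ-≤ L (+-cancelˡ-≤ (L * N) _ _ (begin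
  L * N + L * N ≡⟨ solve 2 (λ L N → L :* N :+ L :* N := con 2 :* L :* N) refl L N ⟩
  2 * L * N ≤⟨ le ⟩
  2 * L * d + L * (N + κ * d)
    ≡⟨ solve 4 (λ L d N k → con 2 :* L :* d :+ L :* (N :+ k :* d) := L :* N :+ L :* ((con 2 :+ k) :* d)) refl L d N κ ⟩
  L * N + L * ((2 + κ) * d) ∎))
  where open ≤-Reasoning

-- `p` and `q` are the sums of squared degrees on the two sides, `F` counts closed walks of length
-- four, `N` those with `e` ≠ `h`. Cauchy-Schwarz bounds p² and q² by `F`, while `F` is linear in
-- `p + q`, so one factor `p + q` can be cancelled.
combine-sides : ∀ m p q F N κ → p * p ≤ m * F → q * q ≤ m * F → F ≤ 2 * N + 2 * p → N ≤ (2 + κ) * (p + q) →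
                (p + q) * (p + q) ≤ (p + q) * (m * (8 * (3 + κ)))
combine-sides m p q F N κ p² q² F≤ N≤ = begin
  d * d ≤⟨ double-square p q ⟩
  2 * (p * p) + 2 * (q * q) ≤⟨ +-mono-≤ (*-monoʳ-≤ 2 p²) (*-monoʳ-≤ 2 q²) ⟩
  2 * (m * F) + 2 * (m * F) ≡⟨ solve 2 (λ m f → con 2 :* (m :* f) :+ con 2 :* (m :* f) := con 4 :* m :* f) refl m F ⟩
  4 * m * F ≤⟨ *-monoʳ-≤ (4 * m) (≤-trans F≤ (+-mono-≤ (*-monoʳ-≤ 2 N≤) (*-monoʳ-≤ 2 (m≤m+n p q)))) ⟩
  4 * m * (2 * ((2 + κ) * d) + 2 * d)
    ≡⟨ solve 3 (λ m k d → con 4 :* m :* (con 2 :* ((con 2 :+ k) :* d) :+ con 2 :* d) := d :* (m :* (con 8 :* (con 3 :+ k)))) refl m κ d ⟩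
  d * (m * (8 * (3 + κ))) ∎
  where
  open ≤-Reasoning
  d = p + q

cancel-self : ∀ d x → d * d ≤ d * x → d ≤ x
cancel-self zero    x le = z≤n
cancel-self (suc d) x le = *-cancelˡ-≤ (suc d) le

-- Kept abstract so that products with the literal are never unfolded.
abstract

  edge-constant : ℕ
  edge-constant = 2200

  1≤edge-constant : 1 ≤ edge-constant
  1≤edge-constant = s≤s z≤n

  -- As 1 ≤ L² and L ≤ L², the coefficient is 8 · (3 + 16 + 256) = 2200.
  constant-bound : ∀ L → 1 ≤ L → 8 * (3 + (8 * (2 * L) + 64 * (2 * L * (2 * L)))) ≤ edge-constant * (L * L)
  constant-bound L 1≤L = begin
    8 * (3 + (8 * (2 * L) + 64 * (2 * L * (2 * L))))
      ≡⟨ cong (λ z → 8 * (3 + z)) (cong₂ _+_ (sym (*-assoc 8 2 L)) (trans (cong (64 *_) (square 2 L)) (sym (*-assoc 64 4 (L * L))))) ⟩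
    8 * (3 + (16 * L + 256 * (L * L)))
      ≤⟨ *-monoʳ-≤ 8 (+-mono-≤ (*-monoʳ-≤ 3 (*-mono-≤ 1≤L 1≤L)) (+-monoˡ-≤ (256 * (L * L)) (*-monoʳ-≤ 16 L≤L²))) ⟩
    8 * (3 * (L * L) + (16 * (L * L) + 256 * (L * L)))
      ≡⟨ cong (8 *_) (trans (cong (3 * (L * L) +_) (sym (*-distribʳ-+ (L * L) 16 256))) (sym (*-distribʳ-+ (L * L) 3 272))) ⟩
    8 * (275 * (L * L)) ≡⟨ sym (*-assoc 8 275 (L * L)) ⟩
    2200 * (L * L) ∎
    where
    open ≤-Reasoning
    square : ∀ a L → a * L * (a * L) ≡ a * a * (L * L)
    square = solve 2 (λ a L → a :* L :* (a :* L) := a :* a :* (L :* L)) refl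
    L≤L² : L ≤ L * L
    L≤L² = ≤-trans (≤-reflexive (sym (*-identityˡ L))) (*-monoˡ-≤ L 1≤L)

-- The C₄ count

-- `P` and `Q` name the segments of an edge on C and on D, `X` and `y` its place along them.
-- `simple` and `no-aligned` are the properties (1) and (2). Only the segments of C will be halved.
module Alternating {A : Set} (xs : List A) (X y P Q : A → ℕ)
  (X-inj : ∀ {e f} → X e ≡ X f → e ≡ f)
  (y-inj : ∀ {e f} → y e ≡ y f → e ≡ f)
  (X-once : ∀ n → ∑[ e ← xs ] δ n (X e) ≤ 1)
  {MQ : ℕ} (Q<MQ : ∀ e → Q e < MQ)
  (simple : ∀ {e f} → P e ≡ P f → Q e ≡ Q f → e ≡ f)
  (no-aligned : ∀ {e h f g} → P e ≡ P f → P h ≡ P g → Q e ≡ Q h → Q f ≡ Q g →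
                X e < X f → X h < X g → y e < y h → y f < y g → ⊥)
  where

  α αᵀ : A → A → ℕ
  α e h = δ (Q e) (Q h) * lt (y e) (y h)
  αᵀ e h = α h e

  crossing : A → A → A → A → ℕ
  crossing e h f g = lt (X e) (X f) * lt (X g) (X h) + lt (X f) (X e) * lt (X h) (X g)

  -- The cycles discordant on D and, through `crossing`, also on C.
  twisted : A → A → A → A → ℕ
  twisted e h f g = discordant xs α e h f g * crossing e h f g

  -- The sum of squared degrees over both sides. It bounds the degenerate closed walks and is the
  -- lower order term throughout.
  degrees : ℕ
  degrees = ∑[ e ← xs ] ∑[ f ← xs ] δ (P e) (P f) + ∑[ e ← xs ] ∑[ f ← xs ] δ (Q e) (Q f)

  imbalances : ℕ → (A → ℕ) → ℕ
  imbalances M ℓ = ∑[ i ← downFrom M ] ∑[ j ← downFrom M ]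
    (imbalance xs (piece xs ℓ i) (piece xs ℓ j) α * imbalance xs (piece xs ℓ i) (piece xs ℓ j) α)

  matched : ∀ n n' c → ∑[ f ← xs ] ∑[ g ← xs ] (δ n (X f) * δ n' (X g) * c) ≤ c
  matched n n' c = begin
    ∑[ f ← xs ] ∑[ g ← xs ] (δ n (X f) * δ n' (X g) * c)
      ≡⟨ ∑-cong xs (λ f → ∑-*ʳ xs c _) ⟩
    ∑[ f ← xs ] (∑[ g ← xs ] (δ n (X f) * δ n' (X g)) * c)
      ≡⟨ ∑-*ʳ xs c _ ⟩
    ∑[ f ← xs ] ∑[ g ← xs ] (δ n (X f) * δ n' (X g)) * c
      ≡⟨ cong (_* c) (sym (∑-*-∑ xs xs _ _)) ⟩
    ∑[ f ← xs ] δ n (X f) * ∑[ g ← xs ] δ n' (X g) * c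
      ≤⟨ *-monoˡ-≤ c (*-mono-≤ (X-once n) (X-once n')) ⟩
    1 * 1 * c ≡⟨ +-identityʳ c ⟩
    c ∎
    where open ≤-Reasoning

  module Balance (ℓ : A → ℕ) {M} (ℓ<M : ∀ e → ℓ e < M)
                 (ℓ⇒P : ∀ {e f} → ℓ e ≡ ℓ f → P e ≡ P f) where

    ω : A → A → ℕ
    ω e f = δ (ℓ e) (ℓ f) * lt (X e) (X f)

    W Z₁ Z₂ : A → A → A → A → ℕ
    W e h f g = δ (ℓ e) (ℓ f) * δ (ℓ h) (ℓ g) * (δ (Q e) (Q h) * δ (Q f) (Q g))
    Z₁ e h f g = δ (X e) (X h) * δ (X f) (X g) * δ (P e) (P f)
    Z₂ e h f g = δ (X e) (X f) * δ (X h) (X g) * δ (Q e) (Q h)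

    W-cases : ∀ e h f g → (W e h f g ≡ 0) ⊎
              (W e h f g ≡ 1 × ℓ e ≡ ℓ f × ℓ h ≡ ℓ g × Q e ≡ Q h × Q f ≡ Q g)
    W-cases e h f g with δ-cases (ℓ e) (ℓ f) | δ-cases (ℓ h) (ℓ g) | δ-cases (Q e) (Q h) | δ-cases (Q f) (Q g)
    ... | inj₁ z | _ | _ | _ rewrite z = inj₁ refl
    ... | inj₂ (_ , o) | inj₁ z | _ | _ rewrite o | z = inj₁ refl
    ... | inj₂ (_ , o) | inj₂ (_ , o') | inj₁ z | _ rewrite o | o' | z = inj₁ refl
    ... | inj₂ (_ , o) | inj₂ (_ , o') | inj₂ (_ , o'') | inj₁ z rewrite o | o' | o'' | z = inj₁ refl
    ... | inj₂ (a , o) | inj₂ (b , o') | inj₂ (c , o'') | inj₂ (d , o''') rewrite o | o' | o'' | o''' =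
      inj₂ (refl , a , b , c , d)

    ly lx : A → A → ℕ
    ly e h = lt (y e) (y h)
    lx e h = lt (X e) (X h)

    -- Property (2) as an inequality. A cycle concordant on exactly one side gives 1 on both sides
    -- of `≤`, a twisted one gives 1 and 2, and one concordant on both would give 2 and 0. `Z₁` and
    -- `Z₂` pay for the walks with `e` = `h`, `f` = `g` and with `e` = `f`, `h` = `g`.
    CoreBound : A → A → A → A → Set
    CoreBound e h f g =
      concordant xs ly e h f g + concordant xs lx e f h g + discordant xs ly e h f g * crossing e h f g
        ≤ discordant xs ly e h f g + discordant xs lx e f h g + (Z₁ e h f g + Z₂ e h f g)

    core-Q : ∀ e f → P e ≡ P f → CoreBound e e f f
    core-Q e f Pef rewrite lt-no (≤-refl {y e}) | δ-refl (X e) | δ-refl (X f) | Pef | δ-refl (P f)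
      with comparison (X e) (X f)
    ... | less _ p q rewrite p | q    = s≤s z≤n
    ... | greater _ p q rewrite p | q = s≤s z≤n
    ... | equal _ p q rewrite p | q   = z≤n

    core-P : ∀ e h → Q e ≡ Q h → CoreBound e h e h
    core-P e h Qeh rewrite lt-no (≤-refl {X e}) | δ-refl (X e) | δ-refl (X h) | Qeh | δ-refl (Q h)
      with comparison (y e) (y h)
    ... | less _ p q rewrite p | q    = m≤n+m 1 (δ (X e) (X h) * δ (X e) (X h) * δ (P e) (P e))
    ... | greater _ p q rewrite p | q = m≤n+m 1 (δ (X e) (X h) * δ (X e) (X h) * δ (P e) (P e))
    ... | equal _ p q rewrite p | q   = z≤n

    -- A tie in one of the four comparisons collapses the walk to two edges by (1). Of the sixteen
    -- sign patterns without ties, the four aligned ones are `no-aligned` after a symmetry of the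
    -- 4-cycle.
    core : ∀ e h f g → P e ≡ P f → P h ≡ P g → Q e ≡ Q h → Q f ≡ Q g → CoreBound e h f g
    core e h f g Pef Phg Qeh Qfg with comparison (y e) (y h) | comparison (y f) (y g)
                                     | comparison (X e) (X f) | comparison (X h) (X g)
    ... | equal e≡h _ _ | _ | _ | _
          with refl ← y-inj e≡h
          with refl ← simple {f} {g} (trans (sym Pef) Phg) Qfg = core-Q e f Pef
    core e h f g Pef Phg Qeh Qfg | _ | equal f≡g _ _ | _ | _
          with refl ← y-inj f≡g
          with refl ← simple {e} {h} (trans Pef (sym Phg)) Qeh = core-Q e f Pef
    core e h f g Pef Phg Qeh Qfg | _ | _ | equal e≡f _ _ | _
          with refl ← X-inj e≡f
          with refl ← simple {h} {g} Phg (trans (sym Qeh) Qfg) = core-P e h Qeh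
    core e h f g Pef Phg Qeh Qfg | _ | _ | _ | equal h≡g _ _
          with refl ← X-inj h≡g
          with refl ← simple {e} {f} Pef (trans Qeh (sym Qfg)) = core-P e h Qeh
    core e h f g Pef Phg Qeh Qfg | less a _ _ | less b _ _ | less c _ _ | less d _ _ =
      ⊥-elim (no-aligned Pef Phg Qeh Qfg c d a b)
    core e h f g Pef Phg Qeh Qfg | less a _ _ | less b _ _ | greater c _ _ | greater d _ _ =
      ⊥-elim (no-aligned (sym Pef) (sym Phg) Qfg Qeh c d b a)
    core e h f g Pef Phg Qeh Qfg | greater a _ _ | greater b _ _ | less c _ _ | less d _ _ =
      ⊥-elim (no-aligned Phg Pef (sym Qeh) (sym Qfg) d c a b)
    core e h f g Pef Phg Qeh Qfg | greater a _ _ | greater b _ _ | greater c _ _ | greater d _ _ =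
      ⊥-elim (no-aligned (sym Phg) (sym Pef) (sym Qfg) (sym Qeh) d c b a)
    core e h f g Pef Phg Qeh Qfg | less _ a a' | less _ b b' | less _ c c' | greater _ d d'
      rewrite a | a' | b | b' | c | c' | d | d' = s≤s z≤n
    core e h f g Pef Phg Qeh Qfg | less _ a a' | less _ b b' | greater _ c c' | less _ d d'
      rewrite a | a' | b | b' | c | c' | d | d' = s≤s z≤n
    core e h f g Pef Phg Qeh Qfg | greater _ a a' | greater _ b b' | less _ c c' | greater _ d d'
      rewrite a | a' | b | b' | c | c' | d | d' = s≤s z≤n
    core e h f g Pef Phg Qeh Qfg | greater _ a a' | greater _ b b' | greater _ c c' | less _ d d'
      rewrite a | a' | b | b' | c | c' | d | d' = s≤s z≤n
    core e h f g Pef Phg Qeh Qfg | less _ a a' | greater _ b b' | less _ c c' | less _ d d'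
      rewrite a | a' | b | b' | c | c' | d | d' = s≤s z≤n
    core e h f g Pef Phg Qeh Qfg | less _ a a' | greater _ b b' | greater _ c c' | greater _ d d'
      rewrite a | a' | b | b' | c | c' | d | d' = s≤s z≤n
    core e h f g Pef Phg Qeh Qfg | greater _ a a' | less _ b b' | less _ c c' | less _ d d'
      rewrite a | a' | b | b' | c | c' | d | d' = s≤s z≤n
    core e h f g Pef Phg Qeh Qfg | greater _ a a' | less _ b b' | greater _ c c' | greater _ d d'
      rewrite a | a' | b | b' | c | c' | d | d' = s≤s z≤n
    core e h f g Pef Phg Qeh Qfg | less _ a a' | greater _ b b' | less _ c c' | greater _ d d'
      rewrite a | a' | b | b' | c | c' | d | d' = s≤s z≤n
    core e h f g Pef Phg Qeh Qfg | less _ a a' | greater _ b b' | greater _ c c' | less _ d d'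
      rewrite a | a' | b | b' | c | c' | d | d' = s≤s z≤n
    core e h f g Pef Phg Qeh Qfg | greater _ a a' | less _ b b' | less _ c c' | greater _ d d'
      rewrite a | a' | b | b' | c | c' | d | d' = s≤s z≤n
    core e h f g Pef Phg Qeh Qfg | greater _ a a' | less _ b b' | greater _ c c' | less _ d d'
      rewrite a | a' | b | b' | c | c' | d | d' = s≤s z≤n

    weighted : ∀ e h f g →
      W e h f g * concordant xs ly e h f g + W e h f g * concordant xs lx e f h g
        + W e h f g * (discordant xs ly e h f g * crossing e h f g)
      ≤ W e h f g * discordant xs ly e h f g + W e h f g * discordant xs lx e f h g + (Z₁ e h f g + Z₂ e h f g)
    weighted e h f g with W-cases e h f g
    ... | inj₁ z rewrite z = z≤n
    ... | inj₂ (o , ℓef , ℓhg , Qeh , Qfg) rewrite o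
        | +-identityʳ (concordant xs ly e h f g) | +-identityʳ (concordant xs lx e f h g)
        | +-identityʳ (discordant xs ly e h f g * crossing e h f g)
        | +-identityʳ (discordant xs ly e h f g) | +-identityʳ (discordant xs lx e f h g) =
        core e h f g (ℓ⇒P ℓef) (ℓ⇒P ℓhg) Qeh Qfg

    α-concordant : ∀ e h f g → δ (ℓ e) (ℓ f) * δ (ℓ h) (ℓ g) * concordant xs α e h f g
                              ≡ W e h f g * concordant xs ly e h f g
    α-concordant e h f g rewrite δ-sym (Q h) (Q e) | δ-sym (Q g) (Q f) =
      solve 7 (λ w a b p q r s → w :* (a :* p :* (b :* q) :+ a :* r :* (b :* s)) := w :* (a :* b) :* (p :* q :+ r :* s)) refl
        (δ (ℓ e) (ℓ f) * δ (ℓ h) (ℓ g)) (δ (Q e) (Q h)) (δ (Q f) (Q g)) (ly e h) (ly f g) (ly h e) (ly g f)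

    α-discordant : ∀ e h f g → δ (ℓ e) (ℓ f) * δ (ℓ h) (ℓ g) * discordant xs α e h f g
                              ≡ W e h f g * discordant xs ly e h f g
    α-discordant e h f g rewrite δ-sym (Q h) (Q e) | δ-sym (Q g) (Q f) =
      solve 7 (λ w a b p q r s → w :* (a :* p :* (b :* q) :+ a :* r :* (b :* s)) := w :* (a :* b) :* (p :* q :+ r :* s)) refl
        (δ (ℓ e) (ℓ f) * δ (ℓ h) (ℓ g)) (δ (Q e) (Q h)) (δ (Q f) (Q g)) (ly e h) (ly g f) (ly h e) (ly f g)

    ω-concordant : ∀ e h f g → δ (Q e) (Q h) * δ (Q f) (Q g) * concordant xs ω e f h g
                              ≡ W e h f g * concordant xs lx e f h g
    ω-concordant e h f g rewrite δ-sym (ℓ f) (ℓ e) | δ-sym (ℓ g) (ℓ h) =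
      solve 7 (λ w a b p q r s → w :* (a :* p :* (b :* q) :+ a :* r :* (b :* s)) := (a :* b) :* w :* (p :* q :+ r :* s)) refl
        (δ (Q e) (Q h) * δ (Q f) (Q g)) (δ (ℓ e) (ℓ f)) (δ (ℓ h) (ℓ g)) (lx e f) (lx h g) (lx f e) (lx g h)

    ω-discordant : ∀ e h f g → δ (Q e) (Q h) * δ (Q f) (Q g) * discordant xs ω e f h g
                              ≡ W e h f g * discordant xs lx e f h g
    ω-discordant e h f g rewrite δ-sym (ℓ f) (ℓ e) | δ-sym (ℓ g) (ℓ h) =
      solve 7 (λ w a b p q r s → w :* (a :* p :* (b :* q) :+ a :* r :* (b :* s)) := (a :* b) :* w :* (p :* q :+ r :* s)) refl
        (δ (Q e) (Q h) * δ (Q f) (Q g)) (δ (ℓ e) (ℓ f)) (δ (ℓ h) (ℓ g)) (lx e f) (lx g h) (lx f e) (lx h g)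

    twisted-W : ∀ e h f g → δ (ℓ e) (ℓ f) * δ (ℓ h) (ℓ g) * twisted e h f g
                           ≡ W e h f g * (discordant xs ly e h f g * crossing e h f g)
    twisted-W e h f g = begin
      v * (discordant xs α e h f g * crossing e h f g) ≡⟨ sym (*-assoc v _ _) ⟩
      v * discordant xs α e h f g * crossing e h f g   ≡⟨ cong (_* crossing e h f g) (α-discordant e h f g) ⟩
      W e h f g * discordant xs ly e h f g * crossing e h f g ≡⟨ *-assoc (W e h f g) _ _ ⟩
      W e h f g * (discordant xs ly e h f g * crossing e h f g) ∎
      where
      open ≡-Reasoning
      v = δ (ℓ e) (ℓ f) * δ (ℓ h) (ℓ g)

    pointwise-sum :
      linked xs ℓ (concordant xs α) + linked xs Q (concordant xs ω) + linked xs ℓ twisted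
      ≤ linked xs ℓ (discordant xs α) + linked xs Q (discordant xs ω) + (∑⁴ xs Z₁ + ∑⁴ xs Z₂)
    pointwise-sum = begin
      linked xs ℓ (concordant xs α) + linked xs Q (concordant xs ω) + linked xs ℓ twisted
        ≡⟨ cong₂ _+_ (cong₂ _+_ (∑⁴-cong xs α-concordant)
             (trans (sym (∑⁴-swap xs _)) (∑⁴-cong xs ω-concordant))) (∑⁴-cong xs twisted-W) ⟩
      ∑⁴ xs F₁ + ∑⁴ xs F₂ + ∑⁴ xs F₃
        ≡⟨ sym (trans (∑⁴-+ xs (λ e h f g → F₁ e h f g + F₂ e h f g) F₃) (cong (_+ ∑⁴ xs F₃) (∑⁴-+ xs F₁ F₂))) ⟩
      ∑⁴ xs (λ e h f g → F₁ e h f g + F₂ e h f g + F₃ e h f g)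
        ≤⟨ ∑⁴-mono xs weighted ⟩
      ∑⁴ xs (λ e h f g → G₁ e h f g + G₂ e h f g + (Z₁ e h f g + Z₂ e h f g))
        ≡⟨ trans (∑⁴-+ xs (λ e h f g → G₁ e h f g + G₂ e h f g) (λ e h f g → Z₁ e h f g + Z₂ e h f g))
             (cong₂ _+_ (∑⁴-+ xs G₁ G₂) (∑⁴-+ xs Z₁ Z₂)) ⟩
      ∑⁴ xs G₁ + ∑⁴ xs G₂ + (∑⁴ xs Z₁ + ∑⁴ xs Z₂)
        ≡⟨ cong (_+ (∑⁴ xs Z₁ + ∑⁴ xs Z₂)) (sym (cong₂ _+_ (∑⁴-cong xs α-discordant)
             (trans (sym (∑⁴-swap xs _)) (∑⁴-cong xs ω-discordant)))) ⟩
      linked xs ℓ (discordant xs α) + linked xs Q (discordant xs ω) + (∑⁴ xs Z₁ + ∑⁴ xs Z₂) ∎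
      where
      open ≤-Reasoning
      F₁ F₂ F₃ G₁ G₂ : A → A → A → A → ℕ
      F₁ e h f g = W e h f g * concordant xs ly e h f g
      F₂ e h f g = W e h f g * concordant xs lx e f h g
      F₃ e h f g = W e h f g * (discordant xs ly e h f g * crossing e h f g)
      G₁ e h f g = W e h f g * discordant xs ly e h f g
      G₂ e h f g = W e h f g * discordant xs lx e f h g

    -- On either side the concordant count is the discordant one plus a sum of squares. Summing
    -- `CoreBound` over all walks therefore cancels the discordant counts; the squares for `ω` are
    -- dropped, and the degenerate walks amount to at most `degrees`.
    balance : imbalances M ℓ + linked xs ℓ twisted ≤ degrees
    balance = +-cancelˡ-≤ (s + t) _ _ (begin
      (s + t) + (imbalances M ℓ + linked xs ℓ twisted)
        ≡⟨ solve 4 (λ s t i c → (s :+ t) :+ (i :+ c) := (s :+ i) :+ t :+ c) refl s t (imbalances M ℓ) (linked xs ℓ twisted) ⟩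
      (s + imbalances M ℓ) + t + linked xs ℓ twisted
        ≤⟨ +-monoˡ-≤ _ (+-mono-≤ (≤-reflexive (sym (linked-concordant xs ℓ<M α)))
             (≤-trans (m≤m+n t _) (≤-reflexive (sym (linked-concordant xs Q<MQ ω))))) ⟩
      linked xs ℓ (concordant xs α) + linked xs Q (concordant xs ω) + linked xs ℓ twisted
        ≤⟨ pointwise-sum ⟩
      (s + t) + (∑⁴ xs Z₁ + ∑⁴ xs Z₂)
        ≤⟨ +-monoʳ-≤ (s + t) (+-mono-≤
             (≤-trans (≤-reflexive (∑⁴-swap xs Z₁)) (∑-mono₂ xs xs λ e f → matched (X e) (X f) _))
             (∑-mono₂ xs xs λ e h → matched (X e) (X h) _)) ⟩
      (s + t) + degrees ∎)
      where
      open ≤-Reasoning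
      s = linked xs ℓ (discordant xs α)
      t = linked xs Q (discordant xs ω)

  -- Contrapositive of (2). A tie `X g` = `X h` would force `e` = `f` by (1).
  opposite : ∀ {e h f g} → P e ≡ P f → P h ≡ P g → Q e ≡ Q h → Q f ≡ Q g → X e < X f →
             (y e < y h × y f < y g) ⊎ (y h < y e × y g < y f) → X g < X h
  opposite {e} {h} {f} {g} Pef Phg Qeh Qfg e<f same with <-cmp (X g) (X h) | same
  ... | tri< g<h _ _ | _ = g<h
  ... | tri≈ _ g≡h _ | _ with refl ← X-inj g≡h with refl ← simple Pef (trans Qeh (sym Qfg)) = ⊥-elim (<-irrefl refl e<f)
  ... | tri> _ _ h<g | inj₁ (e<h , f<g) = ⊥-elim (no-aligned Pef Phg Qeh Qfg e<f h<g e<h f<g)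
  ... | tri> _ _ h<g | inj₂ (h<e , g<f) = ⊥-elim (no-aligned Phg Pef (sym Qeh) (sym Qfg) h<g e<f h<e g<f)

  α-cases : ∀ e h → (α e h ≡ 0) ⊎ (α e h ≡ 1 × Q e ≡ Q h × y e < y h)
  α-cases e h with δ-cases (Q e) (Q h) | lt-cases (y e) (y h)
  ... | inj₁ z | _ rewrite z = inj₁ refl
  ... | inj₂ (_ , o) | inj₁ z rewrite o | z = inj₁ refl
  ... | inj₂ (q , o) | inj₂ (l , o') rewrite o | o' = inj₂ (refl , q , l)

  -- Sets of edges appear as weights, hence conditions on members are stated for the pairs whose
  -- product of weights does not vanish.
  Cell : (A → ℕ) → (A → ℕ) → Set
  Cell p₀ p₁ = ∀ e f → (p₀ e * p₁ f ≡ 0) ⊎ P e ≡ P f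

  Before : (A → ℕ) → (A → ℕ) → Set
  Before p₀ p₁ = ∀ e f → (p₀ e * p₁ f ≡ 0) ⊎ (P e ≡ P f × X e < X f)

  module Cells (p₀ p₁ q : A → ℕ) (p₀<p₁ : Before p₀ p₁) (q-cell : Cell q q) where

    twist : ℕ
    twist = quads xs p₀ q p₁ q twisted

    data Weight (e h f g : A) : Set where
      vanishing : (p₀ e * q h) * (p₁ f * q g) ≡ 0 → Weight e h f g
      present   : P e ≡ P f → X e < X f → P h ≡ P g → Weight e h f g

    weight : ∀ e h f g → Weight e h f g
    weight e h f g with p₀<p₁ e f | q-cell h g
    ... | inj₁ z | _ = vanishing (begin
          (p₀ e * q h) * (p₁ f * q g) ≡⟨ solve 4 (λ a b c d → a :* b :* (c :* d) := a :* c :* (b :* d)) refl (p₀ e) (q h) (p₁ f) (q g) ⟩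
          (p₀ e * p₁ f) * (q h * q g) ≡⟨ cong (_* (q h * q g)) z ⟩
          0 ∎)
      where open ≡-Reasoning
    ... | inj₂ _ | inj₁ z = vanishing (begin
          (p₀ e * q h) * (p₁ f * q g) ≡⟨ solve 4 (λ a b c d → a :* b :* (c :* d) := b :* d :* (a :* c)) refl (p₀ e) (q h) (p₁ f) (q g) ⟩
          (q h * q g) * (p₀ e * p₁ f) ≡⟨ cong (_* (p₀ e * p₁ f)) z ⟩
          0 ∎)
      where open ≡-Reasoning
    ... | inj₂ (Pef , e<f) | inj₂ Phg = present Pef e<f Phg

    crossing≥1 : ∀ {e h f g} → X e < X f → X g < X h → 1 ≤ crossing e h f g
    crossing≥1 {e} {h} {f} {g} e<f g<h rewrite lt-yes e<f | lt-yes g<h = s≤s z≤n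

    all-twisted : ∀ (φ ψ : A → A → ℕ) → (∀ e h f g → φ e h * ψ f g ≤ discordant xs α e h f g) →
      (∀ e h f g → (p₀ e * q h) * (p₁ f * q g) * (φ e h * ψ f g) ≡ 0 ⊎ X g < X h) →
      (∀ e h f g → (p₀ e * q h) * (p₁ f * q g) ≡ 0 ⊎ X e < X f) →
      pairs xs p₀ q φ * pairs xs p₁ q ψ ≤ twist
    all-twisted φ ψ opp cross order = begin
      pairs xs p₀ q φ * pairs xs p₁ q ψ ≡⟨ sym (quads-* xs p₀ q p₁ q φ ψ) ⟩
      quads xs p₀ q p₁ q (λ e h f g → φ e h * ψ f g) ≤⟨ ∑⁴-mono xs le ⟩
      twist ∎
      where
      open ≤-Reasoning
      le : ∀ e h f g → (p₀ e * q h) * (p₁ f * q g) * (φ e h * ψ f g) ≤ (p₀ e * q h) * (p₁ f * q g) * twisted e h f g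
      le e h f g with cross e h f g | order e h f g
      ... | inj₁ z   | _        rewrite z = z≤n
      ... | inj₂ _   | inj₁ z   rewrite z = z≤n
      ... | inj₂ g<h | inj₂ e<f = *-monoʳ-≤ ((p₀ e * q h) * (p₁ f * q g)) (begin
        φ e h * ψ f g                            ≡⟨ sym (*-identityʳ _) ⟩
        φ e h * ψ f g * 1                        ≤⟨ *-mono-≤ (opp e h f g) (crossing≥1 e<f g<h) ⟩
        discordant xs α e h f g * crossing e h f g ∎)

    order : ∀ e h f g → (p₀ e * q h) * (p₁ f * q g) ≡ 0 ⊎ X e < X f
    order e h f g with weight e h f g
    ... | vanishing z     = inj₁ z
    ... | present _ e<f _ = inj₂ e<f

    -- If some pair of opposite signs is not twisted, then the two sign classes of the left half
    -- enclose those of the right half, so all pairs of the complementary signs are twisted.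
    one-product-twisted :
      (pairs xs p₀ q αᵀ * pairs xs p₁ q α ≤ twist) ⊎ (pairs xs p₀ q α * pairs xs p₁ q αᵀ ≤ twist)
    one-product-twisted with pairs xs p₀ q αᵀ * pairs xs p₁ q α ≤? twist
    ... | yes le = inj₁ le
    ... | no nle = inj₂ (witnessed (∑-witness xs (λ le → nle (≤-trans (≤-reflexive (sym (quads-* xs p₀ q p₁ q αᵀ α))) le))))
      where
      Goal : Set
      Goal = pairs xs p₀ q α * pairs xs p₁ q αᵀ ≤ twist
      found : ∀ e h f g → ¬ ((p₀ e * q h) * (p₁ f * q g) * (αᵀ e h * α f g) ≤ (p₀ e * q h) * (p₁ f * q g) * twisted e h f g) → Goal
      found e h f g gap with weight e h f g | α-cases h e | α-cases f g
      ... | vanishing z | _ | _ = ⊥-elim (gap (subst (_≤ (p₀ e * q h) * (p₁ f * q g) * twisted e h f g)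
                                       (sym (cong (_* (αᵀ e h * α f g)) z)) z≤n))
      ... | present _ _ _ | inj₁ z | _ rewrite z | *-zeroʳ ((p₀ e * q h) * (p₁ f * q g)) = ⊥-elim (gap z≤n)
      ... | present _ _ _ | inj₂ _ | inj₁ z rewrite z | *-zeroʳ (αᵀ e h) | *-zeroʳ ((p₀ e * q h) * (p₁ f * q g)) = ⊥-elim (gap z≤n)
      ... | present Pef e<f Phg | inj₂ (_ , Qhe , yh<ye) | inj₂ (_ , Qfg , yf<yg) =
        all-twisted α αᵀ (λ _ _ _ _ → m≤m+n _ _) cross order
        where
        nonzero : ¬ ((p₀ e * q h) * (p₁ f * q g) ≡ 0)
        nonzero z = gap (subst (_≤ (p₀ e * q h) * (p₁ f * q g) * twisted e h f g)
                          (sym (cong (_* (αᵀ e h * α f g)) z)) z≤n)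
        h<g : X h < X g
        h<g with <-cmp (X h) (X g)
        ... | tri< h<g _ _ = h<g
        ... | tri≈ _ h≡g _ with refl ← X-inj h≡g with refl ← simple Pef (trans (sym Qhe) (sym Qfg)) = ⊥-elim (<-irrefl refl e<f)
        ... | tri> _ _ g<h = ⊥-elim (gap (*-monoʳ-≤ ((p₀ e * q h) * (p₁ f * q g)) (begin
              αᵀ e h * α f g                             ≡⟨ sym (*-identityʳ _) ⟩
              αᵀ e h * α f g * 1                         ≤⟨ *-mono-≤ (m≤n+m _ (α e h * α g f)) (crossing≥1 e<f g<h) ⟩
              discordant xs α e h f g * crossing e h f g ∎)))
          where open ≤-Reasoning
        cross : ∀ e' h' f' g' → (p₀ e' * q h') * (p₁ f' * q g') * (α e' h' * αᵀ f' g') ≡ 0 ⊎ X g' < X h'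
        cross e' h' f' g' with α-cases e' h' | α-cases g' f'
        ... | inj₁ z | _ rewrite z = inj₁ (*-zeroʳ ((p₀ e' * q h') * (p₁ f' * q g')))
        ... | inj₂ _ | inj₁ z rewrite z | *-zeroʳ (α e' h') = inj₁ (*-zeroʳ ((p₀ e' * q h') * (p₁ f' * q g')))
        ... | inj₂ (_ , Qe'h' , y₁) | inj₂ (_ , Qg'f' , y₂) with weight e' h' f g | weight e h f' g'
        -- The chain is `X g'` < `X h` < `X g` < `X h'`: its outer steps compare a new pair with an
        -- old pair of the same sign, its middle step is the failure of the old cycle to be
        -- crossing.
        ... | present p l r | present p' l' r' = inj₂ (<-trans
                (opposite p' r' (sym Qhe) (sym Qg'f') l' (inj₂ (yh<ye , y₂)))
                (<-trans h<g (opposite p r Qe'h' Qfg l (inj₁ (y₁ , yf<yg)))))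
        ... | vanishing z | _ with m*n≡0⇒m≡0∨n≡0 (p₀ e' * q h') z
        ...   | inj₁ z' rewrite z' = inj₁ refl
        ...   | inj₂ z' = ⊥-elim (nonzero (trans (cong ((p₀ e * q h) *_) z') (*-zeroʳ (p₀ e * q h))))
        cross e' h' f' g' | inj₂ _ | inj₂ _ | present _ _ _ | vanishing z with m*n≡0⇒m≡0∨n≡0 (p₀ e * q h) z
        ...   | inj₁ z' = ⊥-elim (nonzero (cong (_* (p₁ f * q g)) z'))
        ...   | inj₂ z' rewrite z' | *-zeroʳ (p₀ e' * q h') = inj₁ refl
      witnessed : (∃ λ e → ¬ (_ ≤ _)) → Goal
      witnessed (e , n₁) with h , n₂ ← ∑-witness xs n₁ with f , n₃ ← ∑-witness xs n₂ with g , n₄ ← ∑-witness xs n₃ = found e h f g n₄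

  total : (A → ℕ) → (A → ℕ) → ℕ
  total p q = pairs xs p q α + pairs xs p q αᵀ

  -- The square of `total` counts the closed walks of length four through two given pieces. This is
  -- the number of 4-cycles, together with the walks having `e` = `f` and `h` = `g`.
  count₄ : ℕ → (A → ℕ) → ℕ
  count₄ M ℓ = ∑[ i ← downFrom M ] ∑[ j ← downFrom M ]
    (total (piece xs ℓ i) (piece xs ℓ j) * total (piece xs ℓ i) (piece xs ℓ j))

  pairs-+ˡ : ∀ p p₀ p₁ q φ → (∀ e → p e ≡ p₀ e + p₁ e) → pairs xs p q φ ≡ pairs xs p₀ q φ + pairs xs p₁ q φ
  pairs-+ˡ p p₀ p₁ q φ p≡ = trans
    (∑-cong₂ xs xs λ e h → trans (cong (λ z → z * q h * φ e h) (p≡ e))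
      (solve 4 (λ a b c d → (a :+ b) :* c :* d := a :* c :* d :+ b :* c :* d) refl (p₀ e) (p₁ e) (q h) (φ e h)))
    (∑₂-+ xs xs _ _)

  pairs-flip : ∀ p q φ → pairs xs p q φ ≡ pairs xs q p (λ e h → φ h e)
  pairs-flip p q φ = trans (∑-swap xs xs _)
    (∑-cong₂ xs xs λ h e → cong (_* φ e h) (*-comm (p e) (q h)))

  pairs-+ʳ : ∀ p q q₀ q₁ φ → (∀ e → q e ≡ q₀ e + q₁ e) → pairs xs p q φ ≡ pairs xs p q₀ φ + pairs xs p q₁ φ
  pairs-+ʳ p q q₀ q₁ φ q≡ = trans (pairs-flip p q φ) (trans (pairs-+ˡ q q₀ q₁ p (λ e h → φ h e) q≡)
    (sym (cong₂ _+_ (pairs-flip p q₀ φ) (pairs-flip p q₁ φ))))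

  quads-flip : ∀ p q p' q' → quads xs p q p' q' twisted ≡ quads xs q p q' p' twisted
  quads-flip p q p' q' = trans (∑-swap xs xs _) (∑-cong₂ xs xs λ h e → trans (∑-swap xs xs _)
    (∑-cong₂ xs xs λ g f → cong₂ _*_ (cong₂ _*_ (*-comm (p e) (q h)) (*-comm (p' f) (q' g)))
      (cong₂ _*_ (+-comm (α e h * α g f) (α h e * α f g))
        (solve 4 (λ a b c d → a :* b :+ c :* d := d :* c :+ b :* a) refl
          (lt (X e) (X f)) (lt (X g) (X h)) (lt (X f) (X e)) (lt (X h) (X g))))))

  -- `ℓ` is the labelling after the cut; `κ` joins its pieces two by two and is the labelling before
  -- the cut.
  module Refinement (ℓ : A → ℕ) {M} (ℓ< : ∀ e → ℓ e < dbl M)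
                    (ℓ-mono : ∀ {e f} → ℓ e < ℓ f → X e < X f)
                    (half⇒P : ∀ {e f} → ⌊ ℓ e /2⌋ ≡ ⌊ ℓ f /2⌋ → P e ≡ P f) where

    κ : A → ℕ
    κ e = ⌊ ℓ e /2⌋

    piece-cell : ∀ (λ' : A → ℕ) → (∀ {e f} → λ' e ≡ λ' f → P e ≡ P f) → ∀ i → Cell (piece xs λ' i) (piece xs λ' i)
    piece-cell λ' λ'⇒P i e f with δ-cases (λ' e) i | δ-cases (λ' f) i
    ... | inj₁ z | _ rewrite z = inj₁ refl
    ... | inj₂ _ | inj₁ z rewrite z = inj₁ (*-zeroʳ (δ (λ' e) i))
    ... | inj₂ (p , _) | inj₂ (q , _) = inj₂ (λ'⇒P (trans p (sym q)))

    module Quarters (i j : ℕ) where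
      p p₀ p₁ q q₀ q₁ : A → ℕ
      p  = piece xs κ i
      p₀ = piece xs ℓ (dbl i)
      p₁ = piece xs ℓ (suc (dbl i))
      q  = piece xs κ j
      q₀ = piece xs ℓ (dbl j)
      q₁ = piece xs ℓ (suc (dbl j))

      p≡ : ∀ e → p e ≡ p₀ e + p₁ e
      p≡ e = δ-half (ℓ e) i
      q≡ : ∀ e → q e ≡ q₀ e + q₁ e
      q≡ e = δ-half (ℓ e) j

      halves-before : ∀ k → Before (piece xs ℓ (dbl k)) (piece xs ℓ (suc (dbl k)))
      halves-before k e f with δ-cases (ℓ e) (dbl k) | δ-cases (ℓ f) (suc (dbl k))
      ... | inj₁ z | _ rewrite z = inj₁ refl
      ... | inj₂ _ | inj₁ z rewrite z = inj₁ (*-zeroʳ (δ (ℓ e) (dbl k)))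
      ... | inj₂ (a , _) | inj₂ (b , _) = inj₂
            ( half⇒P (trans (cong ⌊_/2⌋ a) (trans (half-dbl k) (trans (sym (half-suc-dbl k)) (cong ⌊_/2⌋ (sym b)))))
            , ℓ-mono (subst₂ _<_ (sym a) (sym b) ≤-refl))

      t₀₀ t₀₁ t₁₀ t₁₁ : ℕ
      t₀₀ = total p₀ q₀
      t₀₁ = total p₀ q₁
      t₁₀ = total p₁ q₀
      t₁₁ = total p₁ q₁

      module Left = Cells p₀ p₁ q (halves-before i) (piece-cell κ half⇒P j)
      module Below (k : ℕ) = Cells q₀ q₁ (piece xs ℓ k) (halves-before j) (piece-cell ℓ (λ eq → half⇒P (cong ⌊_/2⌋ eq)) k)

      interchange : ∀ a b c d → (a + b) + (c + d) ≡ (a + c) + (b + d)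
      interchange = solve 4 (λ a b c d → (a :+ b) :+ (c :+ d) := (a :+ c) :+ (b :+ d)) refl

      row : ∀ p' → total p' q ≡ total p' q₀ + total p' q₁
      row p' = trans (cong₂ _+_ (pairs-+ʳ p' q q₀ q₁ α q≡) (pairs-+ʳ p' q q₀ q₁ αᵀ q≡))
        (interchange (pairs xs p' q₀ α) (pairs xs p' q₁ α) (pairs xs p' q₀ αᵀ) (pairs xs p' q₁ αᵀ))

      whole : total p q ≡ (t₀₀ + t₀₁) + (t₁₀ + t₁₁)
      whole = trans (trans (cong₂ _+_ (pairs-+ˡ p p₀ p₁ q α p≡) (pairs-+ˡ p p₀ p₁ q αᵀ p≡))
        (interchange (pairs xs p₀ q α) (pairs xs p₁ q α) (pairs xs p₀ q αᵀ) (pairs xs p₁ q αᵀ)))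
        (cong₂ _+_ (row p₀) (row p₁))

      t : ℕ
      t = (t₀₀ + t₀₁) + (t₁₀ + t₁₁)

      -- Concerns the cycles separated by the cut of the first piece, the second piece being left
      -- whole.
      left-right : (t₀₀ + t₀₁) * (t₁₀ + t₁₁) ≤ 4 * Left.twist + 2 * (t * (imbalance xs p₀ q α + imbalance xs p₁ q α))
      left-right = subst (_≤ 4 * Left.twist + 2 * (t * (imbalance xs p₀ q α + imbalance xs p₁ q α))) (cong₂ _*_ (row p₀) (row p₁))
        (separated-bound (pairs xs p₀ q α) (pairs xs p₀ q αᵀ) (pairs xs p₁ q α) (pairs xs p₁ q αᵀ) t Left.twist
          Left.one-product-twisted (≤-reflexive (cong₂ _+_ (row p₀) (row p₁))))

      -- Inside one half of the first piece, the second piece is cut. Exchanging the roles of the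
      -- two pieces also exchanges the two signs, so the alternatives `inj₁` and `inj₂` trade
      -- places.
      below-above : ∀ k → let p' = piece xs ℓ k in total p' q₀ + total p' q₁ ≤ t →
        total p' q₀ * total p' q₁ ≤ 4 * quads xs p' q₀ p' q₁ twisted + 2 * (t * (imbalance xs p' q₀ α + imbalance xs p' q₁ α))
      below-above k le = separated-bound (pairs xs p' q₀ α) (pairs xs p' q₀ αᵀ) (pairs xs p' q₁ α) (pairs xs p' q₁ αᵀ) t _
        small le
        where
        p' = piece xs ℓ k
        small : (pairs xs p' q₀ αᵀ * pairs xs p' q₁ α ≤ quads xs p' q₀ p' q₁ twisted)
              ⊎ (pairs xs p' q₀ α * pairs xs p' q₁ αᵀ ≤ quads xs p' q₀ p' q₁ twisted)
        small with Below.one-product-twisted k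
        ... | inj₁ le' = inj₂ (subst₂ _≤_ (cong₂ _*_ (pairs-flip q₀ p' αᵀ) (pairs-flip q₁ p' α)) (quads-flip q₀ p' q₁ p') le')
        ... | inj₂ le' = inj₁ (subst₂ _≤_ (cong₂ _*_ (pairs-flip q₀ p' α) (pairs-flip q₁ p' αᵀ)) (quads-flip q₀ p' q₁ p') le')

      imbalance-row : ∀ p' → imbalance xs p' q α ≤ imbalance xs p' q₀ α + imbalance xs p' q₁ α
      imbalance-row p' rewrite pairs-+ʳ p' q q₀ q₁ α q≡ | pairs-+ʳ p' q q₀ q₁ αᵀ q≡ =
        ∣-∣-+ (pairs xs p' q₀ α) (pairs xs p' q₀ αᵀ) (pairs xs p' q₁ α) (pairs xs p' q₁ αᵀ)

      -- The three families are disjoint: `e` and `f` lie in different halves of the first piece,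
      -- both in its left half, or both in its right half.
      twists : Left.twist + quads xs p₀ q₀ p₀ q₁ twisted + quads xs p₁ q₀ p₁ q₁ twisted ≤ quads xs p q p q twisted
      twists = begin
        Left.twist + quads xs p₀ q₀ p₀ q₁ twisted + quads xs p₁ q₀ p₁ q₁ twisted
          ≡⟨ sym (trans (∑⁴-+ xs (λ e h f g → F₁ e h f g + F₂ e h f g) F₃) (cong (_+ ∑⁴ xs F₃) (∑⁴-+ xs F₁ F₂))) ⟩
        ∑⁴ xs (λ e h f g → F₁ e h f g + F₂ e h f g + F₃ e h f g)
          ≤⟨ ∑⁴-mono xs le ⟩
        quads xs p q p q twisted ∎
        where
        open ≤-Reasoning
        F₁ F₂ F₃ : A → A → A → A → ℕ
        F₁ e h f g = (p₀ e * q h) * (p₁ f * q g) * twisted e h f g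
        F₂ e h f g = (p₀ e * q₀ h) * (p₀ f * q₁ g) * twisted e h f g
        F₃ e h f g = (p₁ e * q₀ h) * (p₁ f * q₁ g) * twisted e h f g
        weights : ∀ a₀ a₁ b₀ b₁ c₀ c₁ d₀ d₁ →
          (a₀ * (b₀ + b₁)) * (c₁ * (d₀ + d₁)) + (a₀ * b₀) * (c₀ * d₁) + (a₁ * b₀) * (c₁ * d₁) ≤
          ((a₀ + a₁) * (b₀ + b₁)) * ((c₀ + c₁) * (d₀ + d₁))
        weights a₀ a₁ b₀ b₁ c₀ c₁ d₀ d₁ = ≤-trans
          (m≤m+n _ (a₀ * c₀ * (b₀ * d₀ + b₁ * d₀ + b₁ * d₁) + a₁ * c₀ * (b₀ + b₁) * (d₀ + d₁) + a₁ * c₁ * (b₀ * d₀ + b₁ * d₀ + b₁ * d₁)))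
          (≤-reflexive (solve 8 (λ a₀ a₁ b₀ b₁ c₀ c₁ d₀ d₁ →
            (a₀ :* (b₀ :+ b₁)) :* (c₁ :* (d₀ :+ d₁)) :+ (a₀ :* b₀) :* (c₀ :* d₁) :+ (a₁ :* b₀) :* (c₁ :* d₁) :+
            (a₀ :* c₀ :* (b₀ :* d₀ :+ b₁ :* d₀ :+ b₁ :* d₁) :+ a₁ :* c₀ :* (b₀ :+ b₁) :* (d₀ :+ d₁) :+ a₁ :* c₁ :* (b₀ :* d₀ :+ b₁ :* d₀ :+ b₁ :* d₁))
            := ((a₀ :+ a₁) :* (b₀ :+ b₁)) :* ((c₀ :+ c₁) :* (d₀ :+ d₁))) refl a₀ a₁ b₀ b₁ c₀ c₁ d₀ d₁))
        le : ∀ e h f g → F₁ e h f g + F₂ e h f g + F₃ e h f g ≤ (p e * q h) * (p f * q g) * twisted e h f g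
        le e h f g rewrite p≡ e | p≡ f | q≡ h | q≡ g = begin
          u * w + v * w + z * w ≡⟨ solve 4 (λ u v z w → u :* w :+ v :* w :+ z :* w := (u :+ v :+ z) :* w) refl u v z w ⟩
          (u + v + z) * w ≤⟨ *-monoˡ-≤ w (weights (p₀ e) (p₁ e) (q₀ h) (q₁ h) (p₀ f) (p₁ f) (q₀ g) (q₁ g)) ⟩
          _ ∎
          where
          w = twisted e h f g
          u = (p₀ e * (q₀ h + q₁ h)) * (p₁ f * (q₀ g + q₁ g))
          v = (p₀ e * q₀ h) * (p₀ f * q₁ g)
          z = (p₁ e * q₀ h) * (p₁ f * q₁ g)

      D² : (A → ℕ) → (A → ℕ) → ℕ
      D² p' q' = imbalance xs p' q' α * imbalance xs p' q' α

      quarter-bound : ∀ K → K * (total p q * total p q) ≤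
        K * (t₀₀ * t₀₀ + t₀₁ * t₀₁ + (t₁₀ * t₁₀ + t₁₁ * t₁₁)) + total p q * total p q
          + 8 * K * quads xs p q p q twisted + 64 * (K * K) * (D² p₀ q₀ + D² p₀ q₁ + (D² p₁ q₀ + D² p₁ q₁))
      quarter-bound K rewrite whole =
        quartering K t₀₀ t₀₁ t₁₀ t₁₁ (imbalance xs p₀ q₀ α) (imbalance xs p₀ q₁ α) (imbalance xs p₁ q₀ α) (imbalance xs p₁ q₁ α)
          (imbalance xs p₀ q α) (imbalance xs p₁ q α) Left.twist (quads xs p₀ q₀ p₀ q₁ twisted) (quads xs p₁ q₀ p₁ q₁ twisted) _
          left-right (below-above (dbl i) (m≤m+n (t₀₀ + t₀₁) (t₁₀ + t₁₁))) (below-above (suc (dbl i)) (m≤n+m (t₁₀ + t₁₁) (t₀₀ + t₀₁)))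
          (imbalance-row p₀) (imbalance-row p₁) twists

      squares : t₀₀ * t₀₀ + t₀₁ * t₀₁ + (t₁₀ * t₁₀ + t₁₁ * t₁₁) ≤ total p q * total p q
      squares rewrite whole = ≤-trans
        (m≤m+n _ (2 * (t₀₀ * t₀₁ + t₁₀ * t₁₁ + (t₀₀ + t₀₁) * (t₁₀ + t₁₁))))
        (≤-reflexive (solve 4 (λ a b c d → a :* a :+ b :* b :+ (c :* c :+ d :* d) :+ con 2 :* (a :* b :+ c :* d :+ (a :+ b) :* (c :+ d))
           := (a :+ b :+ (c :+ d)) :* (a :+ b :+ (c :+ d))) refl t₀₀ t₀₁ t₁₀ t₁₁))

    open Quarters
    r = downFrom M

    ℓ⇒P : ∀ {e f} → ℓ e ≡ ℓ f → P e ≡ P f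
    ℓ⇒P eq = half⇒P (cong ⌊_/2⌋ eq)

    κ<M : ∀ e → κ e < M
    κ<M e = half-< (ℓ< e)

    -- Lets a single bound on the coarsest count serve all finer levels.
    count-mono : count₄ (dbl M) ℓ ≤ count₄ M κ
    count-mono = ≤-trans (≤-reflexive (∑-dbl₂ M _)) (∑-mono₂ r r squares)

    -- Divided by `K`: a halving loses at most 1/K of the count and `8 + 64 * K` times `degrees`.
    -- `balance` enters twice, at `κ` for the twisted cycles and at `ℓ` for the imbalances.
    count-step : ∀ K → K * count₄ M κ ≤ K * count₄ (dbl M) ℓ + count₄ M κ + (8 * K + 64 * (K * K)) * degrees
    count-step K = begin
      K * count₄ M κ
        ≡⟨ sym (∑₂-*ˡ r r K _) ⟩
      ∑[ i ← r ] ∑[ j ← r ] (K * (T i j * T i j))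
        ≤⟨ ∑-mono₂ r r (λ i j → quarter-bound i j K) ⟩
      ∑[ i ← r ] ∑[ j ← r ] (K * S i j + T i j * T i j + 8 * K * m i j + 64 * (K * K) * D i j)
        ≡⟨ trans (∑₂-+ r r _ _) (cong₂ _+_ (trans (∑₂-+ r r _ _) (cong₂ _+_ (trans (∑₂-+ r r _ _)
             (cong (_+ count₄ M κ) (∑₂-*ˡ r r K S))) (∑₂-*ˡ r r (8 * K) m))) (∑₂-*ˡ r r (64 * (K * K)) D)) ⟩
      K * (∑[ i ← r ] ∑[ j ← r ] S i j) + count₄ M κ + 8 * K * (∑[ i ← r ] ∑[ j ← r ] m i j) + 64 * (K * K) * (∑[ i ← r ] ∑[ j ← r ] D i j)
        ≡⟨ cong₂ _+_ (cong₂ _+_ (cong (λ z → K * z + count₄ M κ) (sym (∑-dbl₂ M _)))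
             (cong (8 * K *_) (sym (linked-pieces xs κ<M twisted)))) (cong (64 * (K * K) *_) (sym (∑-dbl₂ M _))) ⟩
      K * count₄ (dbl M) ℓ + count₄ M κ + 8 * K * linked xs κ twisted + 64 * (K * K) * imbalances (dbl M) ℓ
        ≤⟨ +-mono-≤ (+-monoʳ-≤ (K * count₄ (dbl M) ℓ + count₄ M κ) (*-monoʳ-≤ (8 * K) (≤-trans (m≤n+m _ _) (Balance.balance κ κ<M half⇒P))))
             (*-monoʳ-≤ (64 * (K * K)) (≤-trans (m≤m+n _ _) (Balance.balance ℓ ℓ< ℓ⇒P))) ⟩
      K * count₄ (dbl M) ℓ + count₄ M κ + 8 * K * degrees + 64 * (K * K) * degrees
        ≡⟨ solve 4 (λ z a b d → z :+ a :* d :+ b :* d := z :+ (a :+ b) :* d) refl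
             (K * count₄ (dbl M) ℓ + count₄ M κ) (8 * K) (64 * (K * K)) degrees ⟩
      K * count₄ (dbl M) ℓ + count₄ M κ + (8 * K + 64 * (K * K)) * degrees ∎
      where
      open ≤-Reasoning
      S T m D : ℕ → ℕ → ℕ
      S i j = t₀₀ i j * t₀₀ i j + t₀₁ i j * t₀₁ i j + (t₁₀ i j * t₁₀ i j + t₁₁ i j * t₁₁ i j)
      T i j = total (p i j) (q i j)
      m i j = quads xs (p i j) (q i j) (p i j) (q i j) twisted
      D i j = D² i j (p₀ i j) (q₀ i j) + D² i j (p₀ i j) (q₁ i j) + (D² i j (p₁ i j) (q₀ i j) + D² i j (p₁ i j) (q₁ i j))

  -- Iterating the halving down to single edges

  level : ℕ → A → ℕ
  level zero    e = X e
  level (suc s) e = ⌊ level s e /2⌋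

  level-mono : ∀ s {e f} → level s e < level s f → X e < X f
  level-mono zero    lt = lt
  level-mono (suc s) lt = level-mono s (≰⇒> λ le → <⇒≱ lt (⌊n/2⌋-mono le))

  linked-X≤ : ∀ (ℓ : A → ℕ) F (c : A → A → ℕ) →
    (∀ e h f g → δ (ℓ e) (ℓ f) * δ (ℓ h) (ℓ g) * F e h f g ≤ δ (X e) (X f) * δ (X h) (X g) * c e h) →
    linked xs ℓ F ≤ ∑[ e ← xs ] ∑[ h ← xs ] c e h
  linked-X≤ ℓ F c le = ≤-trans (∑⁴-mono xs le) (∑-mono₂ xs xs λ e h → matched (X e) (X h) (c e h))

  total-linked : ∀ {M} {ℓ : A → ℕ} → (∀ e → ℓ e < M) →
    count₄ M ℓ ≡ linked xs ℓ (λ e h f g → (α e h + α h e) * (α f g + α g f))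
  total-linked {M} {ℓ} ℓ<M = sym (trans (linked-* xs ℓ<M (λ e h → α e h + α h e) (λ e h → α e h + α h e))
    (∑-cong₂ (downFrom M) (downFrom M) λ i j → cong₂ _*_ (sum i j) (sum i j)))
    where
    sum : ∀ i j → pairs xs (piece xs ℓ i) (piece xs ℓ j) (λ e h → α e h + α h e) ≡ total (piece xs ℓ i) (piece xs ℓ j)
    sum i j = trans (∑-cong₂ xs xs λ e h → *-distribˡ-+ (piece xs ℓ i e * piece xs ℓ j h) (α e h) (α h e)) (∑₂-+ xs xs _ _)

  α-sum≤ : ∀ e h → α e h + α h e ≤ δ (Q e) (Q h)
  α-sum≤ e h rewrite δ-sym (Q h) (Q e) with comparison (y e) (y h)
  ... | less _ a b rewrite a | b | *-identityʳ (δ (Q e) (Q h)) | *-zeroʳ (δ (Q e) (Q h)) = ≤-reflexive (+-identityʳ _)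
  ... | equal _ a b rewrite a | b | *-zeroʳ (δ (Q e) (Q h)) = z≤n
  ... | greater _ a b rewrite a | b | *-identityʳ (δ (Q e) (Q h)) | *-zeroʳ (δ (Q e) (Q h)) = ≤-refl

  δ≤1 : ∀ a b → δ a b ≤ 1
  δ≤1 a b with δ-cases a b
  ... | inj₁ z rewrite z = z≤n
  ... | inj₂ (_ , o) rewrite o = ≤-refl

  -- At level 0 a piece is a single edge, so `e` = `f` and `h` = `g`, and only the pairs with a
  -- common segment of D remain.
  count-base : ∀ {M} → (∀ e → X e < M) → count₄ M X ≤ degrees
  count-base {M} X<M = begin
    count₄ M X ≡⟨ total-linked X<M ⟩
    linked xs X (λ e h f g → (α e h + α h e) * (α f g + α g f))
      ≤⟨ linked-X≤ X _ (λ e h → δ (Q e) (Q h)) (λ e h f g → *-monoʳ-≤ (δ (X e) (X f) * δ (X h) (X g))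
           (≤-trans (*-mono-≤ (α-sum≤ e h) (≤-trans (α-sum≤ f g) (δ≤1 (Q f) (Q g)))) (≤-reflexive (*-identityʳ _)))) ⟩
    ∑[ e ← xs ] ∑[ h ← xs ] δ (Q e) (Q h) ≤⟨ m≤n+m _ _ ⟩
    degrees ∎
    where open ≤-Reasoning

  -- Induction over the halvings. `B` is carried unchanged, so that the loss of each level is
  -- measured against the same number.
  count-levels : ∀ K s M → (∀ e → level s e < M) → (∀ {e f} → level s e ≡ level s f → P e ≡ P f) →
    ∀ B → count₄ M (level s) ≤ B →
    K * count₄ M (level s) ≤ K * degrees + s * (B + (8 * K + 64 * (K * K)) * degrees)
  count-levels K zero    M ℓ<M ℓ⇒P B le = ≤-trans (*-monoʳ-≤ K (count-base ℓ<M)) (m≤m+n _ _)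
  count-levels K (suc s) M ℓ<M ℓ⇒P B le = begin
    K * count₄ M (level (suc s))
      ≤⟨ R.count-step K ⟩
    K * count₄ (dbl M) (level s) + count₄ M (level (suc s)) + c
      ≤⟨ +-monoˡ-≤ c (+-mono-≤ (count-levels K s (dbl M) (λ e → <dbl (ℓ<M e)) (λ eq → ℓ⇒P (cong ⌊_/2⌋ eq)) B
           (≤-trans R.count-mono le)) le) ⟩
    K * degrees + s * (B + c) + B + c
      ≡⟨ solve 4 (λ k s B c → k :+ s :* (B :+ c) :+ B :+ c := k :+ (con 1 :+ s) :* (B :+ c)) refl (K * degrees) s B c ⟩
    K * degrees + suc s * (B + c) ∎
    where
    open ≤-Reasoning
    c = (8 * K + 64 * (K * K)) * degrees
    module R = Refinement (level s) {M} (λ e → <dbl (ℓ<M e)) (level-mono s) ℓ⇒P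

  module _ (L : ℕ) .{{_ : NonZero L}} {M : ℕ} (P<M : ∀ e → P e < M) (MQ≤M : MQ ≤ M)
           (P≡level : ∀ e → P e ≡ level L e) where

    private
      SP SQ : ℕ
      SP = ∑[ e ← xs ] ∑[ f ← xs ] δ (P e) (P f)
      SQ = ∑[ e ← xs ] ∑[ f ← xs ] δ (Q e) (Q f)

      Q<M : ∀ e → Q e < M
      Q<M e = <-≤-trans (Q<MQ e) MQ≤M

      N : ℕ
      N = count₄ M (level L)

      ℓ<M : ∀ e → level L e < M
      ℓ<M e = subst (_< M) (P≡level e) (P<M e)

      1≤L : 1 ≤ L
      1≤L = >-nonZero⁻¹ L

      κ : ℕ
      κ = 8 * (2 * L) + 64 * (2 * L * (2 * L))

      N≤ : N ≤ (2 + κ) * degrees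
      N≤ = absorb-half L N degrees κ
        -- The choice `K` = `2 * L` makes the `L` losses of 1/K add up to one half of `N`.
        (count-levels (2 * L) L M ℓ<M (λ {e} {f} eq → trans (P≡level e) (trans eq (sym (P≡level f)))) N ≤-refl)

      F : ℕ
      F = linked xs (level L) (λ e h f g → δ (Q e) (Q h) * δ (Q f) (Q g))

      δQ≤ : ∀ e h → δ (Q e) (Q h) ≤ (α e h + α h e) + δ (X e) (X h)
      δQ≤ e h rewrite δ-sym (Q h) (Q e) with comparison (y e) (y h)
      ... | less _ a b rewrite a | b | *-identityʳ (δ (Q e) (Q h)) = ≤-trans (m≤m+n _ _) (m≤m+n _ _)
      ... | equal eq _ _ with refl ← y-inj eq rewrite δ-refl (X e) = ≤-trans (δ≤1 (Q e) (Q e)) (m≤n+m 1 _)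
      ... | greater _ a b rewrite a | b | *-identityʳ (δ (Q e) (Q h)) | *-zeroʳ (δ (Q e) (Q h)) = m≤m+n (δ (Q e) (Q h)) (δ (X e) (X h))

      diagonal : linked xs (level L) (λ e h f g → δ (X e) (X h) * δ (X f) (X g)) ≤ SP
      diagonal = begin
        linked xs (level L) (λ e h f g → δ (X e) (X h) * δ (X f) (X g)) ≤⟨ ∑⁴-mono xs le ⟩
        ∑⁴ xs G ≡⟨ ∑⁴-swap xs G ⟩
        ∑⁴ xs (λ e f h g → G e h f g) ≤⟨ ∑-mono₂ xs xs (λ e f → matched (X e) (X f) _) ⟩
        SP ∎
        where
        open ≤-Reasoning
        G : A → A → A → A → ℕ
        G e h f g = δ (X e) (X h) * δ (X f) (X g) * δ (P e) (P f)
        le : ∀ e h f g → δ (level L e) (level L f) * δ (level L h) (level L g) * (δ (X e) (X h) * δ (X f) (X g)) ≤ G e h f g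
        le e h f g rewrite P≡level e | P≡level f | *-comm (δ (X e) (X h) * δ (X f) (X g)) (δ (level L e) (level L f)) =
          *-monoˡ-≤ (δ (X e) (X h) * δ (X f) (X g)) (≤-trans (*-monoʳ-≤ (δ (level L e) (level L f)) (δ≤1 (level L h) (level L g))) (≤-reflexive (*-identityʳ (δ (level L e) (level L f)))))

      r = downFrom M
      pc : ℕ → A → ℕ
      pc = piece xs (level L)

      -- The pairs with a common segment of D split into those of distinct edges, counted by
      -- `total`, and the diagonal. Squaring the sum costs the factor 2.
      F≤ : F ≤ 2 * N + 2 * SP
      F≤ = begin
        F ≡⟨ linked-* xs ℓ<M (λ e h → δ (Q e) (Q h)) (λ e h → δ (Q e) (Q h)) ⟩
        ∑[ i ← r ] ∑[ j ← r ] (q i j * q i j)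
          ≤⟨ ∑-mono₂ r r (λ i j → *-mono-≤ (q≤ i j) (q≤ i j)) ⟩
        ∑[ i ← r ] ∑[ j ← r ] ((t i j + d i j) * (t i j + d i j))
          ≤⟨ ∑-mono₂ r r (λ i j → double-square (t i j) (d i j)) ⟩
        ∑[ i ← r ] ∑[ j ← r ] (2 * (t i j * t i j) + 2 * (d i j * d i j))
          ≡⟨ trans (∑₂-+ r r _ _) (cong₂ _+_ (∑₂-*ˡ r r 2 _) (∑₂-*ˡ r r 2 _)) ⟩
        2 * N + 2 * (∑[ i ← r ] ∑[ j ← r ] (d i j * d i j))
          ≡⟨ cong (λ z → 2 * N + 2 * z) (sym (linked-* xs ℓ<M (λ e h → δ (X e) (X h)) (λ e h → δ (X e) (X h)))) ⟩
        2 * N + 2 * linked xs (level L) (λ e h f g → δ (X e) (X h) * δ (X f) (X g))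
          ≤⟨ +-monoʳ-≤ (2 * N) (*-monoʳ-≤ 2 diagonal) ⟩
        2 * N + 2 * SP ∎
        where
        open ≤-Reasoning
        q t d : ℕ → ℕ → ℕ
        q i j = pairs xs (pc i) (pc j) (λ e h → δ (Q e) (Q h))
        t i j = total (pc i) (pc j)
        d i j = pairs xs (pc i) (pc j) (λ e h → δ (X e) (X h))
        q≤ : ∀ i j → q i j ≤ t i j + d i j
        q≤ i j = begin
          q i j ≤⟨ ∑-mono₂ xs xs (λ e h → *-monoʳ-≤ (pc i e * pc j h) (δQ≤ e h)) ⟩
          pairs xs (pc i) (pc j) (λ e h → (α e h + α h e) + δ (X e) (X h))
            ≡⟨ ∑-cong₂ xs xs (λ e h → solve 4 (λ w a b c → w :* ((a :+ b) :+ c) := (w :* a :+ w :* b) :+ w :* c) refl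
                 (pc i e * pc j h) (α e h) (α h e) (δ (X e) (X h))) ⟩
          _ ≡⟨ trans (∑₂-+ xs xs _ _) (cong (_+ d i j) (∑₂-+ xs xs _ _)) ⟩
          t i j + d i j ∎

      SQ² : SQ * SQ ≤ M * M * F
      SQ² = cauchy-schwarz-linked xs ℓ<M (λ e h → δ (Q e) (Q h))

      SP² : SP * SP ≤ M * M * F
      SP² = ≤-trans (cauchy-schwarz-linked xs Q<M (λ e f → δ (P e) (P f))) (≤-reflexive (cong (M * M *_) flip))
        where
        -- A closed walk of length four satisfies the same four coincidences whether it is grouped
        -- by segments of C or of D.
        flip : linked xs Q (λ e h f g → δ (P e) (P h) * δ (P f) (P g)) ≡ F
        flip = trans (∑⁴-swap xs _) (∑⁴-cong xs λ e h f g → trans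
          (*-comm (δ (Q e) (Q h) * δ (Q f) (Q g)) (δ (P e) (P f) * δ (P h) (P g)))
          (cong₂ (λ a b → a * b * (δ (Q e) (Q h) * δ (Q f) (Q g)))
            (cong₂ δ (P≡level e) (P≡level f)) (cong₂ δ (P≡level h) (P≡level g))))

      T²≤ : degrees * degrees ≤ degrees * (M * M * (8 * (3 + κ)))
      T²≤ = combine-sides (M * M) SP SQ F N κ SP² SQ² F≤ N≤

      degrees≤ : degrees ≤ M * M * (8 * (3 + κ))
      degrees≤ = cancel-self degrees (M * M * (8 * (3 + κ))) T²≤

    edge-bound : length xs * length xs ≤ edge-constant * (M * M * M * (L * L))
    edge-bound = begin
      length xs * length xs ≤⟨ length²-≤ xs ℓ<M ⟩
      M * (∑[ e ← xs ] ∑[ f ← xs ] δ (level L e) (level L f))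
        ≡⟨ cong (M *_) (∑-cong₂ xs xs λ e f → sym (cong₂ δ (P≡level e) (P≡level f))) ⟩
      M * SP ≤⟨ *-monoʳ-≤ M (≤-trans (m≤m+n SP SQ) (≤-trans degrees≤ (*-monoʳ-≤ (M * M) (constant-bound L 1≤L)))) ⟩
      M * (M * M * (edge-constant * (L * L))) ≡⟨ regroup M edge-constant (L * L) ⟩
      edge-constant * (M * M * M * (L * L)) ∎
      where
      open ≤-Reasoning
      regroup : ∀ M c l → M * (M * M * (c * l)) ≡ c * (M * M * M * l)
      regroup = solve 3 (λ M c l → M :* (M :* M :* (c :* l)) := c :* (M :* M :* M :* l)) refl

-- Menger’s theorem

injective⇒surjective : ∀ {n} {f : Fin n → Fin n} → Injective _≡_ _≡_ f → ∀ j → ∃ λ i → f i ≡ j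
injective⇒surjective {suc n} {f} f-inj j with Fin.any? (λ i → f i Fin.≟ j)
... | yes hit = hit
... | no miss = ⊥-elim (1+n≰n (Fin.injective⇒≤ {f = λ i → Fin.punchOut (j≢f i)}
        (λ eq → f-inj (Fin.punchOut-injective (j≢f _) (j≢f _) eq))))
  where
  j≢f : ∀ i → j ≢ f i
  j≢f i eq = miss (i , sym eq)

module _ {V : Set} where

  lookup-injective : ∀ {xs : List V} → Unique xs → ∀ {i j} → lookup xs i ≡ lookup xs j → i ≡ j
  lookup-injective (_ ∷ _) {Fin.zero} {Fin.zero} _ = refl
  lookup-injective (x∉ ∷ _) {Fin.zero} {Fin.suc j} eq = ⊥-elim (All.lookup x∉ (∈-lookup j) eq)
  lookup-injective (x∉ ∷ _) {Fin.suc i} {Fin.zero} eq = ⊥-elim (All.lookup x∉ (∈-lookup i) (sym eq))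
  lookup-injective (_ ∷ u) {Fin.suc i} {Fin.suc j} eq = cong Fin.suc (lookup-injective u eq)

  vertices : ∀ {R : V → V → Set} {u v} → Star R u v → List V
  vertices {u = u} ε       = u ∷ []
  vertices {u = u} (_ ◅ p) = u ∷ vertices p

  module _ {R : V → V → Set} where

    source-∈ : ∀ {u v} (p : Star R u v) → u ∈ vertices p
    source-∈ ε       = here refl
    source-∈ (_ ◅ _) = here refl

    target-∈ : ∀ {u v} (p : Star R u v) → v ∈ vertices p
    target-∈ ε       = here refl
    target-∈ (_ ◅ p) = there (target-∈ p)

    ∈-◅◅ : ∀ {u v w z} (p : Star R u v) (q : Star R v w) → z ∈ vertices (p ◅◅ q) → z ∈ vertices p ⊎ z ∈ vertices q
    ∈-◅◅ ε       q z∈         = inj₂ z∈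
    ∈-◅◅ (_ ◅ p) q (here eq)  = inj₁ (here eq)
    ∈-◅◅ (_ ◅ p) q (there z∈) with ∈-◅◅ p q z∈
    ... | inj₁ z∈p = inj₁ (there z∈p)
    ... | inj₂ z∈q = inj₂ z∈q

  mapWalk : ∀ {R R' : V → V → Set} → (∀ {u w} → R u w → R' u w) → ∀ {u v} (p : Star R u v) →
            ∃ λ (q : Star R' u v) → ∀ {z} → z ∈ vertices q → z ∈ vertices p
  mapWalk f ε       = ε , λ z∈ → z∈
  mapWalk f (r ◅ p) with q , q⊆p ← mapWalk f p = f r ◅ q , λ { (here eq) → here eq ; (there z∈) → there (q⊆p z∈) }

  reverseWalk : ∀ {R R' : V → V → Set} → (∀ {u w} → R u w → R' w u) → ∀ {u v} (p : Star R u v) →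
                ∃ λ (q : Star R' v u) → ∀ {z} → z ∈ vertices q → z ∈ vertices p
  reverseWalk f ε       = ε , λ z∈ → z∈
  reverseWalk f (r ◅ p) with q , q⊆p ← reverseWalk f p = q ◅◅ (f r ◅ ε) , back
    where
    back : ∀ {z} → z ∈ vertices (q ◅◅ (f r ◅ ε)) → z ∈ vertices (r ◅ p)
    back z∈ with ∈-◅◅ q (f r ◅ ε) z∈
    ... | inj₁ z∈q                = there (q⊆p z∈q)
    ... | inj₂ (here refl)         = there (source-∈ p)
    ... | inj₂ (there (here refl)) = here refl

  -- Edges are directed and kept in a list: the induction in Menger's theorem deletes the head, and
  -- reversing the graph is `map swap`.
  Edge : List (V × V) → V → V → Set
  Edge E u w = (u , w) ∈ E

  Separates : (V → V → Set) → List V → List V → List V → Set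
  Separates R A B S = ∀ {a b} → a ∈ A → b ∈ B → (p : Star R a b) → ∃ λ s → s ∈ S × s ∈ vertices p

  record Linkage (R : V → V → Set) (A B : List V) (k : ℕ) : Set where
    field
      src dst  : Fin k → V
      src∈     : ∀ i → src i ∈ A
      dst∈     : ∀ i → dst i ∈ B
      walk     : ∀ i → Star R (src i) (dst i)
      disjoint : ∀ {i j z} → z ∈ vertices (walk i) → z ∈ vertices (walk j) → i ≡ j

  data FirstHit (R : V → V → Set) (T : List V) : V → V → Set where
    hit : ∀ {t} → t ∈ T → FirstHit R T t t
    go  : ∀ {u w t} → u ∉ T → R u w → FirstHit R T w t → FirstHit R T u t

  module _ {R : V → V → Set} {T : List V} where

    toWalk : ∀ {u t} → FirstHit R T u t → Star R u t
    toWalk (hit _)    = ε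
    toWalk (go _ r p) = r ◅ toWalk p

    hit-∈ : ∀ {u t} → FirstHit R T u t → t ∈ T
    hit-∈ (hit t∈)   = t∈
    hit-∈ (go _ _ p) = hit-∈ p

    hit-unique : ∀ {u t z} (p : FirstHit R T u t) → z ∈ vertices (toWalk p) → z ∈ T → z ≡ t
    hit-unique (hit _)     (here eq)  z∈T = eq
    hit-unique (go u∉ _ p) (here refl) z∈T = ⊥-elim (u∉ z∈T)
    hit-unique (go _ _ p)  (there z∈) z∈T = hit-unique p z∈ z∈T

    avoiding-prefix : ∀ {S u t z} → (∀ {s} → s ∈ S → s ∈ T) → (p : FirstHit R T u t) → z ∈ vertices (toWalk p) → z ∉ S →
                      ∃ λ (q : Star R u z) → ∀ {s} → s ∈ vertices q → s ∉ S
    avoiding-prefix S⊆T (hit _)     (here refl) z∉ = ε , λ { (here refl) → z∉ }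
    avoiding-prefix S⊆T (go u∉ _ p) (here refl) z∉ = ε , λ { (here refl) → z∉ }
    avoiding-prefix S⊆T (go u∉ r p) (there z∈)  z∉ with q , q∉ ← avoiding-prefix S⊆T p z∈ z∉ =
      r ◅ q , λ { (here refl) s∈ → u∉ (S⊆T s∈) ; (there s∈) → q∉ s∈ }

  FirstHitLinkage : (R : V → V → Set) → List V → List V → ℕ → Set
  FirstHitLinkage R A T k = ∃ λ (src : Fin k → V) → ∃ λ (dst : Fin k → V) →
    (∀ i → src i ∈ A) × ∃ λ (p : ∀ i → FirstHit R T (src i) (dst i)) →
    ∀ {i j z} → z ∈ vertices (toWalk (p i)) → z ∈ vertices (toWalk (p j)) → i ≡ j

module MengerTheorem {V : Set} (_≟_ : DecidableEquality V) where

  open import Data.List.Membership.DecPropositional _≟_ using (_∈?_)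

  firstHit : ∀ {R : V → V → Set} {T u v z} (p : Star R u v) → z ∈ vertices p → z ∈ T →
             ∃ λ t → ∃ λ (q : FirstHit R T u t) → ∀ {s} → s ∈ vertices (toWalk q) → s ∈ vertices p
  firstHit {T = T} {u} p z∈p z∈T with u ∈? T
  firstHit p z∈p z∈T | yes u∈T = _ , hit u∈T , λ { (here refl) → source-∈ p }
  firstHit ε (here refl) z∈T | no u∉T = ⊥-elim (u∉T z∈T)
  firstHit (r ◅ p) (here refl) z∈T | no u∉T = ⊥-elim (u∉T z∈T)
  firstHit (r ◅ p) (there z∈p) z∈T | no u∉T with t , q , q⊆p ← firstHit p z∈p z∈T =
    t , go u∉T r q , λ { (here eq) → here eq ; (there s∈) → there (q⊆p s∈) }

  module _ {x y : V} {E : List (V × V)} where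

    drop-edge : ∀ {T u t} → x ∈ T → (p : FirstHit (Edge ((x , y) ∷ E)) T u t) →
                ∃ λ (q : Star (Edge E) u t) → ∀ {z} → z ∈ vertices q → z ∈ vertices (toWalk p)
    drop-edge x∈T (hit _) = ε , λ z∈ → z∈
    drop-edge x∈T (go u∉ (here refl) p) = ⊥-elim (u∉ x∈T)
    drop-edge x∈T (go u∉ (there r) p) with q , q⊆p ← drop-edge x∈T p =
      r ◅ q , λ { (here eq) → here eq ; (there z∈) → there (q⊆p z∈) }

    uses-edge : ∀ {u v} (p : Star (Edge ((x , y) ∷ E)) u v) →
                (x ∈ vertices p) ⊎ ∃ λ (q : Star (Edge E) u v) → ∀ {z} → z ∈ vertices q → z ∈ vertices p
    uses-edge ε = inj₂ (ε , λ z∈ → z∈)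
    uses-edge (here refl ◅ p) = inj₁ (here refl)
    uses-edge (there r ◅ p) with uses-edge p
    ... | inj₁ x∈ = inj₁ (there x∈)
    ... | inj₂ (q , q⊆p) = inj₂ (r ◅ q , λ { (here eq) → here eq ; (there z∈) → there (q⊆p z∈) })

    extended-separates : ∀ {A B S} → Separates (Edge E) A B S → Separates (Edge ((x , y) ∷ E)) A B (x ∷ S)
    extended-separates sep a∈ b∈ p with uses-edge p
    ... | inj₁ x∈p = x , here refl , x∈p
    ... | inj₂ (q , q⊆p) with s , s∈S , s∈q ← sep a∈ b∈ q = s , there s∈S , q⊆p s∈q

    -- A walk up to its first vertex in x ∷ S cannot use the edge (x , y).
    linkage-to-separator : ∀ {A B S k} → Separates (Edge E) A B S →
      (∀ U → Separates (Edge ((x , y) ∷ E)) A B U → k ≤ length U) →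
      ((∀ U → Separates (Edge E) A (x ∷ S) U → k ≤ length U) → ¬ ¬ Linkage (Edge E) A (x ∷ S) k) →
      ¬ ¬ FirstHitLinkage (Edge E) A (x ∷ S) k
    linkage-to-separator {A} {B} {S} {k} sep large IH ret = IH bound (λ l → ret (truncate l))
      where
      bound : ∀ U → Separates (Edge E) A (x ∷ S) U → k ≤ length U
      bound U sepU = large U λ a∈ b∈ p →
        let s , s∈T , s∈p = extended-separates sep a∈ b∈ p
            t , q , q⊆p = firstHit p s∈p s∈T
            q' , q'⊆q = drop-edge (here refl) q
            z , z∈U , z∈q' = sepU a∈ (hit-∈ q) q'
        in z , z∈U , q⊆p (q'⊆q z∈q')
      truncate : Linkage (Edge E) A (x ∷ S) k → FirstHitLinkage (Edge E) A (x ∷ S) k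
      truncate l = src , (λ i → proj₁ (short i)) , src∈ , (λ i → proj₁ (proj₂ (short i))) ,
        λ {i} {j} z∈i z∈j → disjoint (proj₂ (proj₂ (short i)) z∈i) (proj₂ (proj₂ (short j)) z∈j)
        where
        open Linkage l
        short : ∀ i → _
        short i = firstHit {T = x ∷ S} (walk i) (target-∈ (walk i)) (dst∈ i)

  -- Disjoint walks have distinct ends. As there are as many walks as entries of `T`, the ends
  -- exhaust `T`, and `σ` inverts the map from walks to targets.
  match-targets : ∀ {R : V → V → Set} {A T} → (l : FirstHitLinkage R A T (length T)) →
    ∃ λ (σ : Fin (length T) → Fin (length T)) → (∀ j → proj₁ (proj₂ l) (σ j) ≡ lookup T j) ×
      (∀ {i j} → σ i ≡ σ j → i ≡ j) × (∀ {i j} → lookup T i ≡ lookup T j → i ≡ j)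
  match-targets {R} {A} {T} (src , dst , src∈ , p , disjoint) =
    σ , dst-σ , (λ {i} {j} eq → trans (sym (idx-σ i)) (trans (cong idx eq) (idx-σ j))) , lookup-inj
    where
    idx : Fin (length T) → Fin (length T)
    idx i = index (hit-∈ (p i))
    lookup-idx : ∀ i → lookup T (idx i) ≡ dst i
    lookup-idx i = sym (lookup-index (hit-∈ (p i)))
    dst-inj : ∀ {i j} → dst i ≡ dst j → i ≡ j
    dst-inj {i} {j} eq = disjoint (target-∈ (toWalk (p i))) (subst (_∈ vertices (toWalk (p j))) (sym eq) (target-∈ (toWalk (p j))))
    idx-inj : ∀ {i j} → idx i ≡ idx j → i ≡ j
    idx-inj {i} {j} eq = dst-inj (trans (sym (lookup-idx i)) (trans (cong (lookup T) eq) (lookup-idx j)))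
    σ : Fin (length T) → Fin (length T)
    σ j = proj₁ (injective⇒surjective idx-inj j)
    idx-σ : ∀ j → idx (σ j) ≡ j
    idx-σ j = proj₂ (injective⇒surjective idx-inj j)
    dst-σ : ∀ j → dst (σ j) ≡ lookup T j
    dst-σ j = trans (sym (lookup-idx (σ j))) (cong (lookup T) (idx-σ j))
    lookup-inj : ∀ {i j} → lookup T i ≡ lookup T j → i ≡ j
    lookup-inj {i} {j} eq = trans (sym (idx-σ i)) (trans (cong idx (dst-inj (trans (dst-σ i) (trans eq (sym (dst-σ j)))))) (idx-σ j))

  module _ {x y : V} {E Eᵒ : List (V × V)} {A B S : List V}
           (flip : ∀ {u w} → Edge Eᵒ u w → Edge E w u) (sep : Separates (Edge E) A B S) where

    -- Two walks ending at the same vertex of `S` are glued there, and the walks ending at `x` and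
    -- `y` are joined by the deleted edge.
    join-linkages : FirstHitLinkage (Edge E) A (x ∷ S) (suc (length S)) →
                    FirstHitLinkage (Edge Eᵒ) B (y ∷ S) (suc (length S)) →
                    Linkage (Edge ((x , y) ∷ E)) A B (suc (length S))
    join-linkages l@(srcP , dstP , srcP∈ , P , P-disj) m@(srcQ , dstQ , srcQ∈ , Q , Q-disj)
      with σ , dst-σ , σ-inj , lookupP-inj ← match-targets l
         | τ , dst-τ , τ-inj , lookupQ-inj ← match-targets m = record
      { src = λ j → srcP (σ j) ; dst = λ j → srcQ (τ j)
      ; src∈ = λ j → srcP∈ (σ j) ; dst∈ = λ j → srcQ∈ (τ j)
      ; walk = λ j → proj₁ (joined j)
      ; disjoint = disj }
      where
      link : ∀ j {u v} → u ≡ lookup (x ∷ S) j → v ≡ lookup (y ∷ S) j →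
             ∃ λ (p : Star (Edge ((x , y) ∷ E)) u v) → ∀ {z} → z ∈ vertices p → z ≡ u ⊎ z ≡ v
      link Fin.zero    refl refl = here refl ◅ ε , λ { (here eq) → inj₁ eq ; (there (here eq)) → inj₂ eq }
      link (Fin.suc j) refl refl = ε , λ { (here eq) → inj₁ eq }
      OnP OnQ : Fin (suc (length S)) → V → Set
      OnP j z = z ∈ vertices (toWalk (P (σ j)))
      OnQ j z = z ∈ vertices (toWalk (Q (τ j)))
      joined : ∀ j → ∃ λ (p : Star (Edge ((x , y) ∷ E)) (srcP (σ j)) (srcQ (τ j))) → ∀ {z} → z ∈ vertices p → OnP j z ⊎ OnQ j z
      joined j with mapWalk {R' = Edge ((x , y) ∷ E)} there (toWalk (P (σ j)))
                  | reverseWalk {R' = Edge ((x , y) ∷ E)} (λ r → there (flip r)) (toWalk (Q (τ j)))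
                  | link j (dst-σ j) (dst-τ j)
      ... | p , p⊆ | q , q⊆ | r , r⊆ = p ◅◅ (r ◅◅ q) , covers
        where
        covers : ∀ {z} → z ∈ vertices (p ◅◅ (r ◅◅ q)) → OnP j z ⊎ OnQ j z
        covers z∈ with ∈-◅◅ p (r ◅◅ q) z∈
        ... | inj₁ z∈p = inj₁ (p⊆ z∈p)
        ... | inj₂ z∈' with ∈-◅◅ r q z∈'
        ...   | inj₂ z∈q = inj₂ (q⊆ z∈q)
        ...   | inj₁ z∈r with r⊆ z∈r
        ...     | inj₁ refl = inj₁ (target-∈ (toWalk (P (σ j))))
        ...     | inj₂ refl = inj₂ (target-∈ (toWalk (Q (τ j))))
      -- Otherwise the two walks would combine to one from A to B in E avoiding S.
      common-∈S : ∀ {i j z} → OnP i z → OnQ j z → z ∈ S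
      common-∈S {i} {j} {z} z∈P z∈Q with z ∈? S
      ... | yes z∈S = z∈S
      ... | no z∉S with p , p∉ ← avoiding-prefix there (P (σ i)) z∈P z∉S
                      | q , q∉ ← avoiding-prefix there (Q (τ j)) z∈Q z∉S
                   with q' , q'⊆ ← reverseWalk {R' = Edge E} flip q
                   with s , s∈S , s∈ ← sep (srcP∈ (σ i)) (srcQ∈ (τ j)) (p ◅◅ q')
                   with ∈-◅◅ p q' s∈
      ...   | inj₁ s∈p = ⊥-elim (p∉ s∈p s∈S)
      ...   | inj₂ s∈q = ⊥-elim (q∉ (q'⊆ s∈q) s∈S)
      -- A common vertex lies in `S`, which either walk meets only at its end, so both walks carry
      -- the index of that vertex. `Fin.suc` skips the heads `x` and `y`.
      crossing : ∀ {i j z} → OnP i z → OnQ j z → i ≡ j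
      crossing {i} {j} {z} z∈P z∈Q with z∈S ← common-∈S {i} {j} z∈P z∈Q =
        trans (lookupP-inj {i} {Fin.suc (index z∈S)}
                (trans (sym (trans (hit-unique (P (σ i)) z∈P (there z∈S)) (dst-σ i))) (lookup-index z∈S)))
              (lookupQ-inj {Fin.suc (index z∈S)} {j}
                (trans (sym (lookup-index z∈S)) (trans (hit-unique (Q (τ j)) z∈Q (there z∈S)) (dst-τ j))))
      disj : ∀ {i j z} → z ∈ vertices (proj₁ (joined i)) → z ∈ vertices (proj₁ (joined j)) → i ≡ j
      disj {i} {j} z∈i z∈j with proj₂ (joined i) z∈i | proj₂ (joined j) z∈j
      ... | inj₁ a | inj₁ b = σ-inj (P-disj a b)
      ... | inj₂ a | inj₂ b = τ-inj (Q-disj a b)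
      ... | inj₁ a | inj₂ b = crossing {i} {j} a b
      ... | inj₂ a | inj₁ b = sym (crossing {j} {i} b a)

  edge-swap : ∀ {E : List (V × V)} {u w} → Edge (map swap E) u w → Edge E w u
  edge-swap r with (_ , _) , r' , refl ← ∈-map⁻ swap r = r'

  swap-edge : ∀ {E : List (V × V)} {u w} → Edge E u w → Edge (map swap E) w u
  swap-edge = ∈-map⁺ swap

  -- Göring's proof: if deleting the edge (x , y) creates a small separator S, then S ∪ {x} and S ∪ {y}
  -- are minimum separators, and both halves are linked by induction.
  menger : ∀ n (E : List (V × V)) → length E ≡ n → ∀ A B k → (∀ U → Separates (Edge E) A B U → k ≤ length U) →
           ¬ ¬ Linkage (Edge E) A B k
  menger zero [] _ A B k large ret = ret (record
    { src = pick ; dst = pick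
    ; src∈ = λ i → proj₁ (both i) ; dst∈ = λ i → proj₂ (both i)
    ; walk = λ i → ε
    ; disjoint = λ { {i} {j} (here eq) (here eq') → Fin.inject≤-injective k≤ k≤ i j
                       (lookup-injective (DecUnique.deduplicate-! _≟_ (filter (_∈? B) A)) (trans (sym eq) eq')) } })
    where
    -- Without edges all walks are trivial, so the intersection of `A` and `B` separates.
    S : List V
    S = deduplicate _≟_ (filter (_∈? B) A)
    k≤ : k ≤ length S
    k≤ = large S λ { a∈ b∈ ε → _ , ∈-deduplicate⁺ _≟_ (∈-filter⁺ (_∈? B) a∈ b∈) , here refl ; _ _ (() ◅ _) }
    pick : Fin k → V
    pick i = lookup S (Fin.inject≤ i k≤)
    both : ∀ i → pick i ∈ A × pick i ∈ B
    both i = ∈-filter⁻ (_∈? B) (∈-deduplicate⁻ _≟_ (filter (_∈? B) A) (∈-lookup (Fin.inject≤ i k≤)))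
  menger (suc n) ((x , y) ∷ E) len A B k large ret = menger n E lenE A B k bound (λ l → ret (weaken l))
    where
    lenE : length E ≡ n
    lenE = suc-injective len
    weaken : Linkage (Edge E) A B k → Linkage (Edge ((x , y) ∷ E)) A B k
    weaken l = record
      { src = src ; dst = dst ; src∈ = src∈ ; dst∈ = dst∈
      ; walk = λ i → proj₁ (mapWalk there (walk i))
      ; disjoint = λ {i} {j} z∈i z∈j → disjoint (proj₂ (mapWalk there (walk i)) z∈i) (proj₂ (mapWalk there (walk j)) z∈j) }
      where open Linkage l
    -- Shown against `ret`: a separator that is too small yields a linkage, hence a contradiction.
    -- No decision whether such a separator exists is made.
    bound : ∀ S → Separates (Edge E) A B S → k ≤ length S
    bound S sep with k ≤? length S
    ... | yes k≤ = k≤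
    -- `x ∷ S` still separates in the graph with the edge, so `k` is exactly `suc (length S)`.
    ... | no k≰ with refl ← ≤-antisym (large (x ∷ S) (extended-separates sep)) (≰⇒> k≰) =
      ⊥-elim (linkage-to-separator sep large (menger n E lenE A (x ∷ S) _) λ l →
        linkage-to-separator {x = y} {y = x} sepᵒ largeᵒ (menger n (map swap E) (trans (length-map swap E) lenE) B (y ∷ S) _) λ m →
          ret (join-linkages edge-swap sep l m))
      where
      sepᵒ : Separates (Edge (map swap E)) B A S
      sepᵒ b∈ a∈ p with q , q⊆p ← reverseWalk {R' = Edge E} edge-swap p
                   with s , s∈S , s∈q ← sep a∈ b∈ q = s , s∈S , q⊆p s∈q
      largeᵒ : ∀ U → Separates (Edge ((y , x) ∷ map swap E)) B A U → suc (length S) ≤ length U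
      largeᵒ U sepU = large U λ a∈ b∈ p →
        let q , q⊆p = reverseWalk {R' = Edge (map swap ((x , y) ∷ E))} swap-edge p
            s , s∈U , s∈q = sepU b∈ a∈ q
        in s , s∈U , q⊆p s∈q

-- Exchanging arcs between two longest cycles

module _ {A : Set} where

  unique-++⁻ : ∀ (xs : List A) {ys} → Unique (xs ++ ys) → Unique xs × Unique ys × (∀ {z} → z ∈ xs → z ∉ ys)
  unique-++⁻ []       u = [] , u , λ ()
  unique-++⁻ (x ∷ xs) (x∉ ∷ u) with ux , uy , disj ← unique-++⁻ xs u =
    (All.++⁻ˡ xs x∉ ∷ ux) , uy , λ { (here refl) z∈ → All.lookup (All.++⁻ʳ xs x∉) z∈ refl ; (there z∈) → disj z∈ }

  unique-++⁺ : ∀ {xs ys : List A} → Unique xs → Unique ys → (∀ {z} → z ∈ xs → z ∉ ys) → Unique (xs ++ ys)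
  unique-++⁺ ux uy disj = ++⁺ ux uy λ { (z∈x , z∈y) → disj z∈x z∈y }

  unique-replace : ∀ (pre α post : List A) {γ} → Unique (pre ++ α ++ post) → Unique γ →
                   (∀ {z} → z ∈ γ → z ∉ pre × z ∉ post) → Unique (pre ++ γ ++ post)
  unique-replace pre α post u uγ fresh with upre , u' , disj ← unique-++⁻ pre u with _ , upost , _ ← unique-++⁻ α u' =
    unique-++⁺ upre (unique-++⁺ uγ upost λ z∈ → proj₂ (fresh z∈)) disj'
    where
    disj' : ∀ {z} → z ∈ pre → z ∉ _ ++ post
    disj' {z} z∈ z∈' with ∈-++⁻ _ z∈'
    ... | inj₁ z∈γ = proj₁ (fresh z∈γ) z∈
    ... | inj₂ z∈p = disj z∈ (∈-++⁺ʳ α z∈p)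

  ∈-reverse⁻ : ∀ {z : A} {xs} → z ∈ reverse xs → z ∈ xs
  ∈-reverse⁻ = reverse⁻

  unique-reverse : ∀ {xs : List A} → Unique xs → Unique (reverse xs)
  unique-reverse {[]} u = u
  unique-reverse {x ∷ xs} (x∉ ∷ u) rewrite unfold-reverse x xs =
    unique-++⁺ (unique-reverse u) ([] ∷ []) λ { z∈ (here refl) → All.lookup x∉ (∈-reverse⁻ z∈) refl }

  reverse-ends : ∀ (u : A) β v → reverse (u ∷ β ++ [ v ]) ≡ v ∷ reverse β ++ [ u ]
  reverse-ends u β v = trans (unfold-reverse u (β ++ [ v ])) (cong (_++ [ u ]) (reverse-++ β [ v ]))

-- Segments of a cycle written as a list

module ListPositions {A : Set} (_≟_ : DecidableEquality A) where

  open import Data.List.Membership.DecPropositional _≟_ using (_∈?_)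

  before : A → List A → List A
  before z []       = []
  before z (x ∷ xs) with z ≟ x
  ... | yes _ = []
  ... | no _  = x ∷ before z xs

  pos : List A → A → ℕ
  pos L z = length (before z L)

  hits : List A → List A → ℕ
  hits K xs = length (filter (_∈? K) xs)

  -- The number of the segment containing `z`, as the number of vertices of `K` passed before it.
  -- The list cuts the cycle at its first entry, so labels range from 0 to `hits K L`, one more than
  -- the cuts by `K`.
  label : List A → List A → A → ℕ
  label K L z = hits K (before z L)

  hits-++ : ∀ K xs ys → hits K (xs ++ ys) ≡ hits K xs + hits K ys
  hits-++ K xs ys = trans (cong length (filter-++ (_∈? K) xs ys)) (length-++ (filter (_∈? K) xs))

  hits≡0 : ∀ {K xs} → hits K xs ≡ 0 → ∀ {z} → z ∈ xs → z ∉ K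
  hits≡0 {K} {xs} eq z∈ z∈K = <-irrefl (sym eq) (∈-length (∈-filter⁺ (_∈? K) z∈ z∈K))

  split-at : ∀ {L z} → z ∈ L → ∃ λ post → L ≡ before z L ++ z ∷ post
  split-at {x ∷ L} {z} z∈ with z ≟ x
  split-at {x ∷ L} z∈          | yes refl = L , refl
  split-at {x ∷ L} (here refl) | no z≢x = ⊥-elim (z≢x refl)
  split-at {x ∷ L} (there z∈)  | no z≢x with post , eq ← split-at z∈ = post , cong (x ∷_) eq

  before-++ : ∀ pre z post → z ∉ pre → before z (pre ++ z ∷ post) ≡ pre
  before-++ [] z post z∉ with z ≟ z
  ... | yes _  = refl
  ... | no z≢z = ⊥-elim (z≢z refl)
  before-++ (x ∷ pre) z post z∉ with z ≟ x
  ... | yes refl = ⊥-elim (z∉ (here refl))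
  ... | no _     = cong (x ∷_) (before-++ pre z post (λ z∈ → z∉ (there z∈)))

  before-unique : ∀ pre z post → Unique (pre ++ z ∷ post) → before z (pre ++ z ∷ post) ≡ pre
  before-unique pre z post u = before-++ pre z post λ z∈ → proj₂ (proj₂ (unique-++⁻ pre u)) z∈ (here refl)

  record Between (L : List A) (u v : A) : Set where
    constructor between
    field
      inner post : List A
      split      : L ≡ before u L ++ u ∷ inner ++ v ∷ post
      before-v   : before v L ≡ before u L ++ u ∷ inner
      len        : pos L v ≡ pos L u + suc (length inner)

  before-earlier : ∀ {L u v} → Unique L → u ∈ L → v ∈ before u L → pos L v < pos L u
  before-earlier {L} {u} {v} uL u∈ v∈ with R , eq ← split-at u∈ | X , eq' ← split-at v∈ =
    subst₂ _<_ (sym (cong length bv)) (sym (trans (cong length eq') (length-++ (before v (before u L))))) (m<m+n _ (s≤s z≤n))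
    where
    eqL : L ≡ before v (before u L) ++ v ∷ (X ++ u ∷ R)
    eqL = trans eq (trans (cong (_++ u ∷ R) eq') (++-assoc (before v (before u L)) (v ∷ X) (u ∷ R)))
    bv : before v L ≡ before v (before u L)
    bv = trans (cong (before v) eqL) (before-unique _ v _ (subst Unique eqL uL))

  before-later : ∀ {L u v R} → Unique L → L ≡ before u L ++ u ∷ R → v ∈ R → before v L ≡ before u L ++ u ∷ before v R
  before-later {L} {u} {v} {R} uL eq v∈ with post , eq' ← split-at v∈ =
    trans (cong (before v) eqL) (before-unique _ v _ (subst Unique eqL uL))
    where
    eqL : L ≡ (before u L ++ u ∷ before v R) ++ v ∷ post
    eqL = trans eq (trans (cong (λ z → before u L ++ u ∷ z) eq') (sym (++-assoc (before u L) (u ∷ before v R) (v ∷ post))))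

  pos-injective : ∀ {L u v} → Unique L → u ∈ L → v ∈ L → pos L u ≡ pos L v → u ≡ v
  pos-injective {L} {u} {v} uL u∈ v∈ eq with R , eqL ← split-at u∈ with ∈-++⁻ (before u L) (subst (v ∈_) eqL v∈)
  ... | inj₂ (here refl) = refl
  ... | inj₁ v∈pre       = ⊥-elim (<-irrefl (sym eq) (before-earlier uL u∈ v∈pre))
  ... | inj₂ (there v∈R) = ⊥-elim (<-irrefl eq (subst (pos L u <_)
          (sym (trans (cong length (before-later uL eqL v∈R)) (length-++ (before u L)))) (m<m+n _ (s≤s z≤n))))

  two-split : ∀ {L u v} → Unique L → u ∈ L → v ∈ L → pos L u < pos L v → Between L u v
  two-split {L} {u} {v} uL u∈ v∈ u<v with R , eq ← split-at u∈ with ∈-++⁻ (before u L) (subst (v ∈_) eq v∈)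
  ... | inj₁ v∈pre       = ⊥-elim (<-asym u<v (before-earlier uL u∈ v∈pre))
  ... | inj₂ (here refl) = ⊥-elim (<-irrefl refl u<v)
  ... | inj₂ (there v∈R) with post , eq' ← split-at v∈R =
          between (before v R) post (trans eq (cong (λ z → before u L ++ u ∷ z) eq')) (before-later uL eq v∈R)
            (trans (cong length (before-later uL eq v∈R)) (length-++ (before u L)))

  label-mono : ∀ {K L u v} → Unique L → u ∈ L → v ∈ L → label K L u < label K L v → pos L u < pos L v
  label-mono {K} {L} {u} {v} uL u∈ v∈ lu<lv with <-cmp (pos L u) (pos L v)
  ... | tri< u<v _ _ = u<v
  ... | tri≈ _ eq _ with refl ← pos-injective uL u∈ v∈ eq = ⊥-elim (<-irrefl refl lu<lv)
  ... | tri> _ _ v<u = ⊥-elim (<⇒≱ lu<lv (subst (label K L v ≤_)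
        (sym (trans (cong (hits K) before-v) (hits-++ K (before v L) (v ∷ inner)))) (m≤m+n _ _)))
    where open Between (two-split uL v∈ u∈ v<u)

  same-label⇒free : ∀ {K L u v} → label K L u ≡ label K L v → (b : Between L u v) →
                    hits K (u ∷ Between.inner b) ≡ 0
  same-label⇒free {K} {L} {u} {v} eq b = +-cancelˡ-≡ (label K L u) _ _ (begin
    label K L u + hits K (u ∷ inner) ≡⟨ sym (hits-++ K (before u L) (u ∷ inner)) ⟩
    hits K (before u L ++ u ∷ inner) ≡⟨ cong (hits K) (sym before-v) ⟩
    label K L v                      ≡⟨ sym eq ⟩
    label K L u                      ≡⟨ sym (+-identityʳ _) ⟩
    label K L u + 0 ∎)
    where
    open ≡-Reasoning
    open Between b

  inner-label : ∀ {K L u v z} → Unique L → label K L u ≡ label K L v → (b : Between L u v) → z ∈ Between.inner b →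
                label K L z ≡ label K L u
  inner-label {K} {L} {u} {v} {z} uL eq b z∈ with post' , eq' ← split-at z∈ = begin
    label K L z ≡⟨ cong (hits K) bz ⟩
    hits K (before u L ++ u ∷ before z inner) ≡⟨ hits-++ K (before u L) (u ∷ before z inner) ⟩
    label K L u + hits K (u ∷ before z inner) ≡⟨ cong (label K L u +_) (m+n≡0⇒m≡0 _ zero-hits) ⟩
    label K L u + 0 ≡⟨ +-identityʳ _ ⟩
    label K L u ∎
    where
    open ≡-Reasoning
    open Between b
    zero-hits : hits K (u ∷ before z inner) + hits K (z ∷ post') ≡ 0
    zero-hits = trans (sym (hits-++ K (u ∷ before z inner) (z ∷ post')))
                  (trans (cong (λ w → hits K (u ∷ w)) (sym eq')) (same-label⇒free eq b))
    eqL : L ≡ (before u L ++ u ∷ before z inner) ++ z ∷ (post' ++ v ∷ post)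
    eqL = trans split (trans (cong (λ w → before u L ++ u ∷ w) (trans (cong (_++ v ∷ post) eq') (++-assoc (before z inner) (z ∷ post') (v ∷ post))))
            (sym (++-assoc (before u L) (u ∷ before z inner) (z ∷ post' ++ v ∷ post))))
    bz : before z L ≡ before u L ++ u ∷ before z inner
    bz = trans (cong (before z) eqL) (before-unique _ z _ (subst Unique eqL uL))

-- Replacing an arc of a longest cycle

module Cycles (G : Graph) where

  private
    V = Fin (n G)

  open ListPositions {V} Fin._≟_

  chain-split : ∀ xs c ys → ConsecAdj G (xs ++ c ∷ ys) → ConsecAdj G (xs ++ [ c ]) × ConsecAdj G (c ∷ ys)
  chain-split []           c ys ch = tt , ch
  chain-split (x ∷ [])     c ys (a , ch) = (a , tt) , ch
  chain-split (x ∷ y ∷ xs) c ys (a , ch) with l , r ← chain-split (y ∷ xs) c ys ch = (a , l) , r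

  chain-join : ∀ xs c ys → ConsecAdj G (xs ++ [ c ]) → ConsecAdj G (c ∷ ys) → ConsecAdj G (xs ++ c ∷ ys)
  chain-join []           c ys _ r = r
  chain-join (x ∷ [])     c ys (a , _) r = a , r
  chain-join (x ∷ y ∷ xs) c ys (a , l) r = a , chain-join (y ∷ xs) c ys l r

  chain-reverse : ∀ xs → ConsecAdj G xs → ConsecAdj G (reverse xs)
  chain-reverse []           _ = tt
  chain-reverse (x ∷ [])     _ = tt
  chain-reverse (x ∷ y ∷ xs) (a , ch) = subst (ConsecAdj G) (sym eq)
    (chain-join (reverse xs) y [ x ] (subst (ConsecAdj G) (unfold-reverse y xs) (chain-reverse (y ∷ xs) ch)) (Graph.sym G a , tt))
    where
    eq : reverse (x ∷ y ∷ xs) ≡ reverse xs ++ y ∷ [ x ]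
    eq = trans (unfold-reverse x (y ∷ xs)) (trans (cong (_++ [ x ]) (unfold-reverse y xs)) (++-assoc (reverse xs) [ y ] [ x ]))

  chain-replace : ∀ pre c α c' post {γ} → ConsecAdj G (pre ++ c ∷ α ++ c' ∷ post) → ConsecAdj G (c ∷ γ ++ [ c' ]) →
                  ConsecAdj G (pre ++ c ∷ γ ++ c' ∷ post)
  chain-replace pre c α c' post {γ} ch chγ with l , r ← chain-split pre c (α ++ c' ∷ post) ch
    with _ , r' ← chain-split (c ∷ α) c' post r = chain-join pre c (γ ++ c' ∷ post) l (chain-join (c ∷ γ) c' post chγ r')

  cycle-unique : ∀ {C} → IsCycle G C → Unique C
  cycle-unique {_ ∷ _} (_ , u , _) = u

  cycle-chain : ∀ {C} → IsCycle G C → ConsecAdj G C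
  cycle-chain {x ∷ C} (_ , _ , ch) = subst (ConsecAdj G) (++-identityʳ (x ∷ C)) (drop-last (x ∷ C) ch)
    where
    drop-last : ∀ xs {ys} → ConsecAdj G (xs ++ ys) → ConsecAdj G (xs ++ [])
    drop-last []           _ = tt
    drop-last (x ∷ [])     _ = tt
    drop-last (x ∷ y ∷ xs) (a , ch) = a , drop-last (y ∷ xs) ch

  new-cycle : ∀ pre c α c' post {γ} → IsCycle G (pre ++ c ∷ α ++ c' ∷ post) → ConsecAdj G (c ∷ γ ++ [ c' ]) →
              1 ≤ length γ → Unique (pre ++ c ∷ γ ++ c' ∷ post) → IsCycle G (pre ++ c ∷ γ ++ c' ∷ post)
  new-cycle [] c α c' post {γ} (_ , _ , ch) chγ 1≤γ u = long , u ,
    subst (ConsecAdj G) (cong (c ∷_) (sym (++-assoc γ (c' ∷ post) [ c ])))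
      (chain-replace [] c α c' (post ++ [ c ]) (subst (ConsecAdj G) (cong (c ∷_) (++-assoc α (c' ∷ post) [ c ])) ch) chγ)
    where
    long : 3 ≤ length (c ∷ γ ++ c' ∷ post)
    long rewrite length-++ γ {c' ∷ post} = s≤s (+-mono-≤ {1} {_} {1} 1≤γ (s≤s z≤n))
  new-cycle (x ∷ pre) c α c' post {γ} (_ , _ , ch) chγ 1≤γ u = long , u ,
    subst (ConsecAdj G) (sym (assoc γ)) (chain-replace (x ∷ pre) c α c' (post ++ [ x ]) (subst (ConsecAdj G) (assoc α) ch) chγ)
    where
    assoc : ∀ δ → (x ∷ pre ++ c ∷ δ ++ c' ∷ post) ++ [ x ] ≡ x ∷ pre ++ c ∷ δ ++ c' ∷ (post ++ [ x ])
    assoc δ = cong (x ∷_) (trans (++-assoc pre (c ∷ δ ++ c' ∷ post) [ x ]) (cong (λ z → pre ++ c ∷ z) (++-assoc δ (c' ∷ post) [ x ])))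
    long : 3 ≤ length (x ∷ pre ++ c ∷ γ ++ c' ∷ post)
    long rewrite length-++ pre {c ∷ γ ++ c' ∷ post} | length-++ γ {c' ∷ post} =
      s≤s (≤-trans (s≤s (≤-trans 1≤γ (m≤m+n _ _))) (m≤n+m _ (length pre)))

  -- `γ` may reuse vertices of the arc `α` that it replaces; the reversed middle arc of `exchange₂`
  -- requires this.
  arc-maximal : ∀ pre c α c' post {γ} → IsLongestCycle G (pre ++ c ∷ α ++ c' ∷ post) → ConsecAdj G (c ∷ γ ++ [ c' ]) →
                1 ≤ length γ → Unique γ → (∀ {z} → z ∈ γ → z ∈ α ⊎ z ∉ pre ++ c ∷ α ++ c' ∷ post) → length γ ≤ length α
  arc-maximal pre c α c' post {γ} (cyc , longest) chγ 1≤γ uγ fresh =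
    +-cancelʳ-≤ (suc (length post)) _ _ (s≤s⁻¹ (+-cancelˡ-≤ (length pre) _ _ (subst₂ _≤_ (len γ) (len α) (longest _ new))))
    where
    len : ∀ δ → length (pre ++ c ∷ δ ++ c' ∷ post) ≡ length pre + suc (length δ + suc (length post))
    len δ = trans (length-++ pre) (cong (λ z → length pre + suc z) (length-++ δ))
    assoc : ∀ δ → pre ++ c ∷ δ ++ c' ∷ post ≡ (pre ++ [ c ]) ++ δ ++ c' ∷ post
    assoc δ = sym (++-assoc pre [ c ] (δ ++ c' ∷ post))
    uC : Unique ((pre ++ [ c ]) ++ α ++ c' ∷ post)
    uC = subst Unique (assoc α) (cycle-unique cyc)
    fresh' : ∀ {z} → z ∈ γ → z ∉ pre ++ [ c ] × z ∉ c' ∷ post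
    fresh' {z} z∈ with fresh z∈
    ... | inj₂ z∉ = (λ z∈' → z∉ (subst (z ∈_) (sym (assoc α)) (∈-++⁺ˡ z∈')))
                  , (λ z∈' → z∉ (subst (z ∈_) (sym (assoc α)) (∈-++⁺ʳ (pre ++ [ c ]) (∈-++⁺ʳ α z∈'))))
    ... | inj₁ z∈α with _ , u' , disj ← unique-++⁻ (pre ++ [ c ]) uC with _ , _ , disj' ← unique-++⁻ α u' =
      (λ z∈' → disj z∈' (∈-++⁺ˡ z∈α)) , disj' z∈α
    new : IsCycle G (pre ++ c ∷ γ ++ c' ∷ post)
    new = new-cycle pre c α c' post cyc chγ 1≤γ (subst Unique (sym (assoc γ)) (unique-replace (pre ++ [ c ]) α (c' ∷ post) uC uγ fresh'))

  -- A bridge touches the two cycles only at its feet, each foot on one cycle only. `mid` may be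
  -- empty.
  record Bridges (C D : List V) (k : ℕ) : Set where
    field
      c d       : Fin k → V
      mid       : Fin k → List V
      c∈C       : ∀ i → c i ∈ C
      c∉D       : ∀ i → c i ∉ D
      d∈D       : ∀ i → d i ∈ D
      d∉C       : ∀ i → d i ∉ C
      c-inj     : ∀ {i j} → c i ≡ c j → i ≡ j
      d-inj     : ∀ {i j} → d i ≡ d j → i ≡ j
      chain     : ∀ i → ConsecAdj G (c i ∷ mid i ++ [ d i ])
      mid-uniq  : ∀ i → Unique (mid i)
      mid∉      : ∀ {i z} → z ∈ mid i → z ∉ C × z ∉ D
      mid-disj  : ∀ {i j z} → z ∈ mid i → z ∈ mid j → i ≡ j

  flip-bridges : ∀ {C D k} → Bridges C D k → Bridges D C k
  flip-bridges b = record
    { c = d ; d = c ; mid = λ i → reverse (mid i) ; c∈C = d∈D ; c∉D = d∉C ; d∈D = c∈C ; d∉C = c∉D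
    ; c-inj = d-inj ; d-inj = c-inj
    ; chain = λ i → subst (ConsecAdj G) (reverse-ends (c i) (mid i) (d i)) (chain-reverse _ (chain i))
    ; mid-uniq = λ i → unique-reverse (mid-uniq i)
    ; mid∉ = λ z∈ → proj₂ (mid∉ (∈-reverse⁻ z∈)) , proj₁ (mid∉ (∈-reverse⁻ z∈))
    ; mid-disj = λ z∈ z∈' → mid-disj (∈-reverse⁻ z∈) (∈-reverse⁻ z∈') }
    where open Bridges b

  ∣a-a+b∣ : ∀ {a b c} → a ≡ b + c → ∣ a - b ∣ ≡ c
  ∣a-a+b∣ {a} {b} {c} refl = trans (∣-∣-comm (b + c) b) (∣m-m+n∣≡n b c)

  -- A stretch of one segment of `D`, traversed in either direction; hence the absolute difference
  -- in `len`.
  record Arc (K D : List V) (u v : V) : Set where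
    field
      body   : List V
      chain  : ConsecAdj G (u ∷ body ++ [ v ])
      uniq   : Unique (u ∷ body ++ [ v ])
      within : ∀ {z} → z ∈ u ∷ body ++ [ v ] → z ∈ D × z ∉ K × label K D z ≡ label K D u
      len    : suc (length body) ≡ ∣ pos D v - pos D u ∣

  reverse-arc : ∀ {K D u v} → Arc K D u v → Arc K D v u
  reverse-arc {K} {D} {u} {v} a = record
    { body = reverse body
    ; chain = subst (ConsecAdj G) (reverse-ends u body v) (chain-reverse _ chain)
    ; uniq = subst Unique (reverse-ends u body v) (unique-reverse uniq)
    ; within = λ {z} z∈ → let z∈D , z∉K , l = within (back z∈)
                              _ , _ , lv = within (there (∈-++⁺ʳ body (here refl)))
                          in z∈D , z∉K , trans l (sym lv)
    ; len = trans (cong suc (length-reverse body)) (trans len (∣-∣-comm (pos D v) (pos D u))) }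
    where
    open Arc a
    back : ∀ {z} → z ∈ v ∷ reverse body ++ [ u ] → z ∈ u ∷ body ++ [ v ]
    back {z} z∈ = ∈-reverse⁻ (subst (z ∈_) (sym (reverse-ends u body v)) z∈)

  arc : ∀ {K D u v} → IsCycle G D → u ∈ D → v ∈ D → v ∉ K → label K D u ≡ label K D v → pos D u < pos D v → Arc K D u v
  arc {K} {D} {u} {v} cyc u∈ v∈ v∉K eq u<v = record
    { body = inner
    ; chain = proj₁ (chain-split (u ∷ inner) v post chR)
    ; uniq = uB
    ; within = ins
    ; len = sym (∣a-a+b∣ len) }
    where
    uD = cycle-unique cyc
    b = two-split uD u∈ v∈ u<v
    open Between b
    chR : ConsecAdj G (u ∷ inner ++ v ∷ post)
    chR = proj₂ (chain-split (before u D) u (inner ++ v ∷ post) (subst (ConsecAdj G) split (cycle-chain cyc)))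
    uR : Unique (u ∷ inner ++ v ∷ post)
    uR = proj₁ (proj₂ (unique-++⁻ (before u D) (subst Unique split uD)))
    uB : Unique (u ∷ inner ++ [ v ])
    uB = proj₁ (unique-++⁻ (u ∷ inner ++ [ v ]) (subst Unique (cong (u ∷_) (sym (++-assoc inner [ v ] post))) uR))
    ins : ∀ {z} → z ∈ u ∷ inner ++ [ v ] → z ∈ D × z ∉ K × label K D z ≡ label K D u
    ins (here refl) = u∈ , hits≡0 (same-label⇒free eq b) (here refl) , refl
    ins {z} (there z∈) with ∈-++⁻ inner z∈
    ... | inj₁ z∈i = subst (z ∈_) (sym split) (∈-++⁺ʳ (before u D) (there (∈-++⁺ˡ z∈i)))
                   , hits≡0 (same-label⇒free eq b) (there z∈i) , inner-label uD eq b z∈i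
    ... | inj₂ (here refl) = v∈ , v∉K , sym eq

  module Exchange {C D : List V} {k} (longC : IsLongestCycle G C) (cycD : IsCycle G D) (br : Bridges C D k) where

    open Bridges br

    x y P Q : Fin k → ℕ
    x i = pos C (c i)
    y i = pos D (d i)
    P i = label D C (c i)
    Q i = label C D (d i)

    cycC = proj₁ longC
    uC = cycle-unique cycC
    uD = cycle-unique cycD

    arc-D : ∀ {i j} → i ≢ j → Q i ≡ Q j → Arc C D (d i) (d j)
    arc-D {i} {j} i≢j eq with <-cmp (y i) (y j)
    ... | tri< l _ _ = arc cycD (d∈D i) (d∈D j) (d∉C j) eq l
    ... | tri≈ _ e _ = ⊥-elim (i≢j (d-inj (pos-injective uD (d∈D i) (d∈D j) e)))
    ... | tri> _ _ g = reverse-arc (arc cycD (d∈D j) (d∈D i) (d∉C i) (sym eq) g)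

    -- A path between the two feet on C, through bridge i, along D, and back through bridge j.
    record Detour (i j : Fin k) : Set where
      field
        path    : List V
        chain'  : ConsecAdj G (c i ∷ path ++ [ c j ])
        uniq    : Unique path
        avoids  : ∀ {z} → z ∈ path → z ∉ C
        origin  : ∀ {z} → z ∈ path → (z ∈ mid i ⊎ z ∈ mid j) ⊎ (z ∈ D × label C D z ≡ Q i)
        length≥ : suc ∣ y i - y j ∣ ≤ length path

    detour : ∀ {i j} → i ≢ j → Q i ≡ Q j → Detour i j
    detour {i} {j} i≢j eq = record
      { path = mid i ++ B ++ M
      ; chain' = subst (λ z → ConsecAdj G (c i ∷ z)) (sym (trans (++-assoc (mid i) (B ++ M) [ c j ])
                   (cong (mid i ++_) (cong (d i ∷_) (trans (cong (_++ [ c j ]) (++-assoc body [ d j ] M)) (++-assoc body (d j ∷ M) [ c j ]))))))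
                   (chain-join (c i ∷ mid i) (d i) (body ++ d j ∷ M ++ [ c j ]) (chain i)
                     (chain-join (d i ∷ body) (d j) (M ++ [ c j ]) (Arc.chain a)
                       (subst (ConsecAdj G) (reverse-ends (c j) (mid j) (d j)) (chain-reverse _ (chain j)))))
      ; uniq = unique-++⁺ (mid-uniq i) (unique-++⁺ (Arc.uniq a) (unique-reverse (mid-uniq j))
                 (λ z∈B z∈M → proj₂ (mid∉ (∈-reverse⁻ z∈M)) (proj₁ (Arc.within a z∈B)))) disj
      ; avoids = avoid
      ; origin = orig
      ; length≥ = len }
      where
      a = arc-D i≢j eq
      open Arc a using (body)
      B M : List V
      B = d i ∷ body ++ [ d j ]
      M = reverse (mid j)
      disj : ∀ {z} → z ∈ mid i → z ∉ B ++ M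
      disj z∈ z∈' with ∈-++⁻ B z∈'
      ... | inj₁ z∈B = proj₂ (mid∉ z∈) (proj₁ (Arc.within a z∈B))
      ... | inj₂ z∈M = i≢j (mid-disj z∈ (∈-reverse⁻ z∈M))
      orig : ∀ {z} → z ∈ mid i ++ B ++ M → (z ∈ mid i ⊎ z ∈ mid j) ⊎ (z ∈ D × label C D z ≡ Q i)
      orig z∈ with ∈-++⁻ (mid i) z∈
      ... | inj₁ z∈i = inj₁ (inj₁ z∈i)
      ... | inj₂ z∈' with ∈-++⁻ B z∈'
      ...   | inj₁ z∈B = inj₂ (proj₁ (Arc.within a z∈B) , proj₂ (proj₂ (Arc.within a z∈B)))
      ...   | inj₂ z∈M = inj₁ (inj₂ (∈-reverse⁻ z∈M))
      avoid : ∀ {z} → z ∈ mid i ++ B ++ M → z ∉ C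
      avoid z∈ with ∈-++⁻ (mid i) z∈
      ... | inj₁ z∈i = proj₁ (mid∉ z∈i)
      ... | inj₂ z∈' with ∈-++⁻ B z∈'
      ...   | inj₁ z∈B = proj₁ (proj₂ (Arc.within a z∈B))
      ...   | inj₂ z∈M = proj₁ (mid∉ (∈-reverse⁻ z∈M))
      len : suc ∣ y i - y j ∣ ≤ length (mid i ++ B ++ M)
      len = begin
        suc ∣ y i - y j ∣      ≡⟨ cong suc (trans (∣-∣-comm (y i) (y j)) (sym (Arc.len a))) ⟩
        suc (suc (length body)) ≡⟨ cong suc (sym (trans (length-++ body) (+-comm (length body) 1))) ⟩
        length B               ≤⟨ m≤m+n _ _ ⟩
        length B + length M    ≡⟨ sym (length-++ B) ⟩
        length (B ++ M)        ≤⟨ m≤n+m _ _ ⟩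
        length (mid i) + length (B ++ M) ≡⟨ sym (length-++ (mid i)) ⟩
        length (mid i ++ B ++ M) ∎
        where open ≤-Reasoning

    -- The detour has at least one inner vertex more than the distance on D, the replaced arc one
    -- less than the distance on C; hence the 2.
    exchange₁-ordered : ∀ {i j} → i ≢ j → Q i ≡ Q j → x i < x j → ∣ y i - y j ∣ + 2 ≤ ∣ x i - x j ∣
    exchange₁-ordered {i} {j} i≢j eq l = begin
      ∣ y i - y j ∣ + 2       ≡⟨ +-comm _ 2 ⟩
      suc (suc ∣ y i - y j ∣) ≤⟨ s≤s (≤-trans length≥ (arc-maximal (before (c i) C) (c i) inner (c j) post
                                   (subst (IsLongestCycle G) split longC) chain' (≤-trans (s≤s z≤n) length≥) uniq
                                   (λ {z} z∈ → inj₂ (λ z∈C → avoids z∈ (subst (z ∈_) (sym split) z∈C))))) ⟩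
      suc (length inner)      ≡⟨ sym (∣a-a+b∣ len) ⟩
      ∣ x j - x i ∣           ≡⟨ ∣-∣-comm (x j) (x i) ⟩
      ∣ x i - x j ∣ ∎
      where
      open ≤-Reasoning
      open Detour (detour i≢j eq)
      open Between (two-split uC (c∈C i) (c∈C j) l)

    exchange₁ : ∀ {i j} → i ≢ j → Q i ≡ Q j → ∣ y i - y j ∣ + 2 ≤ ∣ x i - x j ∣
    exchange₁ {i} {j} i≢j eq with <-cmp (x i) (x j)
    ... | tri< l _ _ = exchange₁-ordered i≢j eq l
    ... | tri≈ _ e _ = ⊥-elim (i≢j (c-inj (pos-injective uC (c∈C i) (c∈C j) e)))
    ... | tri> _ _ g = subst₂ (λ a b → a + 2 ≤ b) (∣-∣-comm (y j) (y i)) (∣-∣-comm (x j) (x i))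
                         (exchange₁-ordered (λ e → i≢j (sym e)) (sym eq) g)

    -- C = … c e ⋯ c f ⋯ c h ⋯ c g …; the detours replace the outer two arcs and the middle one is reversed.
    exchange₂ : ∀ {e f h g} → x e < x f → x f < x h → x h < x g → Q e ≡ Q h → Q f ≡ Q g → Q e ≢ Q f →
                ∣ y e - y h ∣ + ∣ y f - y g ∣ + 4 ≤ ∣ x e - x f ∣ + ∣ x h - x g ∣
    exchange₂ {e} {f} {h} {g} e<f f<h h<g Qeh Qfg Qef = bound
      where
      x≢ : ∀ {i j} → x i < x j → i ≢ j
      x≢ l refl = <-irrefl refl l
      module ef = Between (two-split uC (c∈C e) (c∈C f) e<f)
      module fh = Between (two-split uC (c∈C f) (c∈C h) f<h)
      module hg = Between (two-split uC (c∈C h) (c∈C g) h<g)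
      module eh = Detour (detour {e} {h} (x≢ (<-trans e<f f<h)) Qeh)
      module fg = Detour (detour {f} {g} (x≢ (<-trans f<h h<g)) Qfg)
      W α middle γ : List V
      W = fh.inner
      α = ef.inner ++ c f ∷ W ++ c h ∷ hg.inner
      middle = c h ∷ reverse W ++ [ c f ]
      γ = eh.path ++ middle ++ fg.path
      splitC : C ≡ before (c e) C ++ c e ∷ α ++ c g ∷ hg.post
      splitC = begin
        C ≡⟨ hg.split ⟩
        before (c h) C ++ c h ∷ hg.inner ++ c g ∷ hg.post
          ≡⟨ cong (_++ c h ∷ hg.inner ++ c g ∷ hg.post) (trans fh.before-v (cong (_++ c f ∷ W) ef.before-v)) ⟩
        ((before (c e) C ++ c e ∷ ef.inner) ++ c f ∷ W) ++ c h ∷ hg.inner ++ c g ∷ hg.post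
          ≡⟨ trans (++-assoc (before (c e) C ++ c e ∷ ef.inner) (c f ∷ W) _) (++-assoc (before (c e) C) (c e ∷ ef.inner) _) ⟩
        before (c e) C ++ c e ∷ ef.inner ++ c f ∷ W ++ c h ∷ hg.inner ++ c g ∷ hg.post
          ≡⟨ cong (λ z → before (c e) C ++ c e ∷ z) (sym (trans (++-assoc ef.inner (c f ∷ W ++ c h ∷ hg.inner) _)
               (cong (λ z → ef.inner ++ c f ∷ z) (++-assoc W (c h ∷ hg.inner) _)))) ⟩
        before (c e) C ++ c e ∷ α ++ c g ∷ hg.post ∎
        where open ≡-Reasoning
      uMiddle' : Unique (c f ∷ W ++ [ c h ])
      uMiddle' = proj₁ (unique-++⁻ (c f ∷ W ++ [ c h ]) (subst Unique (cong (c f ∷_) (sym (++-assoc W [ c h ] fh.post)))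
                   (proj₁ (proj₂ (unique-++⁻ (before (c f) C) (subst Unique fh.split uC))))))
      chMiddle' : ConsecAdj G (c f ∷ W ++ [ c h ])
      chMiddle' = proj₁ (chain-split (c f ∷ W) (c h) fh.post
                    (proj₂ (chain-split (before (c f) C) (c f) _ (subst (ConsecAdj G) fh.split (cycle-chain cycC)))))
      uMiddle : Unique middle
      uMiddle = subst Unique (reverse-ends (c f) W (c h)) (unique-reverse uMiddle')
      chMiddle : ConsecAdj G middle
      chMiddle = subst (ConsecAdj G) (reverse-ends (c f) W (c h)) (chain-reverse _ chMiddle')
      middle⊆α : ∀ {z} → z ∈ middle → z ∈ α
      middle⊆α {z} z∈ with ∈-reverse⁻ {xs = c f ∷ W ++ [ c h ]} (subst (z ∈_) (sym (reverse-ends (c f) W (c h))) z∈)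
      ... | here refl = ∈-++⁺ʳ ef.inner (here refl)
      ... | there z∈' with ∈-++⁻ W z∈'
      ...   | inj₁ z∈W = ∈-++⁺ʳ ef.inner (there (∈-++⁺ˡ z∈W))
      ...   | inj₂ (here refl) = ∈-++⁺ʳ ef.inner (there (∈-++⁺ʳ W (here refl)))
      α⊆C : ∀ {z} → z ∈ α → z ∈ C
      α⊆C {z} z∈ = subst (z ∈_) (sym splitC) (∈-++⁺ʳ (before (c e) C) (there (∈-++⁺ˡ z∈)))
      -- The parts on D lie in the different segments `Q e` and `Q f`. Any other overlap would lie
      -- on two different bridges, or inside a bridge and on D.
      detours-disjoint : ∀ {z} → z ∈ eh.path → z ∉ fg.path
      detours-disjoint z∈ z∈' with eh.origin z∈ | fg.origin z∈'
      ... | inj₁ (inj₁ a) | inj₁ (inj₁ b) = x≢ e<f (mid-disj a b)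
      ... | inj₁ (inj₁ a) | inj₁ (inj₂ b) = x≢ (<-trans e<f (<-trans f<h h<g)) (mid-disj a b)
      ... | inj₁ (inj₂ a) | inj₁ (inj₁ b) = x≢ f<h (mid-disj b a)
      ... | inj₁ (inj₂ a) | inj₁ (inj₂ b) = x≢ h<g (mid-disj a b)
      ... | inj₁ (inj₁ a) | inj₂ (b , _) = proj₂ (mid∉ a) b
      ... | inj₁ (inj₂ a) | inj₂ (b , _) = proj₂ (mid∉ a) b
      ... | inj₂ (a , _) | inj₁ (inj₁ b) = proj₂ (mid∉ b) a
      ... | inj₂ (a , _) | inj₁ (inj₂ b) = proj₂ (mid∉ b) a
      ... | inj₂ (_ , p) | inj₂ (_ , q) = Qef (trans (sym p) q)
      uγ : Unique γ
      uγ = unique-++⁺ eh.uniq (unique-++⁺ uMiddle fg.uniq (λ z∈ z∈' → fg.avoids z∈' (α⊆C (middle⊆α z∈)))) disj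
        where
        disj : ∀ {z} → z ∈ eh.path → z ∉ middle ++ fg.path
        disj z∈ z∈' with ∈-++⁻ middle z∈'
        ... | inj₁ z∈m = eh.avoids z∈ (α⊆C (middle⊆α z∈m))
        ... | inj₂ z∈p = detours-disjoint z∈ z∈p
      chγ : ConsecAdj G (c e ∷ γ ++ [ c g ])
      chγ = subst (λ z → ConsecAdj G (c e ∷ z)) (sym (trans (++-assoc eh.path (middle ++ fg.path) [ c g ])
              (cong (eh.path ++_) (cong (c h ∷_) (trans (cong (_++ [ c g ]) (++-assoc (reverse W) [ c f ] fg.path)) (++-assoc (reverse W) (c f ∷ fg.path) [ c g ]))))))
              (chain-join (c e ∷ eh.path) (c h) (reverse W ++ c f ∷ fg.path ++ [ c g ]) eh.chain'
                (chain-join (c h ∷ reverse W) (c f) (fg.path ++ [ c g ]) chMiddle fg.chain'))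
      fresh : ∀ {z} → z ∈ γ → z ∈ α ⊎ z ∉ before (c e) C ++ c e ∷ α ++ c g ∷ hg.post
      fresh {z} z∈ with ∈-++⁻ eh.path z∈
      ... | inj₁ z∈p = inj₂ (λ z∈C → eh.avoids z∈p (subst (z ∈_) (sym splitC) z∈C))
      ... | inj₂ z∈' with ∈-++⁻ middle z∈'
      ...   | inj₁ z∈m = inj₁ (middle⊆α z∈m)
      ...   | inj₂ z∈p = inj₂ (λ z∈C → fg.avoids z∈p (subst (z ∈_) (sym splitC) z∈C))
      a b w p q : ℕ
      a = ∣ y e - y h ∣
      b = ∣ y f - y g ∣
      w = length W
      p = length ef.inner
      q = length hg.inner
      lenγ : suc a + (suc (w + 1) + suc b) ≤ length γ
      lenγ = subst (suc a + (suc (w + 1) + suc b) ≤_)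
        (sym (trans (length-++ eh.path) (cong (length eh.path +_) (trans (length-++ middle)
          (cong (_+ length fg.path) (cong suc (trans (length-++ (reverse W)) (cong (_+ 1) (length-reverse W)))))))))
        (+-mono-≤ eh.length≥ (+-monoʳ-≤ (suc (w + 1)) fg.length≥))
      lenα : length α ≡ p + suc (w + suc q)
      lenα = trans (length-++ ef.inner) (cong (λ z → p + suc z) (length-++ W))
      bound : a + b + 4 ≤ ∣ x e - x f ∣ + ∣ x h - x g ∣
      bound = subst (a + b + 4 ≤_) (cong₂ _+_
          (trans (sym (∣a-a+b∣ ef.len)) (∣-∣-comm (x f) (x e))) (trans (sym (∣a-a+b∣ hg.len)) (∣-∣-comm (x g) (x h))))
        -- The middle arc with its `w` inner vertices occurs in `γ` and in `α` and cancels.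
        (+-cancelˡ-≤ w _ _ (begin
          w + (a + b + 4) ≡⟨ solve 3 (λ w a b → w :+ (a :+ b :+ con 4) := (con 1 :+ a) :+ ((con 1 :+ (w :+ con 1)) :+ (con 1 :+ b))) refl w a b ⟩
          suc a + (suc (w + 1) + suc b) ≤⟨ lenγ ⟩
          length γ ≤⟨ arc-maximal (before (c e) C) (c e) α (c g) hg.post (subst (IsLongestCycle G) splitC longC) chγ
                        (≤-trans (s≤s z≤n) lenγ) uγ fresh ⟩
          length α ≡⟨ lenα ⟩
          p + suc (w + suc q) ≡⟨ solve 3 (λ p w q → p :+ (con 1 :+ (w :+ (con 1 :+ q))) := w :+ ((con 1 :+ p) :+ (con 1 :+ q))) refl p w q ⟩
          w + (suc p + suc q) ∎))
        where open ≤-Reasoning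

    -- Two distinct segments of C lie one wholly before the other, which gives the order required by
    -- `exchange₂`, possibly after exchanging `e`, `f` with `h`, `g`.
    aligned-exchange : ∀ {e h f g} → P e ≡ P f → P h ≡ P g → P e ≢ P h → Q e ≡ Q h → Q f ≡ Q g → Q e ≢ Q f →
      x e < x f → x h < x g → ∣ y e - y h ∣ + ∣ y f - y g ∣ + 4 ≤ ∣ x e - x f ∣ + ∣ x h - x g ∣
    aligned-exchange {e} {h} {f} {g} Pef Phg Peh Qeh Qfg Qef e<f h<g with <-cmp (P e) (P h)
    ... | tri< l _ _  = exchange₂ e<f (label-mono uC (c∈C f) (c∈C h) (subst (_< P h) Pef l)) h<g Qeh Qfg Qef
    ... | tri≈ _ eq _ = ⊥-elim (Peh eq)
    ... | tri> _ _ l  = subst₂ (λ a b → a + 4 ≤ b)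
          (cong₂ _+_ (∣-∣-comm (y h) (y e)) (∣-∣-comm (y g) (y f))) (+-comm ∣ x h - x g ∣ ∣ x e - x f ∣)
          (exchange₂ h<g (label-mono uC (c∈C g) (c∈C e) (subst (_< P e) Phg l)) e<f (sym Qeh) (sym Qfg)
            (λ eq → Qef (trans Qeh (trans eq (sym Qfg)))))

  module TwoLongest {C D : List V} {k} (longC : IsLongestCycle G C) (longD : IsLongestCycle G D) (br : Bridges C D k) where

    module C→D = Exchange longC (proj₁ longD) br
    module D→C = Exchange longD (proj₁ longC) (flip-bridges br)
    open C→D using (x; y; P; Q)

    too-long : ∀ {a b m} → a + suc m ≤ b → b + suc m ≤ a → ⊥
    too-long {a} {b} p q = <-asym (<-≤-trans (m<m+n a (s≤s z≤n)) p) (<-≤-trans (m<m+n b (s≤s z≤n)) q)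

    -- As both cycles are longest, `exchange₁` applies in both directions, and each of the two
    -- distances would exceed the other.
    bridges-simple : ∀ {i j} → P i ≡ P j → Q i ≡ Q j → i ≡ j
    bridges-simple {i} {j} Pij Qij with i Fin.≟ j
    ... | yes i≡j = i≡j
    ... | no i≢j  = ⊥-elim (too-long {m = 1} (C→D.exchange₁ i≢j Qij) (D→C.exchange₁ i≢j Pij))

    bridges-not-aligned : ∀ {e h f g} → P e ≡ P f → P h ≡ P g → Q e ≡ Q h → Q f ≡ Q g →
      x e < x f → x h < x g → y e < y h → y f < y g → ⊥
    bridges-not-aligned {e} {h} {f} {g} Pef Phg Qeh Qfg e<f h<g e<h f<g =
      too-long {m = 3} (C→D.aligned-exchange Pef Phg Peh Qeh Qfg Qef e<f h<g)
                       -- Seen from D, the 4-cycle is the same with `f` and `h` exchanged.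
                       (D→C.aligned-exchange Qeh Qfg Qef Pef Phg Peh e<h f<g)
      where
      Peh : P e ≢ P h
      Peh eq with refl ← bridges-simple eq Qeh = <-irrefl refl e<h
      Qef : Q e ≢ Q f
      Qef eq with refl ← bridges-simple Pef eq = <-irrefl refl e<f

-- Paths between the two cycles

-- Double negation passes through finite conjunctions; this provides a decision of adjacency for all
-- pairs of vertices at once.
¬¬-∀Fin : ∀ {m} {P : Fin m → Set} → (∀ i → ¬ ¬ P i) → ¬ ¬ (∀ i → P i)
¬¬-∀Fin {zero}  p ret = ret λ ()
¬¬-∀Fin {suc m} p ret = p Fin.zero λ p₀ → ¬¬-∀Fin (λ i → p (Fin.suc i)) λ pₛ → ret λ { Fin.zero → p₀ ; (Fin.suc i) → pₛ i }

unique-⊆-length : ∀ {A : Set} {xs ys : List A} → Unique xs → (∀ {z} → z ∈ xs → z ∈ ys) → length xs ≤ length ys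
unique-⊆-length {xs = xs} {ys} u sub = Fin.injective⇒≤ {f = λ i → index (sub (∈-lookup i))} λ {i} {j} eq →
  lookup-injective u (trans (lookup-index (sub (∈-lookup i))) (trans (cong (lookup ys) eq) (sym (lookup-index (sub (∈-lookup j))))))

module _ {m : ℕ} where

  open import Data.List.Membership.DecPropositional (Fin._≟_ {m}) using (_∈?_)

  escape : ∀ {xs ys : List (Fin m)} → Unique xs → length ys < length xs → ∃ λ z → z ∈ xs × z ∉ ys
  escape {xs} {ys} u short with All.all? (_∈? ys) xs
  ... | yes all = ⊥-elim (<⇒≱ short (unique-⊆-length u (All.lookup all)))
  ... | no ¬all with z , z∈ , z∉ ← find (All.¬All⇒Any¬ (_∈? ys) xs ¬all) = z , z∈ , z∉

  length-filter-split : ∀ (K xs : List (Fin m)) →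
    length (filter (_∈? K) xs) + length (filter (λ z → ¬? (z ∈? K)) xs) ≡ length xs
  length-filter-split K [] = refl
  length-filter-split K (x ∷ xs) with x ∈? K
  ... | yes _ = cong suc (length-filter-split K xs)
  ... | no _  = trans (+-suc _ _) (cong suc (length-filter-split K xs))

-- Vertex lists as subsets

insert : ∀ {m} → Fin m → Subset m → Subset m
insert Fin.zero    (_ ∷ s) = inside ∷ s
insert (Fin.suc x) (b ∷ s) = b ∷ insert x s

insert-∣∣ : ∀ {m} (x : Fin m) s → ∣ insert x s ∣ ≤ suc ∣ s ∣
insert-∣∣ Fin.zero    (inside  ∷ s) = n≤1+n _
insert-∣∣ Fin.zero    (outside ∷ s) = ≤-refl
insert-∣∣ (Fin.suc x) (inside  ∷ s) = s≤s (insert-∣∣ x s)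
insert-∣∣ (Fin.suc x) (outside ∷ s) = insert-∣∣ x s

∈-insert⁻ : ∀ {m} {x z : Fin m} {s} → z Subset.∈ insert x s → z ≡ x ⊎ z Subset.∈ s
∈-insert⁻ {x = Fin.zero}  {s = _ ∷ s} Vec.here = inj₁ refl
∈-insert⁻ {x = Fin.zero}  {s = _ ∷ s} (Vec.there z∈) = inj₂ (Vec.there z∈)
∈-insert⁻ {x = Fin.suc x} {s = _ ∷ s} Vec.here = inj₂ Vec.here
∈-insert⁻ {x = Fin.suc x} {s = _ ∷ s} (Vec.there z∈) with ∈-insert⁻ {x = x} z∈
... | inj₁ refl = inj₁ refl
... | inj₂ z∈s  = inj₂ (Vec.there z∈s)

∈-insert-self : ∀ {m} (x : Fin m) s → x Subset.∈ insert x s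
∈-insert-self Fin.zero    (_ ∷ s) = Vec.here
∈-insert-self (Fin.suc x) (_ ∷ s) = Vec.there (∈-insert-self x s)

∈-insert⁺ : ∀ {m} {x z : Fin m} {s} → z Subset.∈ s → z Subset.∈ insert x s
∈-insert⁺ {x = Fin.zero}  {s = _ ∷ s} Vec.here       = Vec.here
∈-insert⁺ {x = Fin.zero}  {s = _ ∷ s} (Vec.there z∈) = Vec.there z∈
∈-insert⁺ {x = Fin.suc x} {s = _ ∷ s} Vec.here       = Vec.here
∈-insert⁺ {x = Fin.suc x} {s = _ ∷ s} (Vec.there z∈) = Vec.there (∈-insert⁺ z∈)

fromList : ∀ {m} → List (Fin m) → Subset m
fromList []       = Subset.⊥
fromList (x ∷ xs) = insert x (fromList xs)

fromList-∣∣ : ∀ {m} (xs : List (Fin m)) → ∣ fromList xs ∣ ≤ length xs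
fromList-∣∣ {m} [] = ≤-reflexive (Subset.∣⊥∣≡0 m)
fromList-∣∣ (x ∷ xs) = ≤-trans (insert-∣∣ x (fromList xs)) (s≤s (fromList-∣∣ xs))

∈-fromList⁺ : ∀ {m} {z : Fin m} {xs} → z ∈ xs → z Subset.∈ fromList xs
∈-fromList⁺ {xs = x ∷ xs} (here refl) = ∈-insert-self x (fromList xs)
∈-fromList⁺ (there z∈)                = ∈-insert⁺ (∈-fromList⁺ z∈)

∈-fromList⁻ : ∀ {m} {z : Fin m} {xs} → z Subset.∈ fromList xs → z ∈ xs
∈-fromList⁻ {xs = []} z∈ = ⊥-elim (Subset.∉⊥ z∈)
∈-fromList⁻ {xs = x ∷ xs} z∈ with ∈-insert⁻ {x = x} z∈
... | inj₁ eq  = here eq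
... | inj₂ z∈' = there (∈-fromList⁻ z∈')

data EndsAt {A : Set} (v : A) : List A → Set where
  end  : EndsAt v [ v ]
  skip : ∀ {x xs} → EndsAt v xs → EndsAt v (x ∷ xs)

module _ {A : Set} where

  ends-suffix : ∀ {v u : A} pre {post} → EndsAt v (pre ++ u ∷ post) → EndsAt v (u ∷ post)
  ends-suffix []       e        = e
  ends-suffix (x ∷ []) (skip e) = e
  ends-suffix (x ∷ y ∷ pre) (skip e) = ends-suffix (y ∷ pre) e

-- From walks to bridges

module GraphWalks (G : Graph) where

  private
    V = Fin (n G)

  open Cycles G
  open ListPositions {V} Fin._≟_
  open import Data.List.Membership.DecPropositional (Fin._≟_ {n G}) using (_∈?_)

  chain-snoc : ∀ {l v w} → EndsAt v l → ConsecAdj G l → Adj G v w → ConsecAdj G (l ++ [ w ])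
  chain-snoc end                      _        a = a , tt
  chain-snoc (skip {x} {y ∷ xs} e) (b , ch) a = b , chain-snoc e ch a

  record SimplePath (u v : V) (vs : List V) : Set where
    field
      rest  : List V
      chain : ConsecAdj G (u ∷ rest)
      uniq  : Unique (u ∷ rest)
      ends  : EndsAt v (u ∷ rest)
      ⊆vs   : ∀ {z} → z ∈ u ∷ rest → z ∈ vs

  loop-erase : ∀ {R : V → V → Set} → (∀ {u w} → R u w → Adj G u w) → ∀ {u v} (p : Star R u v) → SimplePath u v (vertices p)
  loop-erase adj ε = record { rest = [] ; chain = tt ; uniq = [] ∷ [] ; ends = end ; ⊆vs = λ z∈ → z∈ }
  loop-erase adj {u} (_◅_ {j = w} r p) with loop-erase adj p
  ... | sp with u ∈? (w ∷ SimplePath.rest sp)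
  ...   | no u∉ = record
          { rest = w ∷ rest ; chain = adj r , chain ; uniq = All.¬Any⇒All¬ _ u∉ ∷ uniq ; ends = skip ends
          ; ⊆vs = λ { (here eq) → here eq ; (there z∈) → there (⊆vs z∈) } }
          where open SimplePath sp
  ...   | yes u∈ with post , eq ← split-at u∈ = record
          { rest = post
          ; chain = proj₂ (chain-split (before u (w ∷ rest)) u post (subst (ConsecAdj G) eq chain))
          ; uniq = proj₁ (proj₂ (unique-++⁻ (before u (w ∷ rest)) (subst Unique eq uniq)))
          ; ends = ends-suffix (before u (w ∷ rest)) (subst (EndsAt _) eq ends)
          ; ⊆vs = λ {z} z∈ → there (⊆vs (subst (z ∈_) (sym eq) (∈-++⁺ʳ (before u (w ∷ rest)) z∈))) }
          where open SimplePath sp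

  module _ (C D : List V) where

    record Crossover (l : List V) : Set where
      field
        pre mid post : List V
        c d   : V
        split : l ≡ pre ++ c ∷ mid ++ d ∷ post
        c∈C   : c ∈ C
        c∉D   : c ∉ D
        d∈D   : d ∈ D
        d∉C   : d ∉ C
        mid∉  : ∀ {z} → z ∈ mid → z ∉ C × z ∉ D

    record Clean (l : List V) : Set where
      field
        pre post : List V
        d     : V
        split : l ≡ pre ++ d ∷ post
        d∈D   : d ∈ D
        d∉C   : d ∉ C
        pre∉  : ∀ {z} → z ∈ pre → z ∉ C × z ∉ D

    -- The path is scanned from its far end. `Clean` records that the scanned part reaches D before
    -- C; the next vertex of C found then completes a crossover.
    crossover-or-clean : ∀ {v l} → v ∈ D → EndsAt v l → (∀ {z} → z ∈ l → z ∈ C → z ∉ D) → Crossover l ⊎ Clean l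
    crossover-or-clean {v} v∈D end avoid = inj₂ (record
      { pre = [] ; post = [] ; d = v ; split = refl ; d∈D = v∈D ; d∉C = λ v∈C → avoid (here refl) v∈C v∈D ; pre∉ = λ () })
    crossover-or-clean {v} {u ∷ l} v∈D (skip e) avoid with crossover-or-clean v∈D e (λ z∈ → avoid (there z∈))
    ... | inj₁ x = inj₁ (record { Crossover x ; pre = u ∷ Crossover.pre x ; split = cong (u ∷_) (Crossover.split x) })
    ... | inj₂ cl with u ∈? C | u ∈? D
    ...   | yes u∈C | _ = inj₁ (record
            { pre = [] ; mid = Clean.pre cl ; post = Clean.post cl ; c = u ; d = Clean.d cl ; split = cong (u ∷_) (Clean.split cl)
            ; c∈C = u∈C ; c∉D = avoid (here refl) u∈C ; d∈D = Clean.d∈D cl ; d∉C = Clean.d∉C cl ; mid∉ = Clean.pre∉ cl })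
    ...   | no u∉C | yes u∈D = inj₂ (record
            { pre = [] ; post = l ; d = u ; split = refl ; d∈D = u∈D ; d∉C = u∉C ; pre∉ = λ () })
    ...   | no u∉C | no u∉D = inj₂ (record
            { Clean cl ; pre = u ∷ Clean.pre cl ; split = cong (u ∷_) (Clean.split cl)
            ; pre∉ = λ { (here refl) → u∉C , u∉D ; (there z∈) → Clean.pre∉ cl z∈ } })

    crossover : ∀ {u v rest} → u ∈ C → v ∈ D → EndsAt v (u ∷ rest) → (∀ {z} → z ∈ u ∷ rest → z ∈ C → z ∉ D) → Crossover (u ∷ rest)
    crossover u∈C v∈D e avoid with crossover-or-clean v∈D e avoid
    ... | inj₁ x = x
    ... | inj₂ record { pre = [] ; split = refl ; d∉C = d∉C } = ⊥-elim (d∉C u∈C)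
    ... | inj₂ record { pre = _ ∷ _ ; split = refl ; pre∉ = pre∉ } = ⊥-elim (proj₁ (pre∉ (here refl)) u∈C)

    linkage⇒bridges : ∀ {R : V → V → Set} {A B k} → (∀ {u w} → R u w → Adj G u w) → (∀ {z} → z ∈ A → z ∈ C) → (∀ {z} → z ∈ B → z ∈ D) →
      (l : Linkage R A B k) → (∀ i {z} → z ∈ vertices (Linkage.walk l i) → z ∈ C → z ∉ D) → Bridges C D k
    linkage⇒bridges {R} {A} {B} {k} adj A⊆C B⊆D l avoid = record
      { c = λ i → X.c (x i) ; d = λ i → X.d (x i) ; mid = λ i → X.mid (x i)
      ; c∈C = λ i → X.c∈C (x i) ; c∉D = λ i → X.c∉D (x i) ; d∈D = λ i → X.d∈D (x i) ; d∉C = λ i → X.d∉C (x i)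
      ; c-inj = λ {i} {j} eq → disjoint (on i (here refl)) (subst (_∈ vertices (walk j)) (sym eq) (on j (here refl)))
      ; d-inj = λ {i} {j} eq → disjoint (on i (there (∈-++⁺ʳ (X.mid (x i)) (here refl))))
                                 (subst (_∈ vertices (walk j)) (sym eq) (on j (there (∈-++⁺ʳ (X.mid (x j)) (here refl)))))
      ; chain = λ i → proj₁ (chain-split (X.c (x i) ∷ X.mid (x i)) (X.d (x i)) (X.post (x i)) (proj₂
                  (chain-split (X.pre (x i)) (X.c (x i)) _ (subst (ConsecAdj G) (X.split (x i)) (SimplePath.chain (s i))))))
      ; mid-uniq = λ i → proj₁ (unique-++⁻ (X.mid (x i)) (proj₁ (proj₂ (unique-++⁻ [ X.c (x i) ] (proj₁ (proj₂ (unique-++⁻ (X.pre (x i))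
                  (subst Unique (X.split (x i)) (SimplePath.uniq (s i))))))))))
      ; mid∉ = λ {i} → X.mid∉ (x i)
      ; mid-disj = λ {i} {j} z∈ z∈' → disjoint (on i (there (∈-++⁺ˡ z∈))) (on j (there (∈-++⁺ˡ z∈'))) }
      where
      open Linkage l
      module X = Crossover
      s : ∀ i → SimplePath (src i) (dst i) (vertices (walk i))
      s i = loop-erase adj (walk i)
      x : ∀ i → Crossover (src i ∷ SimplePath.rest (s i))
      x i = crossover (A⊆C (src∈ i)) (B⊆D (dst∈ i)) (SimplePath.ends (s i)) (λ z∈ → avoid i (SimplePath.⊆vs (s i) z∈))
      on : ∀ i {z} → z ∈ X.c (x i) ∷ X.mid (x i) ++ X.d (x i) ∷ X.post (x i) → z ∈ vertices (walk i)
      on i {z} z∈ = SimplePath.⊆vs (s i) (subst (z ∈_) (sym (X.split (x i))) (∈-++⁺ʳ (X.pre (x i)) z∈))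

  Outside : List V → V → V → Set
  Outside C u w = Adj G u w × u ∉ C × w ∉ C

  outside-vertices : ∀ {C u v} → u ∉ C → (p : Star (Outside C) u v) → ∀ {z} → z ∈ vertices p → z ∉ C
  outside-vertices u∉ ε (here refl) = u∉
  outside-vertices u∉ (r ◅ p) (here refl) = u∉
  outside-vertices u∉ ((_ , _ , w∉) ◅ p) (there z∈) = outside-vertices w∉ p z∈

  start-∉ : ∀ {S u v} → WalkAvoiding G S u v → u Subset.∉ S
  start-∉ (here u∉)     = u∉
  start-∉ (step u∉ _ _) = u∉

  -- If S contains all of C except t, then a walk avoiding S first meets C at t.
  approach : ∀ {C S u t} → (∀ {z} → z ∈ C → z ≡ t ⊎ z Subset.∈ S) → t ∈ C → u ∉ C → WalkAvoiding G S u t →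
             ∃ λ w → Star (Outside C) u w × Adj G w t
  approach only t∈ u∉ (here _) = ⊥-elim (u∉ t∈)
  approach {C} {u = u} only t∈ u∉ (step {w = w} _ a walk) with w ∈? C
  ... | no w∉ with w' , p , a' ← approach only t∈ w∉ walk = w' , (a , u∉ , w∉) ◅ p , a'
  ... | yes w∈ with only w∈
  ...   | inj₁ refl = u , ε , a
  ...   | inj₂ w∈S  = ⊥-elim (start-∉ walk w∈S)

  -- Otherwise C has at most `r` vertices and misses some `v`, because `r` < `n`. Deleting all of C
  -- but one vertex removes fewer than `r` vertices, so `v` reaches `c₁` and its neighbour `c₂`
  -- through vertices outside C. The resulting path between them has an inner vertex and lengthens
  -- C.
  connectivity<cycle : ∀ {r C} → Connectedness G r → IsLongestCycle G C → r < length C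
  connectivity<cycle {C = []} _ (() , _)
  connectivity<cycle {C = _ ∷ []} _ ((s≤s () , _) , _)
  connectivity<cycle {r} {C₀@(c₁ ∷ c₂ ∷ rest)} (r<n , connected) longest with r <? length C₀
  ... | yes r<C = r<C
  ... | no r≮C = ⊥-elim (<⇒≱ (s≤s z≤n) (arc-maximal [] c₁ [] c₂ rest longest chγ (s≤s z≤n) (SimplePath.uniq γ)
                   (λ z∈ → inj₂ (outside-vertices w₁∉ path (SimplePath.⊆vs γ z∈)))))
    where
    C≤r : length C₀ ≤ r
    C≤r = ≮⇒≥ r≮C
    uC : Unique C₀
    uC = cycle-unique (proj₁ longest)
    v×v∉ : ∃ λ v → v ∈ allFin (n G) × v ∉ C₀
    v×v∉ = escape (allFin⁺ (n G)) (subst (length C₀ <_) (sym (length-tabulate {n = n G} (λ i → i))) (≤-<-trans C≤r r<n))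
    v = proj₁ v×v∉
    v∉ = proj₂ (proj₂ v×v∉)
    S₁ S₂ : Subset (n G)
    S₁ = fromList (c₂ ∷ rest)
    S₂ = fromList (c₁ ∷ rest)
    c₁∉S₁ : c₁ Subset.∉ S₁
    c₁∉S₁ c₁∈ = proj₂ (proj₂ (unique-++⁻ [ c₁ ] uC)) (here refl) (∈-fromList⁻ c₁∈)
    c₂∉S₂ : c₂ Subset.∉ S₂
    c₂∉S₂ c₂∈ with ∈-fromList⁻ {xs = c₁ ∷ rest} c₂∈
    ... | here refl = proj₂ (proj₂ (unique-++⁻ [ c₁ ] uC)) (here refl) (here refl)
    ... | there c₂∈rest = proj₂ (proj₂ (unique-++⁻ [ c₂ ] (proj₁ (proj₂ (unique-++⁻ [ c₁ ] uC))))) (here refl) c₂∈rest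
    v∉S₁ : v Subset.∉ S₁
    v∉S₁ v∈ = v∉ (there (∈-fromList⁻ v∈))
    v∉S₂ : v Subset.∉ S₂
    v∉S₂ v∈ with ∈-fromList⁻ {xs = c₁ ∷ rest} v∈
    ... | here eq   = v∉ (here eq)
    ... | there v∈' = v∉ (there (there v∈'))
    to₁ : ∃ λ w → Star (Outside C₀) v w × Adj G w c₁
    to₁ = approach (λ { (here eq) → inj₁ eq ; (there z∈) → inj₂ (∈-fromList⁺ z∈) }) (here refl) v∉
            (connected S₁ (≤-<-trans (fromList-∣∣ (c₂ ∷ rest)) C≤r) v c₁ v∉S₁ c₁∉S₁)
    to₂ : ∃ λ w → Star (Outside C₀) v w × Adj G w c₂
    to₂ = approach (λ { (here refl) → inj₂ (∈-fromList⁺ {xs = c₁ ∷ rest} (here refl)) ; (there (here eq)) → inj₁ eq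
                      ; (there (there z∈)) → inj₂ (∈-fromList⁺ {xs = c₁ ∷ rest} (there z∈)) }) (there (here refl)) v∉
            (connected S₂ (≤-<-trans (fromList-∣∣ (c₁ ∷ rest)) C≤r) v c₂ v∉S₂ c₂∉S₂)
    back : ∃ λ (p : Star (Outside C₀) (proj₁ to₁) v) → ∀ {z} → z ∈ vertices p → z ∈ vertices (proj₁ (proj₂ to₁))
    back = reverseWalk (λ { (a , u∉ , w∉) → Graph.sym G a , w∉ , u∉ }) (proj₁ (proj₂ to₁))
    w₁∉ : proj₁ to₁ ∉ C₀
    w₁∉ = outside-vertices v∉ (proj₁ (proj₂ to₁)) (target-∈ (proj₁ (proj₂ to₁)))
    path : Star (Outside C₀) (proj₁ to₁) (proj₁ to₂)
    path = proj₁ back ◅◅ proj₁ (proj₂ to₂)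
    γ : SimplePath (proj₁ to₁) (proj₁ to₂) (vertices path)
    γ = loop-erase proj₁ path
    chγ : ConsecAdj G (c₁ ∷ (proj₁ to₁ ∷ SimplePath.rest γ) ++ [ c₂ ])
    chγ = Graph.sym G (proj₂ (proj₂ to₁)) , chain-snoc (SimplePath.ends γ) (SimplePath.chain γ) (proj₂ (proj₂ to₂))

-- Ranking the edges along C and prefixing the rank by the segment number turns the segments into the
-- top level of a binary hierarchy of intervals.
module SegmentBound {k M L : ℕ} .{{_ : NonZero L}} (k≤2^L : k ≤ 2 ^ L) (x y P Q : Fin k → ℕ)
  (x-inj : ∀ {e f} → x e ≡ x f → e ≡ f)
  (y-inj : ∀ {e f} → y e ≡ y f → e ≡ f)
  (P<M : ∀ e → P e < M) (Q<M : ∀ e → Q e < M)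
  (simple : ∀ {e f} → P e ≡ P f → Q e ≡ Q f → e ≡ f)
  (no-aligned : ∀ {e h f g} → P e ≡ P f → P h ≡ P g → Q e ≡ Q h → Q f ≡ Q g →
                x e < x f → x h < x g → y e < y h → y f < y g → ⊥)
  where

  private
    xs = allFin k

    rank : Fin k → ℕ
    rank e = ∑[ f ← xs ] lt (x f) (x e)

    lt-monoʳ : ∀ {a b} c → a ≤ b → lt c a ≤ lt c b
    lt-monoʳ {a} {b} c a≤b with lt-cases c a
    ... | inj₁ z rewrite z = z≤n
    ... | inj₂ (c<a , o) rewrite o | lt-yes (<-≤-trans c<a a≤b) = ≤-refl

    rank-< : ∀ {e f} → x e < x f → rank e < rank f
    rank-< {e} {f} e<f = ∑-strict (∈-allFin e) (λ z → lt-monoʳ (x z) (<⇒≤ e<f))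
      (subst₂ _<_ (sym (lt-no {x e} {x e} ≤-refl)) (sym (lt-yes e<f)) (s≤s z≤n))

    rank<2^L : ∀ e → rank e < 2 ^ L
    rank<2^L e = <-≤-trans (subst (rank e <_) (trans (∑-ones xs) (length-tabulate {n = k} (λ i → i)))
      (∑-strict (∈-allFin e) lt≤1 (subst (_< 1) (sym (lt-no {x e} {x e} ≤-refl)) (s≤s z≤n)))) k≤2^L
      where
      lt≤1 : ∀ z → lt (x z) (x e) ≤ 1
      lt≤1 z with lt-cases (x z) (x e)
      ... | inj₁ o rewrite o = z≤n
      ... | inj₂ (_ , o) rewrite o = ≤-refl

    X : Fin k → ℕ
    X e = P e * 2 ^ L + rank e

    P≡halve : ∀ e → P e ≡ halve L (X e)
    P≡halve e = sym (halve-digits L (P e) (rank e) (rank<2^L e))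

    X<⇒x< : ∀ {e f} → P e ≡ P f → X e < X f → x e < x f
    X<⇒x< {e} {f} Pef lt with <-cmp (x e) (x f)
    ... | tri< l _ _ = l
    ... | tri≈ _ eq _ with refl ← x-inj eq = ⊥-elim (<-irrefl refl lt)
    ... | tri> _ _ g rewrite Pef = ⊥-elim (<-asym (rank-< g) (+-cancelˡ-< (P f * 2 ^ L) _ _ lt))

    X-inj : ∀ {e f} → X e ≡ X f → e ≡ f
    X-inj {e} {f} eq = x-inj (x≡ (<-cmp (x e) (x f)))
      where
      Pef : P e ≡ P f
      Pef = trans (P≡halve e) (trans (cong (halve L) eq) (sym (P≡halve f)))
      rank≡ : rank e ≡ rank f
      rank≡ = +-cancelˡ-≡ (P e * 2 ^ L) _ _ (trans eq (cong (λ z → z * 2 ^ L + rank f) (sym Pef)))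
      x≡ : Tri (x e < x f) (x e ≡ x f) (x f < x e) → x e ≡ x f
      x≡ (tri< l _ _) = ⊥-elim (<-irrefl rank≡ (rank-< l))
      x≡ (tri≈ _ e _) = e
      x≡ (tri> _ _ g) = ⊥-elim (<-irrefl (sym rank≡) (rank-< g))

    open Alternating xs X y P Q X-inj y-inj (∑-δ-injective X X-inj (allFin⁺ k)) Q<M simple
      (λ Pef Phg Qeh Qfg e<f h<g → no-aligned Pef Phg Qeh Qfg (X<⇒x< Pef e<f) (X<⇒x< Phg h<g))
      using (level; edge-bound)

    level≡halve : ∀ s e → level s e ≡ halve s (X e)
    level≡halve zero    e = refl
    level≡halve (suc s) e = cong ⌊_/2⌋ (level≡halve s e)

  segment-bound : k * k ≤ edge-constant * (M * M * M * (L * L))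
  segment-bound = subst (λ z → z * z ≤ _) (length-tabulate {n = k} (λ i → i))
    (edge-bound L P<M ≤-refl (λ e → trans (P≡halve e) (sym (level≡halve L e))))

-- Existence and number of the bridges

module Intersection (G : Graph) {r} (connected : Connectedness G r) (C D : List (Fin (n G)))
  (longC : IsLongestCycle G C) (longD : IsLongestCycle G D) where

  private
    V = Fin (n G)

  open Cycles G
  open GraphWalks G
  open ListPositions {V} Fin._≟_
  open import Data.List.Membership.DecPropositional (Fin._≟_ {n G}) using (_∈?_)

  common : List V
  common = filter (_∈? D) C

  m : ℕ
  m = commonVertices C D

  common-∈ : ∀ {z} → z ∈ C → z ∈ D → z ∈ common
  common-∈ = ∈-filter⁺ (_∈? D)

  hits-C≤m : hits C D ≤ m
  hits-C≤m = unique-⊆-length (filter⁺ (_∈? C) (cycle-unique (proj₁ longD)))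
    λ z∈ → let z∈D , z∈C = ∈-filter⁻ (_∈? C) {xs = D} z∈ in common-∈ z∈C z∈D

  C∖D D∖C : List V
  C∖D = filter (λ z → ¬? (z ∈? D)) C
  D∖C = filter (λ z → ¬? (z ∈? C)) D

  difference-large : ∀ {K X : List V} → hits K X ≤ m → r < length X → r ∸ m < suc (length (filter (λ z → ¬? (z ∈? K)) X))
  difference-large {K} {X} small r<X = s≤s (≤-trans (∸-monoˡ-≤ m (<⇒≤ r<X)) (≤-trans (∸-monoʳ-≤ (length X) small)
    (≤-reflexive (trans (cong (_∸ hits K X) (sym (length-filter-split K X))) (m+n∸m≡n (hits K X) _)))))

  module _ (adj? : ∀ u w → Dec (Adj G u w)) where

    Shared : V → Set
    Shared z = z ∈ C × z ∈ D

    -- The edges left after deleting the shared vertices; the deletion lowers the number of disjoint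
    -- paths from `r` to `r ∸ m`.
    Link : V × V → Set
    Link (u , w) = Adj G u w × ¬ Shared u × ¬ Shared w

    link? : ∀ e → Dec (Link e)
    link? (u , w) = adj? u w ×-dec ¬? (u ∈? C ×-dec u ∈? D) ×-dec ¬? (w ∈? C ×-dec w ∈? D)

    E : List (V × V)
    E = filter link? (cartesianProduct (allFin (n G)) (allFin (n G)))

    E⁺ : ∀ {u w} → Link (u , w) → Edge E u w
    E⁺ {u} {w} l = ∈-filter⁺ link? (∈-cartesianProduct⁺ (∈-allFin u) (∈-allFin w)) l

    E⁻ : ∀ {u w} → Edge E u w → Link (u , w)
    E⁻ e = proj₂ (∈-filter⁻ link? {xs = cartesianProduct (allFin (n G)) (allFin (n G))} e)

    walk-in-E : ∀ {S : Subset (n G)} → (∀ {z} → z ∈ common → z Subset.∈ S) → ∀ {u v} → WalkAvoiding G S u v →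
                ∃ λ (p : Star (Edge E) u v) → ∀ {z} → z ∈ vertices p → z Subset.∉ S
    walk-in-E sub (here u∉) = ε , λ { (here refl) → u∉ }
    walk-in-E sub (step u∉ a walk) with p , p∉ ← walk-in-E sub walk =
      E⁺ (a , (λ { (u∈C , u∈D) → u∉ (sub (common-∈ u∈C u∈D)) }) , (λ { (w∈C , w∈D) → start-∉ walk (sub (common-∈ w∈C w∈D)) })) ◅ p ,
      λ { (here refl) → u∉ ; (there z∈) → p∉ z∈ }

    -- A smaller `U` would form, with the shared vertices, a set of fewer than `r` vertices, and
    -- neither C∖D nor D∖C would fit into `U`. Connectedness then joins the two differences outside
    -- that set.
    separators-large : ∀ U → Separates (Edge E) C∖D D∖C U → r ∸ m ≤ length U
    separators-large U sep with r ∸ m ≤? length U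
    ... | yes le = le
    ... | no nle = ⊥-elim (meets (sep a∈ b∈ (proj₁ w)))
      where
      U<r-m : length U < r ∸ m
      U<r-m = ≰⇒> nle
      S : Subset (n G)
      S = fromList (common ++ U)
      m<r : m < r
      m<r = ≰⇒> λ r≤m → <⇒≱ U<r-m (≤-trans (≤-reflexive (m≤n⇒m∸n≡0 r≤m)) z≤n)
      S<r : ∣ S ∣ < r
      S<r = ≤-<-trans (fromList-∣∣ (common ++ U)) (subst₂ _<_ (sym (length-++ common)) (m+[n∸m]≡n (<⇒≤ m<r)) (+-monoʳ-< m U<r-m))
      A-escape : ∃ λ a → a ∈ C∖D × a ∉ U
      A-escape = escape (filter⁺ (λ z → ¬? (z ∈? D)) (cycle-unique (proj₁ longC)))
        (<-≤-trans U<r-m (s≤s⁻¹ (difference-large {D} {C} ≤-refl (connectivity<cycle connected longC))))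
      B-escape : ∃ λ b → b ∈ D∖C × b ∉ U
      B-escape = escape (filter⁺ (λ z → ¬? (z ∈? C)) (cycle-unique (proj₁ longD)))
        (<-≤-trans U<r-m (s≤s⁻¹ (difference-large {C} {D} hits-C≤m (connectivity<cycle connected longD))))
      a = proj₁ A-escape
      b = proj₁ B-escape
      a∈ : a ∈ C∖D
      a∈ = proj₁ (proj₂ A-escape)
      b∈ : b ∈ D∖C
      b∈ = proj₁ (proj₂ B-escape)
      a∉S : a Subset.∉ S
      a∉S a∈S with ∈-++⁻ common (∈-fromList⁻ {xs = common ++ U} a∈S)
      ... | inj₁ shared = proj₂ (∈-filter⁻ (λ z → ¬? (z ∈? D)) {xs = C} a∈) (proj₂ (∈-filter⁻ (_∈? D) {xs = C} shared))
      ... | inj₂ a∈U = proj₂ (proj₂ A-escape) a∈U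
      b∉S : b Subset.∉ S
      b∉S b∈S with ∈-++⁻ common (∈-fromList⁻ {xs = common ++ U} b∈S)
      ... | inj₁ shared = proj₂ (∈-filter⁻ (λ z → ¬? (z ∈? C)) {xs = D} b∈) (proj₁ (∈-filter⁻ (_∈? D) {xs = C} shared))
      ... | inj₂ b∈U = proj₂ (proj₂ B-escape) b∈U
      w : ∃ λ (p : Star (Edge E) a b) → ∀ {z} → z ∈ vertices p → z Subset.∉ S
      w = walk-in-E (λ z∈ → ∈-fromList⁺ (∈-++⁺ˡ z∈)) (proj₂ connected S S<r a b a∉S b∉S)
      meets : (∃ λ s → s ∈ U × s ∈ vertices (proj₁ w)) → ⊥
      meets (s , s∈U , s∈w) = proj₂ w s∈w (∈-fromList⁺ (∈-++⁺ʳ common s∈U))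

    unshared : ∀ {u v} → ¬ Shared u → (p : Star (Edge E) u v) → ∀ {z} → z ∈ vertices p → ¬ Shared z
    unshared u∉ ε       (here refl) = u∉
    unshared u∉ (_ ◅ _) (here refl) = u∉
    unshared u∉ (e ◅ p) (there z∈)  = unshared (proj₂ (proj₂ (E⁻ e))) p z∈

    bridges : ¬ ¬ Bridges C D (r ∸ m)
    bridges ret = MengerTheorem.menger Fin._≟_ (length E) E refl C∖D D∖C (r ∸ m) separators-large λ l →
      ret (linkage⇒bridges C D (λ e → proj₁ (E⁻ e)) (λ z∈ → proj₁ (∈-filter⁻ (λ z → ¬? (z ∈? D)) {xs = C} z∈))
             (λ z∈ → proj₁ (∈-filter⁻ (λ z → ¬? (z ∈? C)) {xs = D} z∈)) l
             (λ i z∈ z∈C z∈D → unshared (λ { (_ , s∈D) → proj₂ (∈-filter⁻ (λ z → ¬? (z ∈? D)) {xs = C} (Linkage.src∈ l i)) s∈D })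
                (Linkage.walk l i) z∈ (z∈C , z∈D)))

  ¬¬bridges : ¬ ¬ Bridges C D (r ∸ m)
  ¬¬bridges ret = ¬¬-∀Fin (λ u → ¬¬-∀Fin (λ w → ¬¬-excluded-middle)) λ adj? → bridges adj? ret

  module _ {k} (br : Bridges C D k) where

    open Bridges br
    open TwoLongest longC longD br
    open C→D using (x; y; P; Q)

    label≤hits : ∀ K L {z} → z ∈ L → label K L z ≤ hits K L
    label≤hits K L {z} z∈ with post , eq ← split-at z∈ = ≤-trans (m≤m+n _ _)
      (≤-reflexive (trans (sym (hits-++ K (before z L) (z ∷ post))) (cong (hits K) (sym eq))))

    P≤m : ∀ i → P i ≤ m
    P≤m i = label≤hits D C (c∈C i)

    Q≤m : ∀ i → Q i ≤ m
    Q≤m i = ≤-trans (label≤hits C D (d∈D i)) hits-C≤m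

    bridge-bound : ∀ {L} .{{_ : NonZero L}} → k ≤ 2 ^ L → k * k ≤ edge-constant * (suc m * suc m * suc m * (L * L))
    bridge-bound k≤ = SegmentBound.segment-bound k≤ x y P Q
      (λ {i} {j} eq → c-inj (pos-injective C→D.uC (c∈C i) (c∈C j) eq))
      (λ {i} {j} eq → d-inj (pos-injective C→D.uD (d∈D i) (d∈D j) eq))
      -- Labels run from 0 to `m`, so there are `suc m` segments on either cycle.
      (λ i → s≤s (P≤m i)) (λ i → s≤s (Q≤m i)) bridges-simple bridges-not-aligned

    -- Without shared vertices all bridges have the same pair of labels, and (1) leaves only one.
    -- For `r` ≥ 2 this rules out disjoint longest cycles.
    few-bridges : m ≡ 0 → k ≤ 1
    few-bridges m≡0 = ≮⇒≥ two
      where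
      same : ∀ {a b} (f : Fin k → ℕ) → (∀ i → f i ≤ m) → f a ≡ f b
      same {a} {b} f f≤ = trans (n≤0⇒n≡0 (subst (f a ≤_) m≡0 (f≤ a))) (sym (n≤0⇒n≡0 (subst (f b ≤_) m≡0 (f≤ b))))
      two : ¬ (1 < k)
      two (s≤s (s≤s _)) with () ← bridges-simple {Fin.zero} {Fin.suc Fin.zero} (same P P≤m) (same Q Q≤m)

-- Eliminating the logarithm

^-distribʳ-* : ∀ a b k → (a * b) ^ k ≡ a ^ k * b ^ k
^-distribʳ-* a b zero    = refl
^-distribʳ-* a b (suc k) rewrite ^-distribʳ-* a b k =
  solve 4 (λ a b x y → a :* b :* (x :* y) := a :* x :* (b :* y)) refl a b (a ^ k) (b ^ k)

^-cancel-≤ : ∀ {a b} k → a ^ suc k ≤ b ^ suc k → a ≤ b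
^-cancel-≤ {a} {b} k le with a ≤? b
... | yes a≤b = a≤b
... | no a≰b  = ⊥-elim (<⇒≱ (^-monoˡ-< (suc k) (≰⇒> a≰b)) le)

nearby-power : ∀ b → 2 ≤ b → ∀ k → ∃ λ j → 1 ≤ j × suc k ≤ b ^ j × b ^ j ≤ b * suc k
nearby-power b 2≤b zero = 1 , ≤-refl , ≤-trans (≤-trans (s≤s z≤n) 2≤b) (≤-reflexive (sym (*-identityʳ b))) , ≤-refl
nearby-power b 2≤b (suc k) with j , 1≤j , lo , hi ← nearby-power b 2≤b k with suc (suc k) ≤? b ^ j
... | yes fits = j , 1≤j , fits , ≤-trans hi (*-monoʳ-≤ b (n≤1+n (suc k)))
... | no  full = suc j , s≤s z≤n
               , (begin
                   suc (suc k)     ≤⟨ s≤s (s≤s (m≤m+n k (k + 0))) ⟩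
                   suc (suc (k + (k + 0))) ≤⟨ s≤s (≤-reflexive (sym (+-suc k (k + 0)))) ⟩
                   2 * suc k       ≤⟨ *-mono-≤ 2≤b lo ⟩
                   b * b ^ j ∎)
               , *-monoʳ-≤ b (<⇒≤ (≰⇒> full))
  where open ≤-Reasoning

n<2^n : ∀ n → n < 2 ^ n
n<2^n zero    = s≤s z≤n
n<2^n (suc n) = begin
  suc (suc n)     ≡⟨ +-comm 1 (suc n) ⟩
  suc n + 1       ≤⟨ +-mono-≤ (n<2^n n) (≤-trans (m^n>0 2 n) (≤-reflexive (sym (+-identityʳ (2 ^ n))))) ⟩
  2 * 2 ^ n ∎
  where open ≤-Reasoning

-- `L` is `p * j`, where `(2 ^ p) ^ j` exceeds `suc k` by a factor of at most `2 ^ p`. The bound on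
-- `L ^ p` comes from `j` ≤ `2 ^ j`.
dyadic-scale : ∀ p .{{_ : NonZero p}} k → ∃ λ L → NonZero L × suc k ≤ 2 ^ L × L ^ p ≤ p ^ p * 2 ^ p * suc k
dyadic-scale p k with j , 1≤j , lo , hi ← nearby-power (2 ^ p) (≤-trans (≤-reflexive (sym (^-identityʳ 2))) (^-monoʳ-≤ 2 (>-nonZero⁻¹ p))) k =
  p * j , >-nonZero (*-mono-≤ (>-nonZero⁻¹ p) 1≤j) , ≤-trans lo (≤-reflexive (^-*-assoc 2 p j)) , (begin
    (p * j) ^ p             ≡⟨ ^-distribʳ-* p j p ⟩
    p ^ p * j ^ p           ≤⟨ *-monoʳ-≤ (p ^ p) (^-monoˡ-≤ p (<⇒≤ (n<2^n j))) ⟩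
    p ^ p * (2 ^ j) ^ p     ≡⟨ cong (p ^ p *_) (trans (^-*-assoc 2 j p) (trans (cong (2 ^_) (*-comm j p)) (sym (^-*-assoc 2 p j)))) ⟩
    p ^ p * (2 ^ p) ^ j     ≤⟨ *-monoʳ-≤ (p ^ p) hi ⟩
    p ^ p * (2 ^ p * suc k) ≡⟨ sym (*-assoc (p ^ p) (2 ^ p) (suc k)) ⟩
    p ^ p * 2 ^ p * suc k ∎)
  where open ≤-Reasoning

-- The eighth power of the edge bound contains L¹⁶, which is traded for one factor `K`. This leaves
-- K¹⁵ against M²⁴, and a cube root gives the exponents 5 and 8; hence the exponent 16 for the
-- logarithm.
eliminate-scale : ∀ a c K .{{_ : NonZero K}} M L → 1 ≤ a ^ 8 * c → K * K ≤ a * (M * M * M * (L * L)) → L ^ 16 ≤ c * K →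
                  K ^ 5 ≤ a ^ 8 * c * M ^ 8
eliminate-scale a c K M L 1≤e sq scale = ^-cancel-≤ 2 (begin
  (K ^ 5) ^ 3 ≡⟨ ^-*-assoc (K) 5 3 ⟩
  K ^ 15      ≤⟨ *-cancelˡ-≤ (K) sixteenth ⟩
  e * M ^ 24      ≤⟨ *-monoˡ-≤ (M ^ 24) cube ⟩
  e ^ 3 * M ^ 24  ≡⟨ cong (e ^ 3 *_) (sym (^-*-assoc M 8 3)) ⟩
  e ^ 3 * (M ^ 8) ^ 3 ≡⟨ sym (^-distribʳ-* e (M ^ 8) 3) ⟩
  (e * M ^ 8) ^ 3 ∎)
  where
  open ≤-Reasoning
  e = a ^ 8 * c
  cube : e ≤ e ^ 3
  cube = begin
    e           ≡⟨ sym (*-identityʳ e) ⟩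
    e * 1       ≤⟨ *-monoʳ-≤ e (*-mono-≤ 1≤e (*-mono-≤ 1≤e ≤-refl)) ⟩
    e ^ 3 ∎
  sixteenth : K * K ^ 15 ≤ K * (e * M ^ 24)
  sixteenth = begin
    K ^ 16              ≡⟨ sym (^-*-assoc (K) 2 8) ⟩
    (K ^ 2) ^ 8         ≤⟨ ^-monoˡ-≤ 8 (≤-trans (≤-reflexive (cong (K *_) (*-identityʳ (K)))) sq) ⟩
    (a * (M * M * M * (L * L))) ^ 8
      ≡⟨ cong (λ z → (a * z) ^ 8) (cong₂ _*_
           (solve 1 (λ M → M :* M :* M := M :* (M :* (M :* con 1))) refl M) (solve 1 (λ L → L :* L := L :* (L :* con 1)) refl L)) ⟩
    (a * (M ^ 3 * L ^ 2)) ^ 8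
      ≡⟨ trans (^-distribʳ-* a (M ^ 3 * L ^ 2) 8) (cong (a ^ 8 *_) (trans (^-distribʳ-* (M ^ 3) (L ^ 2) 8)
           (cong₂ _*_ (^-*-assoc M 3 8) (^-*-assoc L 2 8)))) ⟩
    a ^ 8 * (M ^ 24 * L ^ 16) ≤⟨ *-monoʳ-≤ (a ^ 8) (*-monoʳ-≤ (M ^ 24) scale) ⟩
    a ^ 8 * (M ^ 24 * (c * K))
      ≡⟨ solve 4 (λ a m c k → a :* (m :* (c :* k)) := k :* (a :* c :* m)) refl (a ^ 8) (M ^ 24) c (K) ⟩
    K * (e * M ^ 24) ∎

-- If `r` ≤ 2m, the bound is crude. Otherwise `m` ≤ `K`, so `r` ≤ 2K and the edge count applies,
-- with `suc m` ≤ 2m. `t` takes the place of 2.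
bound-from-edge-count : ∀ t e r K m → 2 ≤ t → 1 ≤ e → 1 ≤ m → r ≤ K + m → K ^ 5 ≤ e * suc m ^ 8 → r ^ 5 ≤ (suc (t ^ 5 * t ^ 8 * e) * m) ^ 8
bound-from-edge-count t e r K m 2≤t 1≤e 1≤m r≤ bound = le (r ≤? m + m)
  where
  open ≤-Reasoning
  E = t ^ 5 * t ^ 8 * e
  1≤t : 1 ≤ t
  1≤t = ≤-trans (s≤s z≤n) 2≤t
  instance
    t≢0 : NonZero t
    t≢0 = >-nonZero 1≤t
  1≤tm : 1 ≤ t * m
  1≤tm = *-mono-≤ 1≤t 1≤m
  2m≤tm : m + m ≤ t * m
  2m≤tm = ≤-trans (≤-reflexive (cong (m +_) (sym (+-identityʳ m)))) (*-monoˡ-≤ m 2≤t)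
  t≤E : t ≤ E
  t≤E = begin
    t                   ≡⟨ solve 1 (λ t → t := t :* con 1 :* con 1 :* con 1) refl t ⟩
    t * 1 * 1 * 1       ≤⟨ *-mono-≤ (*-mono-≤ (*-monoʳ-≤ t (m^n>0 t 4)) (m^n>0 t 8)) 1≤e ⟩
    E ∎
  le : Dec (r ≤ m + m) → r ^ 5 ≤ (suc E * m) ^ 8
  le (yes small) = begin
    r ^ 5           ≤⟨ ^-monoˡ-≤ 5 (≤-trans small 2m≤tm) ⟩
    (t * m) ^ 5     ≤⟨ ^-monoʳ-≤ (t * m) {{>-nonZero 1≤tm}} {5} {8} (s≤s (s≤s (s≤s (s≤s (s≤s z≤n))))) ⟩
    (t * m) ^ 8     ≤⟨ ^-monoˡ-≤ 8 (*-monoˡ-≤ m (≤-trans t≤E (n≤1+n E))) ⟩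
    (suc E * m) ^ 8 ∎
  le (no large) = begin
    r ^ 5                         ≤⟨ ^-monoˡ-≤ 5 r≤tK ⟩
    (t * K) ^ 5                   ≡⟨ ^-distribʳ-* t K 5 ⟩
    t ^ 5 * K ^ 5                 ≤⟨ *-monoʳ-≤ (t ^ 5) bound ⟩
    t ^ 5 * (e * suc m ^ 8)       ≤⟨ *-monoʳ-≤ (t ^ 5) (*-monoʳ-≤ e (^-monoˡ-≤ 8 (≤-trans (+-monoˡ-≤ m 1≤m) 2m≤tm))) ⟩
    t ^ 5 * (e * (t * m) ^ 8)     ≡⟨ cong (λ z → t ^ 5 * (e * z)) (^-distribʳ-* t m 8) ⟩
    t ^ 5 * (e * (t ^ 8 * m ^ 8)) ≡⟨ solve 4 (λ a e b x → a :* (e :* (b :* x)) := a :* b :* e :* x) refl (t ^ 5) e (t ^ 8) (m ^ 8) ⟩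
    E * m ^ 8                     ≤⟨ *-monoˡ-≤ (m ^ 8) (≤-trans (n≤1+n E) (≤-trans (≤-reflexive (sym (^-identityʳ (suc E))))
                                       (^-monoʳ-≤ (suc E) {1} {8} (s≤s z≤n)))) ⟩
    suc E ^ 8 * m ^ 8             ≡⟨ sym (^-distribʳ-* (suc E) m 8) ⟩
    (suc E * m) ^ 8 ∎
    where
    m≤K : m ≤ K
    m≤K = +-cancelʳ-≤ m m K (≤-trans (<⇒≤ (≰⇒> large)) r≤)
    r≤tK : r ≤ t * K
    r≤tK = ≤-trans r≤ (≤-trans (+-monoʳ-≤ K m≤K) (≤-trans (≤-reflexive (cong (K +_) (sym (+-identityʳ K)))) (*-monoˡ-≤ K 2≤t)))

-- `t` and `c` will be 2 and `16 ^ 16 * 2 ^ 16`; as variables they stay opaque inside the large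
-- powers.
intersection-bound : ∀ t c → 2 ≤ t → 1 ≤ c →
  (∀ k → ∃ λ L → NonZero L × suc k ≤ 2 ^ L × L ^ 16 ≤ c * suc k) →
  ∃ λ (q : ℕ) → ∀ (r : ℕ) → 2 ≤ r → (G : Graph) → Connectedness G r → (C₁ C₂ : List (Fin (n G))) →
    IsLongestCycle G C₁ → IsLongestCycle G C₂ → r ^ 5 ≤ (suc q * commonVertices C₁ C₂) ^ 8
intersection-bound t c 2≤t 1≤c scale = t ^ 5 * t ^ 8 * (edge-constant ^ 8 * c) , λ r 2≤r G connected C D longC longD →
  decidable-stable (_ ≤? _) λ ¬goal →
    Intersection.¬¬bridges G connected C D longC longD λ br → ¬goal (goal r 2≤r G connected C D longC longD br)
  where
  a = edge-constant

  1≤a⁸c : 1 ≤ a ^ 8 * c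
  1≤a⁸c = *-mono-≤ {1} {a ^ 8} (m^n>0 a {{>-nonZero 1≤edge-constant}} 8) 1≤c

  fifth-power : ∀ K m → (∀ {L} .{{_ : NonZero L}} → K ≤ 2 ^ L → K * K ≤ edge-constant * (m * m * m * (L * L))) → K ^ 5 ≤ a ^ 8 * c * m ^ 8
  fifth-power zero    m bound = z≤n
  fifth-power (suc k) m bound with L , L≢0 , k< , L≤ ← scale k =
    eliminate-scale a c (suc k) m L 1≤a⁸c (bound {L} {{L≢0}} k<) L≤

  goal : ∀ r → 2 ≤ r → (G : Graph) (connected : Connectedness G r) (C D : List (Fin (n G)))
    (longC : IsLongestCycle G C) (longD : IsLongestCycle G D) → Cycles.Bridges G C D (r ∸ commonVertices C D) →
    r ^ 5 ≤ (suc (t ^ 5 * t ^ 8 * (a ^ 8 * c)) * commonVertices C D) ^ 8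
  goal r 2≤r G connected C D longC longD br = by-size (commonVertices C D) refl
    where
    module I = Intersection G connected C D longC longD
    by-size : ∀ m → m ≡ commonVertices C D → r ^ 5 ≤ (suc (t ^ 5 * t ^ 8 * (a ^ 8 * c)) * m) ^ 8
    -- With `m` = 0 there would be `r` ≥ 2 bridges, more than `few-bridges` admits.
    by-size zero    eq = ⊥-elim (<⇒≱ 2≤r (subst (λ z → r ∸ z ≤ 1) (sym eq) (I.few-bridges br (sym eq))))
    by-size (suc m) eq = bound-from-edge-count t (a ^ 8 * c) r (r ∸ suc m) (suc m) 2≤t 1≤a⁸c (s≤s z≤n)
      (≤-trans (m≤n+m∸n r (suc m)) (≤-reflexive (+-comm (suc m) (r ∸ suc m))))
      (fifth-power (r ∸ suc m) (suc (suc m)) λ {L} k≤ →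
        subst (λ z → (r ∸ z) * (r ∸ z) ≤ edge-constant * (suc z * suc z * suc z * (L * L))) (sym eq)
          (I.bridge-bound br (subst (λ z → r ∸ z ≤ 2 ^ L) eq k≤)))

theorem1p3 : ∃ λ (q : ℕ) → ∀ (r : ℕ) → 2 ≤ r → (G : Graph) → Connectedness G r → (C₁ C₂ : List (Fin (n G))) → IsLongestCycle G C₁ → IsLongestCycle G C₂ → r ^ 5 ≤ (suc q * commonVertices C₁ C₂) ^ 8
theorem1p3 = intersection-bound 2 (16 ^ 16 * 2 ^ 16) ≤-refl
  (*-mono-≤ {1} {16 ^ 16} {1} {2 ^ 16} (m^n>0 16 16) (m^n>0 2 16)) (dyadic-scale 16)
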